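{- For any integers $m\geq 1$ and $1\le \ell\le m+1$, the subgraph of the $(2m+1)$-dimensional hypercube $Q_{2m+1}$ induced by the middle $2\ell$ levels, i.e., by all bitstrings of length $2m+1$ having at least $m+1-\ell$ and at most $m+\ell$ entries equal to 1, has a Hamilton cycle.
   Context: The $n$-dimensional hypercube $Q_n$ is the graph whose vertices are all $\{0,1\}$-strings of length $n$, two strings being adjacent if they differ in exactly one bit. Level $k$ of $Q_n$ is the set of bitstrings with exactly $k$ entries equal to 1. -}

module Defs where

open import Data.Nat using (ℕ; zero; suc; _+_; _∸_; _*_; _≤_; _<_; _≡ᵇ_)
open import Data.Bool using (Bool; true; false; if_then_else_)
open import Data.Vec using (Vec; []; _∷_)
open import Data.Fin using (Fin; zero; suc; inject₁; fromℕ)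
open import Data.Product using (Σ; _×_; ∃-syntax)
open import Relation.Binary.PropositionalEquality using (_≡_)

Bitstring : ℕ → Set
Bitstring n = Vec Bool n

weight : ∀ {n} → Bitstring n → ℕ
weight [] = 0
weight (true ∷ xs) = suc (weight xs)
weight (false ∷ xs) = weight xs

hamming : ∀ {n} → Bitstring n → Bitstring n → ℕ
hamming [] [] = 0
hamming (x ∷ xs) (y ∷ ys) = (if (eqb x y) then 0 else 1) + hamming xs ys
  where
  eqb : Bool → Bool → Bool
  eqb true true = true
  eqb false false = true
  eqb _ _ = false

Adjacent : ∀ {n} → Bitstring n → Bitstring n → Set
Adjacent x y = hamming x y ≡ 1

record HamiltonCycle {n : ℕ} (P : Bitstring n → Set) : Set where
  field
    k       : ℕ
    cyc     : Fin (3 + k) → Bitstring n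
    inP     : ∀ i → P (cyc i)
    injective : ∀ i j → cyc i ≡ cyc j → i ≡ j
    covers  : ∀ x → P x → ∃[ i ] (cyc i ≡ x)
    step    : ∀ (i : Fin (2 + k)) → Adjacent (cyc (inject₁ i)) (cyc (suc i))
    close   : Adjacent (cyc (fromℕ (2 + k))) (cyc zero)

MiddleLevels : (m ℓ : ℕ) → Bitstring (suc (2 * m)) → Set
MiddleLevels m ℓ x = (suc m ∸ ℓ ≤ weight x) × (weight x ≤ m + ℓ)

{-# OPTIONS --safe #-}

-- Read 0 as an opening and 1 as a closing bracket, and let B(m,λ) be the set of words of length 2m+1 in the middle
-- 2λ+2 levels. If two opposite edges of a 4-cycle lie on different cycles, exchanging them for the other two edges
-- joins these cycles. So a Hamilton cycle of B(m,λ) arises from disjoint cycles covering B(m,λ) and a family of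
-- 4-cycles which use every edge of the cycles at most once and connect all cycles. For the induction, certain edges
-- of the Hamilton cycle are kept out of these exchanges.
--
-- For λ = 0, moving a marked bit cyclically through a Dyck word gives the cycles of the "book proof" of the middle
-- levels theorem. Along a cycle the Dyck word X0u1 turns into 0X1u, and exchanges along 6-cycles connect v0u011 with
-- v0u101; these two moves connect all Dyck words of equal length.
--
-- For λ = μ+1, the words z0v0B with Dyck words v, B and z in B(k,μ), k ≥ 1, are covered by copies of the Hamilton
-- cycle of B(k,μ); the words S1z, where S has 2μ+1 unmatched ones and no unmatched zeros and z is in B(k,0), are
-- covered by copies of the Hamilton cycle of B(k,0); the remaining words form 4-cycles, by changing two bits, and
-- single edges, which count as cycles of length two. The case μ = 0 differs in how the short cycles are chosen.

module Submission where

open import Defs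
open import Data.Bool using (Bool; true; false; not)
open import Data.Bool.Properties using () renaming (_≟_ to _≟ᵇ_)
open import Data.Empty using (⊥; ⊥-elim)
open import Data.Fin as Fin using (inject₁; fromℕ)
open import Data.List using (List; []; _∷_; _++_; [_]; length; lookup; map; concatMap; filter)
open import Data.List.Membership.Propositional using (_∈_)
open import Data.List.Membership.Propositional.Properties using (∈-++⁺ˡ; ∈-++⁺ʳ; ∈-++⁻; ∈-concat⁻; ∈-concat⁺; ∈-map⁺; ∈-map⁻; ∈-filter⁺; ∈-filter⁻; ∈-lookup)
open import Data.List.Properties using (≡-dec; ∷-injective; ++-assoc; ++-identityʳ; ++-cancelʳ; map-id; map-∘; concatMap-map; concatMap-cong)
open import Data.List.Relation.Binary.Permutation.Propositional renaming (trans to _then_)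
open import Data.List.Relation.Binary.Permutation.Propositional.Properties using (∈-resp-↭; Any-resp-↭; drop-∷; shift; shifts; ++⁺ˡ; ++⁺ʳ; ++⁺; ↭-length; ++-commutativeMonoid) renaming (map⁺ to ↭-map⁺; ++-assoc to ↭-++-assoc; ++-comm to ↭-++-comm)
open import Data.List.Relation.Unary.All as All using (All; []; _∷_)
open import Data.List.Relation.Unary.AllPairs using ([]; _∷_)
open import Data.List.Relation.Unary.Any as Any using (Any; here; there)
open import Data.List.Relation.Unary.Any.Properties using (lookup-index) renaming (map⁺ to Any-map⁺; map⁻ to Any-map⁻)
open import Data.List.Relation.Unary.Unique.Propositional using (Unique)
open import Data.Nat using (ℕ; zero; suc; _+_; _*_; _∸_; _≤_; _<_; z≤n; s≤s; _≤?_; _<?_; _≟_)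
open import Data.Nat.Properties
open import Data.Nat.Tactic.RingSolver using (solve-∀)
open import Data.Product using (Σ; ∃; _×_; _,_; proj₁; proj₂)
open import Data.Sum using (_⊎_; inj₁; inj₂; map₂)
open import Data.Vec using (Vec; []; _∷_; toList)
open import Function using (_∘_; id)
open import Relation.Binary.Definitions using (DecidableEquality)
open import Relation.Binary.PropositionalEquality hiding ([_])
open import Relation.Binary.PropositionalEquality.WithK using () renaming (≡-irrelevant to uip)
open import Relation.Nullary using (¬_; Dec; yes; no)
open import Relation.Nullary.Decidable using (_×-dec_; recompute)
open import Relation.Unary using (Decidable)
import Algebra.Solver.CommutativeMonoid
import Data.List.Membership.DecPropositional
import Data.List.Relation.Binary.Permutation.Setoid.Properties
import Data.List.Relation.Unary.Unique.Propositional.Properties as Uniqueₚ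

-- Bracket words

-- The Hamilton cycles supplied by the induction are known only to exist, so a copy of one can be
-- joined to other cycles only along edges that are guaranteed to lie on it. This is why the
-- induction hypothesis names edges of the cycle: *z and 00u* in general, x*w and 10x* for two
-- levels, where * is the changing bit. Each edge of a short cycle is either spent on one exchange,
-- or promised to the next stage, or left alone.
--
-- Two adjacent levels contain no 4-cycle, hence the 6-cycles for λ = 0. Two of the three edges
-- given up in such an exchange begin and end an arc of six edges; this arc is treated as one edge
-- with inner vertices, which gives the exchange the shape of a 4-cycle.
--
-- That exchanges do not compete for edges is not proved by comparing them: every step of a cycle is
-- built with at most one label, which names the exchange that owns it. Nor is a spanning tree of
-- exchanges chosen. The proof that all classes are connected is a piece of data; the exchanges
-- occurring in it are performed one by one, and those whose edges already lie on one cycle are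
-- omitted.

V : Set
V = List Bool

pattern O = false
pattern I = true

O≢I : O ≢ I
O≢I ()

data Adj : V → V → Set where
  up   : ∀ {x} → Adj (O ∷ x) (I ∷ x)
  down : ∀ {x} → Adj (I ∷ x) (O ∷ x)
  _∷_  : ∀ b {x y} → Adj x y → Adj (b ∷ x) (b ∷ y)

Adj-sym : ∀ {x y} → Adj x y → Adj y x
Adj-sym up = down
Adj-sym down = up
Adj-sym (b ∷ p) = b ∷ Adj-sym p

Adj-++ : ∀ {x y} s → Adj x y → Adj (x ++ s) (y ++ s)
Adj-++ s up = up
Adj-++ s down = down
Adj-++ s (b ∷ p) = b ∷ Adj-++ s p

dbl : ℕ → ℕ
dbl zero = zero
dbl (suc n) = suc (suc (dbl n))

-- Dyck words, with 0 as the opening and 1 as the closing bracket: X ▷ u is X0u1.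
data D : Set where
  ε : D
  _▷_ : D → D → D
infixl 6 _▷_

-- The second argument is the text that follows the word, so nested words need no reassociation of
-- `++`.
⟦_⟧ : D → V → V
⟦ ε ⟧ k = k
⟦ X ▷ u ⟧ k = ⟦ X ⟧ (O ∷ ⟦ u ⟧ (I ∷ k))

sz : D → ℕ
sz ε = 0
sz (X ▷ u) = suc (sz X + sz u)

cat : D → D → D
cat c ε = c
cat c (X ▷ u) = cat c X ▷ u

-- The word 0p1q, split at its first factor, whereas `_▷_` splits off the last one. Both views are
-- needed, since exchanges change bits at either end of a Dyck word.
cons : D → D → D
cons p ε = ε ▷ p
cons p (q ▷ u) = cons p q ▷ u

⟦cons⟧ : ∀ p q k → ⟦ cons p q ⟧ k ≡ O ∷ ⟦ p ⟧ (I ∷ ⟦ q ⟧ k)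
⟦cons⟧ p ε k = refl
⟦cons⟧ p (q ▷ u) k = ⟦cons⟧ p q _

cat-ε : ∀ d → cat ε d ≡ d
cat-ε ε = refl
cat-ε (X ▷ u) = cong (_▷ u) (cat-ε X)

⟦⟧-++ : ∀ d k s → ⟦ d ⟧ k ++ s ≡ ⟦ d ⟧ (k ++ s)
⟦⟧-++ ε k s = refl
⟦⟧-++ (X ▷ u) k s = trans (⟦⟧-++ X _ s) (cong (λ z → ⟦ X ⟧ (O ∷ z)) (⟦⟧-++ u _ s))

⟦⟧-adj : ∀ d {x y} → Adj x y → Adj (⟦ d ⟧ x) (⟦ d ⟧ y)
⟦⟧-adj ε p = p
⟦⟧-adj (X ▷ u) p = ⟦⟧-adj X (O ∷ ⟦⟧-adj u (I ∷ p))

data First : D → Set where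
  none : First ε
  some : ∀ p q → First (cons p q)

first : ∀ d → First d
first ε = none
first (X ▷ u) with first X
... | none = some u ε
... | some p q = some p (q ▷ u)

first-cons : ∀ p q → first (cons p q) ≡ some p q
first-cons p ε = refl
first-cons p (q ▷ u) rewrite first-cons p q = refl

-- L = d₀1d₁1…1dₙ with Dyck words dᵢ: the words without unmatched zeros that have n unmatched ones.
data Bal : ℕ → Set where
  ⌈_⌉ : D → Bal 0
  _▸_ : ∀ {n} → Bal n → D → Bal (suc n)
infixl 5 _▸_

⟦_⟧ᴮ : ∀ {n} → Bal n → V → V
⟦ ⌈ d ⌉ ⟧ᴮ k = ⟦ d ⟧ k
⟦ L ▸ d ⟧ᴮ k = ⟦ L ⟧ᴮ (I ∷ ⟦ d ⟧ k)

szᴮ : ∀ {n} → Bal n → ℕ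
szᴮ ⌈ d ⌉ = sz d
szᴮ (L ▸ d) = szᴮ L + sz d

⟦⟧ᴮ-++ : ∀ {n} (L : Bal n) k s → ⟦ L ⟧ᴮ k ++ s ≡ ⟦ L ⟧ᴮ (k ++ s)
⟦⟧ᴮ-++ ⌈ d ⌉ k s = ⟦⟧-++ d k s
⟦⟧ᴮ-++ (L ▸ d) k s = trans (⟦⟧ᴮ-++ L _ s) (cong (λ z → ⟦ L ⟧ᴮ (I ∷ z)) (⟦⟧-++ d k s))

⟦⟧ᴮ-adj : ∀ {n} (L : Bal n) {x y} → Adj x y → Adj (⟦ L ⟧ᴮ x) (⟦ L ⟧ᴮ y)
⟦⟧ᴮ-adj ⌈ d ⌉ p = ⟦⟧-adj d p
⟦⟧ᴮ-adj (L ▸ d) p = ⟦⟧ᴮ-adj L (I ∷ ⟦⟧-adj d p)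

_⊳_ : ∀ {n} → Bal n → D → Bal n
⌈ d ⌉ ⊳ u = ⌈ d ▷ u ⌉
(L ▸ d) ⊳ u = L ▸ (d ▷ u)
infixl 5 _⊳_

⟦⊳⟧ : ∀ {n} (L : Bal n) u k → ⟦ L ⊳ u ⟧ᴮ k ≡ ⟦ L ⟧ᴮ (O ∷ ⟦ u ⟧ (I ∷ k))
⟦⊳⟧ ⌈ d ⌉ u k = refl
⟦⊳⟧ (L ▸ d) u k = refl

_⊕_ : ∀ {n} → Bal n → D → Bal n
⌈ d ⌉ ⊕ c = ⌈ cat d c ⌉
(L ▸ d) ⊕ c = L ▸ cat d c
infixl 5 _⊕_

push1 : ∀ {n} → Bal n → Bal (suc n)
push1 ⌈ d ⌉ = ⌈ ε ⌉ ▸ d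
push1 (L ▸ d) = push1 L ▸ d

-- A 0 put in front is matched with the first unmatched one, so the number of unmatched ones drops.
push0 : ∀ {n} → Bal (suc n) → Bal n
push0 (⌈ p ⌉ ▸ q) = ⌈ cons p q ⌉
push0 (L ▸ d ▸ e) = push0 (L ▸ d) ▸ e

⟦push1⟧ : ∀ {n} (L : Bal n) k → ⟦ push1 L ⟧ᴮ k ≡ I ∷ ⟦ L ⟧ᴮ k
⟦push1⟧ ⌈ d ⌉ k = refl
⟦push1⟧ (L ▸ d) k = ⟦push1⟧ L _

⟦push0⟧ : ∀ {n} (L : Bal (suc n)) k → ⟦ push0 L ⟧ᴮ k ≡ O ∷ ⟦ L ⟧ᴮ k
⟦push0⟧ (⌈ p ⌉ ▸ q) k = ⟦cons⟧ p q k
⟦push0⟧ (L ▸ d ▸ e) k = ⟦push0⟧ (L ▸ d) _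

data Front : ∀ {n} → Bal n → Set where
  empty : Front ⌈ ε ⌉
  one   : ∀ {n} (y : Bal n) → Front (push1 y)
  nil   : ∀ {n} (y : Bal (suc n)) → Front (push0 y)

front : ∀ {n} (L : Bal n) → Front L
front ⌈ d ⌉ with first d
... | none = empty
... | some p q = nil (⌈ p ⌉ ▸ q)
front (L ▸ d) with front L
... | empty = one ⌈ d ⌉
... | one y = one (y ▸ d)
... | nil (y ▸ c) = nil (y ▸ c ▸ d)

front-one : ∀ {n} (y : Bal n) → front (push1 y) ≡ one y
front-one ⌈ d ⌉ = refl
front-one (y ▸ d) rewrite front-one y = refl

front-nil : ∀ {n} (y : Bal (suc n)) → front (push0 y) ≡ nil y
front-nil (⌈ p ⌉ ▸ q) rewrite first-cons p q = refl
front-nil (y ▸ c ▸ d) rewrite front-nil (y ▸ c) = refl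

-- Any word, as its unmatched ones followed by its unmatched zeros.
data Form : ℕ → ℕ → Set where
  lf  : ∀ {b} → Bal b → Form b 0
  _∙_ : ∀ {b a} → Form b a → D → Form b (suc a)
infixl 4 _∙_

str : ∀ {b a} → Form b a → V → V
str (lf L) k = ⟦ L ⟧ᴮ k
str (f ∙ d) k = str f (O ∷ ⟦ d ⟧ k)

SomeForm : Set
SomeForm = Σ ℕ λ b → Σ ℕ λ a → Form b a

pattern ⟨_⟩ f = _ , _ , f

snoc : SomeForm → Bool → SomeForm
snoc ⟨ f ⟩ O = ⟨ f ∙ ε ⟩
snoc ⟨ lf L ⟩ I = ⟨ lf (L ▸ ε) ⟩
snoc ⟨ lf L ∙ d ⟩ I = ⟨ lf (L ⊳ d) ⟩
snoc ⟨ f ∙ c ∙ d ⟩ I = ⟨ f ∙ (c ▷ d) ⟩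

run : SomeForm → V → SomeForm
run f [] = f
run f (c ∷ x) = run (snoc f c) x

strˢ : SomeForm → V → V
strˢ ⟨ f ⟩ = str f

str-snoc : ∀ f c k → strˢ (snoc f c) k ≡ strˢ f (c ∷ k)
str-snoc ⟨ f ⟩ O k = refl
str-snoc ⟨ lf L ⟩ I k = refl
str-snoc ⟨ lf L ∙ d ⟩ I k = ⟦⊳⟧ L d k
str-snoc ⟨ f ∙ c ∙ d ⟩ I k = refl

str-run : ∀ f x → strˢ (run f x) [] ≡ strˢ f x
str-run f [] = refl
str-run f (c ∷ x) = trans (str-run (snoc f c) x) (str-snoc f c x)

parse : V → SomeForm
parse = run ⟨ lf ⌈ ε ⌉ ⟩

str-parse : ∀ x → strˢ (parse x) [] ≡ x
str-parse = str-run ⟨ lf ⌈ ε ⌉ ⟩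

app : ∀ {b a} → Form b a → D → Form b a
app (lf L) d = lf (L ⊕ d)
app (f ∙ c) d = f ∙ cat c d

-- A Dyck word only extends the part that was read last: for X0u1 the 0 opens a part that collects
-- `u`, and the 1 merges it into the part before. With this, `parse` can be evaluated on words given
-- by their pieces.
run-D : ∀ {b a} (f : Form b a) d k → run ⟨ f ⟩ (⟦ d ⟧ k) ≡ run ⟨ app f d ⟩ k
run-D (lf ⌈ c ⌉) ε k = refl
run-D (lf (L ▸ c)) ε k = refl
run-D (f ∙ c) ε k = refl
run-D f (X ▷ u) k = trans (run-D f X _) (trans (run-D (app f X ∙ ε) u (I ∷ k)) (close f))
  where
  close : ∀ {b a} (f : Form b a) → run (snoc ⟨ app f X ∙ cat ε u ⟩ I) k ≡ run ⟨ app f (X ▷ u) ⟩ k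
  close f rewrite cat-ε u with f
  ... | lf ⌈ c ⌉ = refl
  ... | lf (L ▸ c) = refl
  ... | f′ ∙ c = refl

run-D′ : ∀ {b a} (f : Form b a) d k → run ⟨ f ∙ ε ⟩ (⟦ d ⟧ k) ≡ run ⟨ f ∙ d ⟩ k
run-D′ f d k = trans (run-D (f ∙ ε) d k) (cong (λ z → run ⟨ f ∙ z ⟩ k) (cat-ε d))

parse-B : ∀ {n} (L : Bal n) k → run ⟨ lf ⌈ ε ⌉ ⟩ (⟦ L ⟧ᴮ k) ≡ run ⟨ lf L ⟩ k
parse-B ⌈ d ⌉ k = trans (run-D (lf ⌈ ε ⌉) d k) (cong (λ z → run ⟨ lf ⌈ z ⌉ ⟩ k) (cat-ε d))
parse-B (L ▸ d) k = trans (parse-B L _)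
  (trans (run-D (lf (L ▸ ε)) d k) (cong (λ z → run ⟨ lf (L ▸ z) ⟩ k) (cat-ε d)))

run-++ : ∀ f x y → run f (x ++ y) ≡ run (run f x) y
run-++ f [] y = refl
run-++ f (c ∷ x) y = run-++ (snoc f c) x y

-- Exchanging edges of cycles

open Algebra.Solver.CommutativeMonoid (++-commutativeMonoid {A = V}) using (solve; _⊜_) renaming (_⊕_ to _⊞_)

module SetoidPerm {A : Set} = Data.List.Relation.Binary.Permutation.Setoid.Properties (setoid A)

Unique-resp-↭ : ∀ {A : Set} {xs ys : List A} → xs ↭ ys → Unique xs → Unique ys
Unique-resp-↭ p = SetoidPerm.Unique-resp-↭ (↭⇒↭ₛ p)

-- Walks are built from edges of a family E, each of which may carry some inner vertices; a label names an edge.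
record Sys : Set₁ where
  field
    E     : V → V → Set
    inn   : ∀ {a b} → E a b → List V
    rev   : ∀ {a b} → E a b → E b a
    inn-rev : ∀ {a b} (x : E a b) → inn (rev x) ↭ inn x
    Lab   : Set
    s t   : Lab → V
    e     : ∀ l → E (s l) (t l)

module Walks (S : Sys) where
  open Sys S public

  -- A step has at most one label and a label belongs to one exchange, so the disjointness of the
  -- exchanges is built into the cycles.
  data Step (a b : V) : Set where
    pl : E a b → Step a b
    fw : ∀ l → s l ≡ a → t l ≡ b → Step a b
    bw : ∀ l → t l ≡ a → s l ≡ b → Step a b

  innˢ : ∀ {a b} → Step a b → List V
  innˢ (pl x) = inn x
  innˢ (fw l _ _) = inn (e l)
  innˢ (bw l _ _) = inn (e l)

  labˢ : ∀ {a b} → Step a b → List Lab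
  labˢ (pl x) = []
  labˢ (fw l _ _) = [ l ]
  labˢ (bw l _ _) = [ l ]

  revˢ : ∀ {a b} → Step a b → Step b a
  revˢ (pl x) = pl (rev x)
  revˢ (fw l p q) = bw l q p
  revˢ (bw l p q) = fw l q p

  innˢ-rev : ∀ {a b} (x : Step a b) → innˢ (revˢ x) ↭ innˢ x
  innˢ-rev (pl x) = inn-rev x
  innˢ-rev (fw l _ _) = refl
  innˢ-rev (bw l _ _) = refl

  labˢ-rev : ∀ {a b} (x : Step a b) → labˢ (revˢ x) ≡ labˢ x
  labˢ-rev (pl x) = refl
  labˢ-rev (fw l _ _) = refl
  labˢ-rev (bw l _ _) = refl

  infixr 5 _∷ʷ_ _++ʷ_
  data Walk : V → V → Set where
    []   : ∀ {a} → Walk a a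
    _∷ʷ_ : ∀ {a b c} → Step a b → Walk b c → Walk a c

  -- The start is left out, so that a closed walk lists every passage through a vertex once and
  -- `Unique` expresses that it is a cycle.
  vs : ∀ {a b} → Walk a b → List V
  vs [] = []
  vs (_∷ʷ_ {b = b} x w) = innˢ x ++ b ∷ vs w

  labs : ∀ {a b} → Walk a b → List Lab
  labs [] = []
  labs (x ∷ʷ w) = labˢ x ++ labs w

  _++ʷ_ : ∀ {a b c} → Walk a b → Walk b c → Walk a c
  [] ++ʷ v = v
  (x ∷ʷ w) ++ʷ v = x ∷ʷ w ++ʷ v

  vs-++ : ∀ {a b c} (w : Walk a b) (v : Walk b c) → vs (w ++ʷ v) ↭ vs w ++ vs v
  vs-++ [] v = refl
  vs-++ (_∷ʷ_ {b = b} x w) v = ↭-trans (++⁺ˡ (innˢ x) (prep b (vs-++ w v)))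
    (↭-sym (↭-++-assoc (innˢ x) (b ∷ vs w) (vs v)))

  labs-++ˡ : ∀ {a b c l} (w : Walk a b) {v : Walk b c} → l ∈ labs w → l ∈ labs (w ++ʷ v)
  labs-++ˡ (x ∷ʷ w) p with ∈-++⁻ (labˢ x) p
  ... | inj₁ q = ∈-++⁺ˡ q
  ... | inj₂ q = ∈-++⁺ʳ (labˢ x) (labs-++ˡ w q)

  labs-++ʳ : ∀ {a b c l} (w : Walk a b) {v : Walk b c} → l ∈ labs v → l ∈ labs (w ++ʷ v)
  labs-++ʳ [] p = p
  labs-++ʳ (x ∷ʷ w) p = ∈-++⁺ʳ (labˢ x) (labs-++ʳ w p)

  revʷ : ∀ {a b} → Walk a b → Walk b a
  revʷ [] = []
  revʷ (x ∷ʷ w) = revʷ w ++ʷ revˢ x ∷ʷ []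

  vs-rev : ∀ {a b} (w : Walk a b) → b ∷ vs (revʷ w) ↭ a ∷ vs w
  vs-rev [] = refl
  vs-rev {a} {c} (_∷ʷ_ {b = b} x w) = begin
    c ∷ vs (revʷ w ++ʷ revˢ x ∷ʷ [])      ↭⟨ prep c (vs-++ (revʷ w) _) ⟩
    (c ∷ vs (revʷ w)) ++ innˢ (revˢ x) ++ a ∷ [] ↭⟨ ++⁺ (vs-rev w) (++⁺ʳ [ a ] (innˢ-rev x)) ⟩
    (b ∷ vs w) ++ innˢ x ++ [ a ]        ↭⟨ solve 4 (λ a b w x → (b ⊞ w) ⊞ (x ⊞ a) ⊜ a ⊞ (x ⊞ (b ⊞ w))) refl [ a ] [ b ] (vs w) (innˢ x) ⟩
    a ∷ innˢ x ++ b ∷ vs w                ∎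
    where open PermutationReasoning

  labs-rev : ∀ {a b l} (w : Walk a b) → l ∈ labs w → l ∈ labs (revʷ w)
  labs-rev (x ∷ʷ w) p with ∈-++⁻ (labˢ x) p
  ... | inj₁ q = labs-++ʳ (revʷ w) (∈-++⁺ˡ (subst (_ ∈_) (sym (labˢ-rev x)) q))
  ... | inj₂ q = labs-++ˡ (revʷ w) (labs-rev w q)

  Cyc : Set
  Cyc = Σ V λ a → Walk a a

  vsᶜ : Cyc → List V
  vsᶜ c = vs (proj₂ c)

  labsᶜ : Cyc → List Lab
  labsᶜ c = labs (proj₂ c)

  labs-++⁻ : ∀ {a b c l} (w : Walk a b) {v : Walk b c} → l ∈ labs (w ++ʷ v) → l ∈ labs w ⊎ l ∈ labs v
  labs-++⁻ [] p = inj₂ p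
  labs-++⁻ (x ∷ʷ w) p with ∈-++⁻ (labˢ x) p
  ... | inj₁ q = inj₁ (∈-++⁺ˡ q)
  ... | inj₂ q with labs-++⁻ w q
  ...   | inj₁ r = inj₁ (∈-++⁺ʳ (labˢ x) r)
  ...   | inj₂ r = inj₂ r

  data Split {a b} (l : Lab) : Walk a b → Set where
    split : ∀ {c d} (v : Walk a c) (x : Step c d) (w : Walk d b) → labˢ x ≡ [ l ] → Split l (v ++ʷ x ∷ʷ w)

  find : ∀ {a b l} (w : Walk a b) → l ∈ labs w → Split l w
  find (x ∷ʷ w) p with ∈-++⁻ (labˢ x) p
  find (fw l r r′ ∷ʷ w) p | inj₁ (here refl) = split [] (fw l r r′) w refl
  find (bw l r r′ ∷ʷ w) p | inj₁ (here refl) = split [] (bw l r r′) w refl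
  find (x ∷ʷ w) p | inj₂ q with find w q
  ... | split v y w′ r = split (x ∷ʷ v) y w′ r

  -- The cycle opened at the edge labelled `l`. It is rotated, and reversed if it passes the edge
  -- backwards, so that `rest` always leads from the target to the source.
  record Cut {a} (w : Walk a a) (l : Lab) : Set where
    field
      rest  : Walk (t l) (s l)
      perm  : vs w ↭ (t l ∷ inn (e l)) ++ vs rest
      keeps : ∀ {l′} → l′ ∈ labs w → l′ ≡ l ⊎ l′ ∈ labs rest

  cut-split : ∀ {a l} {w : Walk a a} → Split l w → Cut w l
  cut-split {a} {l} (split {c} {d} v x w q) = go x q
    where
    u : Walk d c
    u = w ++ʷ v
    moved : ∀ (x : Step c d) → vs (v ++ʷ x ∷ʷ w) ↭ innˢ x ++ d ∷ vs u
    moved x = begin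
      vs (v ++ʷ x ∷ʷ w)              ↭⟨ vs-++ v (x ∷ʷ w) ⟩
      vs v ++ innˢ x ++ d ∷ vs w     ↭⟨ solve 4 (λ v x d w → v ⊞ (x ⊞ (d ⊞ w)) ⊜ x ⊞ (d ⊞ (w ⊞ v))) refl (vs v) (innˢ x) [ d ] (vs w) ⟩
      innˢ x ++ d ∷ vs w ++ vs v     ↭⟨ ++⁺ˡ (innˢ x) (prep d (↭-sym (vs-++ w v))) ⟩
      innˢ x ++ d ∷ vs u             ∎
      where open PermutationReasoning
    kept : ∀ (x : Step c d) → labˢ x ≡ [ l ] → ∀ {l′} → l′ ∈ labs (v ++ʷ x ∷ʷ w) → l′ ≡ l ⊎ l′ ∈ labs u
    kept x q {l′} r with labs-++⁻ v r
    ... | inj₁ r′ = inj₂ (labs-++ʳ w r′)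
    ... | inj₂ r′ with ∈-++⁻ (labˢ x) r′
    ...   | inj₂ r″ = inj₂ (labs-++ˡ w r″)
    ...   | inj₁ r″ with subst (l′ ∈_) q r″
    ...     | here z = inj₁ z
    go : (x : Step c d) → labˢ x ≡ [ l ] → Cut (v ++ʷ x ∷ʷ w) l
    go x@(fw l refl refl) refl = record
      { rest = u ; perm = ↭-trans (moved x) (shift d (inn (e l)) (vs u)) ; keeps = kept x refl }
    go x@(bw l refl refl) refl = record
      { rest = revʷ u
      ; perm = ↭-trans (moved x) (↭-trans (++⁺ˡ (inn (e l)) (↭-sym (vs-rev u))) (shift c (inn (e l)) (vs (revʷ u))))
      ; keeps = map₂ (labs-rev u) ∘ kept x refl }

  cut : ∀ {a l} (w : Walk a a) → l ∈ labs w → Cut w l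
  cut w p = cut-split (find w p)

  tgt∈ : ∀ {a b} (w : Walk a b) → a ≡ b ⊎ b ∈ vs w
  tgt∈ [] = inj₁ refl
  tgt∈ (_∷ʷ_ {b = b} x w) with tgt∈ w
  ... | inj₁ refl = inj₂ (∈-++⁺ʳ (innˢ x) (here refl))
  ... | inj₂ p = inj₂ (∈-++⁺ʳ (innˢ x) (there p))

  ends∈ : ∀ {a l} (w : Walk a a) → l ∈ labs w → s l ∈ vs w × t l ∈ vs w
  ends∈ {l = l} w p = ∈-resp-↭ (↭-sym perm) s∈ , ∈-resp-↭ (↭-sym perm) (here refl)
    where
    open Cut (cut w p)
    s∈ : s l ∈ (t l ∷ inn (e l)) ++ vs rest
    s∈ with tgt∈ rest
    ... | inj₁ z = here (sym z)
    ... | inj₂ q = there (∈-++⁺ʳ (inn (e l)) q)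

  vsˡ : List Cyc → List V
  vsˡ = concatMap vsᶜ

  Same : List Cyc → V → V → Set
  Same Cs u v = Any (λ c → u ∈ vsᶜ c × v ∈ vsᶜ c) Cs

  Has : List Cyc → Lab → Set
  Has Cs l = Any (λ c → l ∈ labsᶜ c) Cs

concatMap-↭ : ∀ {A B : Set} (f : A → List B) {xs ys} → xs ↭ ys → concatMap f xs ↭ concatMap f ys
concatMap-↭ f refl = refl
concatMap-↭ f (prep x p) = ++⁺ˡ (f x) (concatMap-↭ f p)
concatMap-↭ f (swap x y p) = ↭-trans (++⁺ˡ (f x) (++⁺ˡ (f y) (concatMap-↭ f p))) (shifts (f x) (f y))
concatMap-↭ f (p then q) = ↭-trans (concatMap-↭ f p) (concatMap-↭ f q)

pick : ∀ {A : Set} {P : A → Set} {xs} → Any P xs → Σ A λ x → Σ (List A) λ ys → P x × xs ↭ x ∷ ys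
pick (here p) = _ , _ , p , refl
pick {xs = x ∷ _} (there a) with pick a
... | y , ys , p , q = y , x ∷ ys , p , ↭-trans (prep x q) (swap x y refl)

pick₂ : ∀ {A : Set} {P Q : A → Set} {xs} → Any P xs → Any Q xs →
        Any (λ x → P x × Q x) xs ⊎ Σ A λ x → Σ A λ y → Σ (List A) λ ys → P x × Q y × xs ↭ x ∷ y ∷ ys
pick₂ (here p) (here q) = inj₁ (here (p , q))
pick₂ (here p) (there b) with pick b
... | y , ys , q , r = inj₂ (_ , y , ys , p , q , prep _ r)
pick₂ (there a) (here q) with pick a
... | x , ys , p , r = inj₂ (x , _ , ys , p , q , ↭-trans (prep _ r) (swap _ _ refl))
pick₂ {xs = z ∷ _} (there a) (there b) with pick₂ a b
... | inj₁ c = inj₁ (there c)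
... | inj₂ (x , y , ys , p , q , r) =
  inj₂ (x , y , z ∷ ys , p , q , ↭-trans (prep z r) (↭-trans (swap z x refl) (prep x (swap z y refl))))

pattern k₀ κ = inj₁ (κ , false)
pattern k₁ κ = inj₁ (κ , true)

-- Edges carrying a label (κ , _) may be exchanged: the two edges of κ are replaced by edges joining their
-- sources and their targets, which joins the two cycles if they are different. Edges labelled by R are kept.
record Exchange : Set₁ where
  field
    E     : V → V → Set
    inn   : ∀ {a b} → E a b → List V
    rev   : ∀ {a b} → E a b → E b a
    inn-rev : ∀ {a b} (x : E a b) → inn (rev x) ↭ inn x
    K R   : Set
    s t   : K × Bool ⊎ R → V
    e     : ∀ l → E (s l) (t l)
    joinˢ : ∀ κ → E (s (k₀ κ)) (s (k₁ κ))
    joinᵗ : ∀ κ → E (t (k₀ κ)) (t (k₁ κ))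
    join-inn : ∀ κ → inn (joinˢ κ) ++ inn (joinᵗ κ) ↭ inn (e (k₀ κ)) ++ inn (e (k₁ κ))

  sys : Sys
  sys = record { E = E ; inn = inn ; rev = rev ; inn-rev = inn-rev ; Lab = K × Bool ⊎ R ; s = s ; t = t ; e = e }

module Glue (X : Exchange) where
  open Exchange X using (K; R; joinˢ; joinᵗ; join-inn; sys)
  open Walks sys public

  -- An exchange uses up both labels of its key but leaves the two sources on one cycle. The second
  -- alternative absorbs this, so keys may occur repeatedly.
  Ready : List Cyc → K → Set
  Ready Cs κ = (Has Cs (k₀ κ) × Has Cs (k₁ κ)) ⊎ Same Cs (s (k₀ κ)) (s (k₁ κ))

  module _ {a b κ} (v : Walk a a) (w : Walk b b) (p : k₀ κ ∈ labs v) (q : k₁ κ ∈ labs w) where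
    private
      module C = Cut (cut v p)
      module C′ = Cut (cut w q)
    -- Cross to the second cycle between the sources, traverse it backwards to its target, cross
    -- back between the targets and finish the first cycle. Both cycles can be oriented in this way
    -- because `Cut` normalises the direction.
    merge : Walk (s (k₀ κ)) (s (k₀ κ))
    merge = pl (joinˢ κ) ∷ʷ revʷ C′.rest ++ʷ revˢ (pl (joinᵗ κ)) ∷ʷ C.rest

    merge-vs : vs merge ↭ vs v ++ vs w
    merge-vs = begin
      inn (joinˢ κ) ++ s₁ ∷ vs (revʷ C′.rest ++ʷ revˢ (pl (joinᵗ κ)) ∷ʷ C.rest)
        ↭⟨ ++⁺ˡ (inn (joinˢ κ)) (prep s₁ (vs-++ (revʷ C′.rest) _)) ⟩
      inn (joinˢ κ) ++ (s₁ ∷ vs (revʷ C′.rest)) ++ inn (rev (joinᵗ κ)) ++ t₀ ∷ vs C.rest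
        ↭⟨ ++⁺ˡ (inn (joinˢ κ)) (++⁺ (vs-rev C′.rest) (++⁺ʳ (t₀ ∷ vs C.rest) (inn-rev (joinᵗ κ)))) ⟩
      inn (joinˢ κ) ++ (t₁ ∷ vs C′.rest) ++ inn (joinᵗ κ) ++ t₀ ∷ vs C.rest
        ↭⟨ solve 6 (λ i j t₀ t₁ r r′ → i ⊞ ((t₁ ⊞ r′) ⊞ (j ⊞ (t₀ ⊞ r))) ⊜ (i ⊞ j) ⊞ ((t₀ ⊞ r) ⊞ (t₁ ⊞ r′))) refl
             (inn (joinˢ κ)) (inn (joinᵗ κ)) [ t₀ ] [ t₁ ] (vs C.rest) (vs C′.rest) ⟩
      (inn (joinˢ κ) ++ inn (joinᵗ κ)) ++ (t₀ ∷ vs C.rest) ++ t₁ ∷ vs C′.rest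
        ↭⟨ ++⁺ʳ _ (join-inn κ) ⟩
      (inn (e (k₀ κ)) ++ inn (e (k₁ κ))) ++ (t₀ ∷ vs C.rest) ++ t₁ ∷ vs C′.rest
        ↭⟨ solve 6 (λ i j t₀ t₁ r r′ → (i ⊞ j) ⊞ ((t₀ ⊞ r) ⊞ (t₁ ⊞ r′)) ⊜ ((t₀ ⊞ i) ⊞ r) ⊞ ((t₁ ⊞ j) ⊞ r′)) refl
             (inn (e (k₀ κ))) (inn (e (k₁ κ))) [ t₀ ] [ t₁ ] (vs C.rest) (vs C′.rest) ⟩
      ((t₀ ∷ inn (e (k₀ κ))) ++ vs C.rest) ++ (t₁ ∷ inn (e (k₁ κ))) ++ vs C′.rest
        ↭⟨ ++⁺ (↭-sym C.perm) (↭-sym C′.perm) ⟩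
      vs v ++ vs w ∎
      where
      open PermutationReasoning
      s₁ = s (k₁ κ)
      t₀ = t (k₀ κ)
      t₁ = t (k₁ κ)

    merge-labs₀ : ∀ {l} → l ∈ labs v → l ≡ k₀ κ ⊎ l ∈ labs merge
    merge-labs₀ r with C.keeps r
    ... | inj₁ z = inj₁ z
    ... | inj₂ z = inj₂ (labs-++ʳ (revʷ C′.rest) z)

    merge-labs₁ : ∀ {l} → l ∈ labs w → l ≡ k₁ κ ⊎ l ∈ labs merge
    merge-labs₁ r with C′.keeps r
    ... | inj₁ z = inj₁ z
    ... | inj₂ z = inj₂ (labs-++ˡ (revʷ C′.rest) (labs-rev C′.rest z))

  record Glued (ks : List K) (Cs : List Cyc) : Set where
    field
      cycles : List Cyc
      same-vs : vsˡ cycles ↭ vsˡ Cs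
      coarser : ∀ {u v} → Same Cs u v → Same cycles u v
      kept    : ∀ {r} → Has Cs (inj₂ r) → Has cycles (inj₂ r)
      joined  : ∀ {κ} → κ ∈ ks → Same cycles (s (k₀ κ)) (s (k₁ κ))

  glue : ∀ ks Cs → (∀ {κ} → κ ∈ ks → Ready Cs κ) → Glued ks Cs
  glue [] Cs f = record { cycles = Cs ; same-vs = refl ; coarser = id ; kept = id ; joined = λ () }
  glue (κ ∷ ks) Cs f = by-cases (f (here refl))
    where
    skip : Same Cs (s (k₀ κ)) (s (k₁ κ)) → Glued (κ ∷ ks) Cs
    skip S = record { cycles = cycles ; same-vs = same-vs ; coarser = coarser ; kept = kept
                    ; joined = λ { (here refl) → coarser S ; (there p) → joined p } }
      where open Glued (glue ks Cs (f ∘ there))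
    by-cases : Ready Cs κ → Glued (κ ∷ ks) Cs
    by-cases (inj₂ S) = skip S
    by-cases (inj₁ (h₀ , h₁)) with pick₂ h₀ h₁
    -- With both edges on one cycle the exchange might cut that cycle in two; it is omitted, as the
    -- sources are together already.
    ... | inj₁ both = skip (Any.map (λ { {_ , u} (p , q) → proj₁ (ends∈ u p) , proj₁ (ends∈ u q) }) both)
    ... | inj₂ ((_ , v) , (_ , w) , Ds , p , q , perm) = record
      { cycles = cycles ; same-vs = ↭-trans same-vs all ; coarser = coarser ∘ same ; kept = kept ∘ reserved
      ; joined = λ { (here refl) → coarser new ; (there r) → joined r } }
      where
      new-vs = merge-vs v w p q
      Cs′ = (_ , merge v w p q) ∷ Ds
      all : vsˡ Cs′ ↭ vsˡ Cs
      all = ↭-trans (++⁺ʳ _ new-vs) (↭-trans (↭-++-assoc (vs v) (vs w) _) (↭-sym (concatMap-↭ vsᶜ perm)))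
      in₀ : ∀ {u} → u ∈ vs v → u ∈ vs (merge v w p q)
      in₀ r = ∈-resp-↭ (↭-sym new-vs) (∈-++⁺ˡ r)
      in₁ : ∀ {u} → u ∈ vs w → u ∈ vs (merge v w p q)
      in₁ r = ∈-resp-↭ (↭-sym new-vs) (∈-++⁺ʳ (vs v) r)
      new : Same Cs′ (s (k₀ κ)) (s (k₁ κ))
      new = here (in₀ (proj₁ (ends∈ v p)) , in₁ (proj₁ (ends∈ w q)))
      same : ∀ {u u′} → Same Cs u u′ → Same Cs′ u u′
      same S with Any-resp-↭ perm S
      ... | here (r , r′) = here (in₀ r , in₀ r′)
      ... | there (here (r , r′)) = here (in₁ r , in₁ r′)
      ... | there (there r) = there r
      still : ∀ {l} → Has Cs l → (l ≡ k₀ κ ⊎ l ≡ k₁ κ) ⊎ Has Cs′ l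
      still h with Any-resp-↭ perm h
      ... | there (there r) = inj₂ (there r)
      ... | here r with merge-labs₀ v w p q r
      ...   | inj₁ z = inj₁ (inj₁ z)
      ...   | inj₂ z = inj₂ (here z)
      still h | there (here r) with merge-labs₁ v w p q r
      ...   | inj₁ z = inj₁ (inj₂ z)
      ...   | inj₂ z = inj₂ (here z)
      reserved : ∀ {r} → Has Cs (inj₂ r) → Has Cs′ (inj₂ r)
      reserved h with still h
      ... | inj₂ z = z
      ... | inj₁ (inj₁ ())
      ... | inj₁ (inj₂ ())
      ready : ∀ {κ′} → κ′ ∈ ks → Ready Cs′ κ′
      ready r with f (there r)
      ... | inj₂ S = inj₂ (same S)
      ... | inj₁ (g₀ , g₁) with still g₀ | still g₁
      ...   | inj₂ y | inj₂ z = inj₁ (y , z)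
      ...   | inj₁ (inj₁ refl) | _ = inj₂ new
      ...   | inj₂ _ | inj₁ (inj₂ refl) = inj₂ new
      open Glued (glue ks Cs′ ready)

-- Selecting disjoint cycles and joining them to a single one

_≟ⱽ_ : DecidableEquality V
_≟ⱽ_ = ≡-dec _≟ᵇ_

open Data.List.Membership.DecPropositional _≟ⱽ_ using (_∈?_)

words : ℕ → List V
words zero = [] ∷ []
words (suc n) = map (O ∷_) (words n) ++ map (I ∷_) (words n)

∈-words : ∀ x {n} → length x ≡ n → x ∈ words n
∈-words [] refl = here refl
∈-words (O ∷ x) refl = ∈-++⁺ˡ (∈-map⁺ (O ∷_) (∈-words x refl))
∈-words (I ∷ x) refl = ∈-++⁺ʳ (map (O ∷_) (words (length x))) (∈-map⁺ (I ∷_) (∈-words x refl))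

Unique-++⁻ : ∀ {A : Set} (xs : List A) {ys v} → Unique (xs ++ ys) → v ∈ xs → v ∈ ys → ⊥
Unique-++⁻ (x ∷ xs) (p ∷ u) (here refl) r = All.lookup p (∈-++⁺ʳ xs r) refl
Unique-++⁻ (x ∷ xs) (p ∷ u) (there q) r = Unique-++⁻ xs u q r

Unique-++ˡ : ∀ {A : Set} (xs : List A) {ys} → Unique (xs ++ ys) → Unique xs
Unique-++ˡ [] u = []
Unique-++ˡ (x ∷ xs) (p ∷ u) = All.tabulate (λ q → All.lookup p (∈-++⁺ˡ q)) ∷ Unique-++ˡ xs u

module _ (S S′ : Sys) where
  private
    module A = Walks S
    module B = Walks S′
  module MapWalk (f : V → V) (φ : ∀ {a b} → A.Step a b → B.Walk (f a) (f b))
    (φ-vs : ∀ {a b} (x : A.Step a b) → B.vs (φ x) ↭ map f (A.innˢ x ++ [ b ])) where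

    mapʷ : ∀ {a b} → A.Walk a b → B.Walk (f a) (f b)
    mapʷ A.[] = B.[]
    mapʷ (x A.∷ʷ w) = φ x B.++ʷ mapʷ w

    map-vs : ∀ {a b} (w : A.Walk a b) → B.vs (mapʷ w) ↭ map f (A.vs w)
    map-vs A.[] = refl
    map-vs (A._∷ʷ_ {b = b} x w) = ↭-trans (B.vs-++ (φ x) _) (↭-trans (++⁺ (φ-vs x) (map-vs w)) (go (A.innˢ x)))
      where
      go : ∀ us → map f (us ++ [ b ]) ++ map f (A.vs w) ↭ map f (us ++ b ∷ A.vs w)
      go [] = refl
      go (u ∷ us) = prep (f u) (go us)

    map-labs : ∀ {l l′} → (∀ {a b} (x : A.Step a b) → l ∈ A.labˢ x → l′ ∈ B.labs (φ x)) →
               ∀ {a b} (w : A.Walk a b) → l ∈ A.labs w → l′ ∈ B.labs (mapʷ w)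
    map-labs h (x A.∷ʷ w) p with ∈-++⁻ (A.labˢ x) p
    ... | inj₁ q = B.labs-++ˡ (φ x) (h x q)
    ... | inj₂ q = B.labs-++ʳ (φ x) (map-labs h w q)

module _ (S : Sys) where
  open Walks S

  -- No vertex occurs twice in the list, so two cycles of it that share `v` stand at the same
  -- position.
  join-at : ∀ {Cs v} {P Q : Cyc → Set} → Unique (vsˡ Cs) →
            Any (λ c → v ∈ vsᶜ c × P c) Cs → Any (λ c → v ∈ vsᶜ c × Q c) Cs → Any (λ c → P c × Q c) Cs
  join-at u a b with pick₂ a b
  ... | inj₁ r = Any.map (λ { ((_ , p) , (_ , q)) → p , q }) r
  ... | inj₂ (c , d , Ds , (p , _) , (q , _) , r) =
    ⊥-elim (Unique-++⁻ (vsᶜ c) (Unique-resp-↭ (concatMap-↭ vsᶜ r) u) p (∈-++⁺ˡ q))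

  ∈-vsˡ⁻ : ∀ Cs {v} → v ∈ vsˡ Cs → Any (λ c → v ∈ vsᶜ c) Cs
  ∈-vsˡ⁻ Cs p = Any-map⁻ (∈-concat⁻ (map vsᶜ Cs) p)

  ∈-vsˡ⁺ : ∀ {Cs v} → Any (λ c → v ∈ vsᶜ c) Cs → v ∈ vsˡ Cs
  ∈-vsˡ⁺ p = ∈-concat⁺ (Any-map⁺ p)

  -- Choose one cycle out of each class of a partition whose classes are all traversed by cycles.
  module Partition {Code : Set} (P : V → Set) (ι : V → Code) (Valid : Code → Set) (C : ∀ c → Valid c → Cyc)
    (valid : ∀ {x} → P x → Valid (ι x))
    (inside : ∀ {x} → P x → (p : Valid (ι x)) → x ∈ vsᶜ (C (ι x) p))
    (sound : ∀ {c p y} → y ∈ vsᶜ (C c p) → P y × ι y ≡ c)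
    (uniq : ∀ c p → Unique (vsᶜ (C c p))) where

    record Chosen (xs : List V) : Set where
      field
        cycles : List Cyc
        unique : Unique (vsˡ cycles)
        all-C  : All (λ d → ∃ λ c → Σ (Valid c) λ p → d ≡ C c p) cycles
        covers : ∀ {x} → x ∈ xs → x ∈ vsˡ cycles

      code-in : ∀ {x} → x ∈ vsˡ cycles → Any (λ d → Σ (Valid (ι x)) λ p → d ≡ C (ι x) p) cycles
      code-in q = go cycles all-C (∈-vsˡ⁻ cycles q)
        where
        go : ∀ Cs → All (λ d → ∃ λ c → Σ (Valid c) λ p → d ≡ C c p) Cs → ∀ {x} →
             Any (λ c → x ∈ vsᶜ c) Cs → Any (λ d → Σ (Valid (ι x)) λ p → d ≡ C (ι x) p) Cs
        go (_ ∷ Cs) ((c , p , refl) ∷ _) (here r) with sound r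
        ... | _ , refl = here (p , refl)
        go (_ ∷ Cs) (_ ∷ al) (there r) = there (go Cs al r)

      all-P : ∀ {x} → x ∈ vsˡ cycles → P x
      all-P q = go cycles all-C (∈-vsˡ⁻ cycles q)
        where
        go : ∀ Cs → All (λ d → ∃ λ c → Σ (Valid c) λ p → d ≡ C c p) Cs → ∀ {x} → Any (λ c → x ∈ vsᶜ c) Cs → P x
        go (_ ∷ Cs) ((c , p , refl) ∷ _) (here r) = proj₁ (sound r)
        go (_ ∷ Cs) (_ ∷ al) (there r) = go Cs al r

    choose : ∀ xs → (∀ {x} → x ∈ xs → P x) → Chosen xs
    choose [] _ = record { cycles = [] ; unique = [] ; all-C = [] ; covers = λ () }
    choose (x ∷ xs) f with choose xs (f ∘ there)
    ... | R with x ∈? vsˡ (Chosen.cycles R)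
    ...   | yes q = record { cycles = cycles ; unique = unique ; all-C = all-C
                           ; covers = λ { (here refl) → q ; (there r) → covers r } }
      where open Chosen R
    ...   | no ¬q = record
      { cycles = C (ι x) p ∷ cycles
      ; unique = Uniqueₚ.++⁺ (uniq _ p) unique disjoint
      ; all-C = (_ , p , refl) ∷ all-C
      ; covers = λ { (here refl) → ∈-++⁺ˡ (inside px p) ; (there r) → ∈-++⁺ʳ _ (covers r) } }
      where
      open Chosen R
      px = f (here refl)
      p = valid px
      disjoint : ∀ {v} → v ∈ vsᶜ (C (ι x) p) × v ∈ vsˡ cycles → ⊥
      disjoint (a , b) with sound a
      ... | _ , eq = ¬q (∈-vsˡ⁺ (Any.map (λ { (p′ , refl) → inside′ eq p′ }) (code-in b)))
        where
        inside′ : ∀ {c} → c ≡ ι x → (p′ : Valid c) → x ∈ vsᶜ (C c p′)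
        inside′ refl p′ = inside px p′

module _ {R : Set} (s t : R → V) (e : ∀ r → Adj (s r) (t r)) where
  adjSys : Sys
  adjSys = record { E = Adj ; inn = λ _ → [] ; rev = Adj-sym ; inn-rev = λ _ → refl
                  ; Lab = R ; s = s ; t = t ; e = e }

  record Ham (P : V → Set) : Set where
    open Walks adjSys using (Walk; vs; labs)
    field
      start    : V
      walk     : Walk start start
      unique   : Unique (vs walk)
      sound    : ∀ {v} → v ∈ vs walk → P v
      complete : ∀ {v} → P v → v ∈ vs walk
      present  : ∀ r → r ∈ labs walk

-- Connections are data because `keys` reads off which exchanges they use. Only these are carried
-- out, so `K` need not be enumerated.
data Conn {K : Set} (κ₀ κ₁ : K → V) (T : V → V → Set) : V → V → Set where
  base : ∀ {u v} → T u v → Conn κ₀ κ₁ T u v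
  link : ∀ κ → Conn κ₀ κ₁ T (κ₀ κ) (κ₁ κ)
  inv  : ∀ {u v} → Conn κ₀ κ₁ T u v → Conn κ₀ κ₁ T v u
  _◅_  : ∀ {u v w} → Conn κ₀ κ₁ T u v → Conn κ₀ κ₁ T v w → Conn κ₀ κ₁ T u w
infixr 5 _◅_

module Connect (X : Exchange) where
  open Exchange X using (K; R; sys)
  open Glue X

  κ₀ κ₁ : K → V
  κ₀ κ = s (k₀ κ)
  κ₁ κ = s (k₁ κ)

  keys : ∀ {T u v} → Conn κ₀ κ₁ T u v → List K
  keys (base _) = []
  keys (link κ) = [ κ ]
  keys (inv c) = keys c
  keys (c ◅ d) = keys c ++ keys d

  module _ {T : V → V → Set} (Cs : List Cyc) (unique : Unique (vsˡ Cs)) (T⇒Same : ∀ {u v} → T u v → Same Cs u v)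
    (has : ∀ κ → Has Cs (k₀ κ) × Has Cs (k₁ κ)) (root : V) (root∈ : root ∈ vsˡ Cs)
    (conn : ∀ {v} → v ∈ vsˡ Cs → Conn κ₀ κ₁ T root v) where

    record Single : Set where
      field
        cycle  : Cyc
        uniq   : Unique (vsᶜ cycle)
        ⊆Cs    : ∀ {v} → v ∈ vsᶜ cycle → v ∈ vsˡ Cs
        ⊇Cs    : ∀ {v} → v ∈ vsˡ Cs → v ∈ vsᶜ cycle
        kept   : ∀ {r} → Has Cs (inj₂ r) → inj₂ r ∈ labsᶜ cycle

    private
      all-keys : ∀ xs → (∀ {v} → v ∈ xs → Conn κ₀ κ₁ T root v) → List K
      all-keys [] f = []
      all-keys (x ∷ xs) f = keys (f (here refl)) ++ all-keys xs (f ∘ there)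

      open Glued (glue (all-keys (vsˡ Cs) conn) Cs (λ {κ} _ → inj₁ (has κ)))
        renaming (kept to keptᵍ)

      unique′ : Unique (vsˡ cycles)
      unique′ = Unique-resp-↭ (↭-sym same-vs) unique

      swap′ : ∀ {u v} → Same cycles u v → Same cycles v u
      swap′ = Any.map (λ { (p , q) → q , p })

      Conn⇒Same : ∀ {u v} (c : Conn κ₀ κ₁ T u v) → (∀ {κ} → κ ∈ keys c → Same cycles (κ₀ κ) (κ₁ κ)) → Same cycles u v
      Conn⇒Same (base x) f = coarser (T⇒Same x)
      Conn⇒Same (link κ) f = f (here refl)
      Conn⇒Same (inv c) f = swap′ (Conn⇒Same c f)
      Conn⇒Same (c ◅ d) f =
        join-at sys unique′ (swap′ (Conn⇒Same c (f ∘ ∈-++⁺ˡ))) (Conn⇒Same d (f ∘ ∈-++⁺ʳ (keys c)))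

      all-same : ∀ xs (f : ∀ {v} → v ∈ xs → Conn κ₀ κ₁ T root v) →
                 (∀ {κ} → κ ∈ all-keys xs f → Same cycles (κ₀ κ) (κ₁ κ)) → ∀ {v} → v ∈ xs → Same cycles root v
      all-same (x ∷ xs) f g (here refl) = Conn⇒Same (f (here refl)) (g ∘ ∈-++⁺ˡ)
      all-same (x ∷ xs) f g (there p) = all-same xs (f ∘ there) (g ∘ ∈-++⁺ʳ (keys (f (here refl)))) p

      same : ∀ {v} → v ∈ vsˡ Cs → Same cycles root v
      same = all-same (vsˡ Cs) conn joined

    single : Single
    single with pick (same root∈)
    ... | c , Ds , (r∈ , _) , perm = record
      { cycle = c
      ; uniq = Unique-++ˡ (vsᶜ c) u
      ; ⊆Cs = λ p → ∈-resp-↭ same-vs (∈-resp-↭ (↭-sym vperm) (∈-++⁺ˡ p))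
      ; ⊇Cs = λ p → hd (same p)
      ; kept = λ h → let at = Any.map (λ { {_ , w} p → proj₁ (ends∈ w p) , p }) (keptᵍ h)
                         s∈ = ∈-resp-↭ same-vs (∈-vsˡ⁺ sys (Any.map proj₁ at))
                     in hd (join-at sys unique′ (swap′ (same s∈)) at) }
      where
      vperm : vsˡ cycles ↭ vsᶜ c ++ vsˡ Ds
      vperm = concatMap-↭ vsᶜ perm
      u : Unique (vsᶜ c ++ vsˡ Ds)
      u = Unique-resp-↭ vperm unique′
      hd : ∀ {Q : Cyc → Set} → Any (λ d → root ∈ vsᶜ d × Q d) cycles → Q c
      hd a with Any-resp-↭ perm a
      ... | here (_ , q) = q
      ... | there b = ⊥-elim (Unique-++⁻ (vsᶜ c) u r∈ (∈-vsˡ⁺ sys (Any.map proj₁ b)))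

-- A system of exchangeable squares: the edges (κ , b) for b = false, true are opposite edges of a square.
record Squares (R : Set) : Set₁ where
  field
    K     : Set
    κs κt : K → Bool → V
    κe    : ∀ κ b → Adj (κs κ b) (κt κ b)
    joinˢ : ∀ κ → Adj (κs κ false) (κs κ true)
    joinᵗ : ∀ κ → Adj (κt κ false) (κt κ true)
    s t   : R → V
    e     : ∀ r → Adj (s r) (t r)

  exchange : Exchange
  exchange = record
    { E = Adj ; inn = λ _ → [] ; rev = Adj-sym ; inn-rev = λ _ → refl ; K = K ; R = R
    ; s = λ { (inj₁ (κ , b)) → κs κ b ; (inj₂ r) → s r }
    ; t = λ { (inj₁ (κ , b)) → κt κ b ; (inj₂ r) → t r }
    ; e = λ { (inj₁ (κ , b)) → κe κ b ; (inj₂ r) → e r }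
    ; joinˢ = joinˢ ; joinᵗ = joinᵗ ; join-inn = λ _ → refl }

  sys : Sys
  sys = Exchange.sys exchange

module Assemble {R : Set} (X : Squares R) where
  open Squares X using (K; κs; exchange; sys; s; t; e)
  private
    module G = Glue exchange
    module S = Walks sys
  open Connect exchange using (Single; single; κ₀; κ₁)

  -- The exchangeable labels have served their purpose and are forgotten; the reserved ones become
  -- the guaranteed edges of the new cycle.
  relabel : ∀ {a b} → S.Step a b → Walks.Walk (adjSys s t e) a b
  relabel (S.pl x) = Walks._∷ʷ_ (Walks.pl x) Walks.[]
  relabel (S.fw (inj₁ (κ , b)) refl refl) = Walks._∷ʷ_ (Walks.pl (Squares.κe X κ b)) Walks.[]
  relabel (S.fw (inj₂ r) p q) = Walks._∷ʷ_ (Walks.fw r p q) Walks.[]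
  relabel (S.bw (inj₁ (κ , b)) refl refl) = Walks._∷ʷ_ (Walks.pl (Adj-sym (Squares.κe X κ b))) Walks.[]
  relabel (S.bw (inj₂ r) p q) = Walks._∷ʷ_ (Walks.bw r p q) Walks.[]

  relabel-vs : ∀ {a b} (x : S.Step a b) → Walks.vs _ (relabel x) ↭ map id (S.innˢ x ++ [ b ])
  relabel-vs (S.pl x) = refl
  relabel-vs (S.fw (inj₁ (κ , b)) refl refl) = refl
  relabel-vs (S.fw (inj₂ r) p q) = refl
  relabel-vs (S.bw (inj₁ (κ , b)) refl refl) = refl
  relabel-vs (S.bw (inj₂ r) p q) = refl

  relabel-lab : ∀ {r a b} (x : S.Step a b) → inj₂ r ∈ S.labˢ x → r ∈ Walks.labs _ (relabel x)
  relabel-lab (S.fw (inj₂ r) p q) (here refl) = here refl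
  relabel-lab (S.bw (inj₂ r) p q) (here refl) = here refl

  open MapWalk sys (adjSys s t e) id relabel relabel-vs

  -- The cycle `C c p` may depend on the proof `p` of validity, and which proof was used when a
  -- cycle was selected is not recorded. Therefore `inside`, `square` and `reserved` are required
  -- for every `p`.
  module _ {Code : Set} {P : V → Set} (P? : Decidable P) (n : ℕ) (len : ∀ {x} → P x → length x ≡ n)
    (ι : V → Code) (Valid : Code → Set) (C : ∀ c → Valid c → S.Cyc)
    (valid : ∀ {x} → P x → Valid (ι x))
    (inside : ∀ {x} → P x → (p : Valid (ι x)) → x ∈ S.vsᶜ (C (ι x) p))
    (sound : ∀ {c p y} → y ∈ S.vsᶜ (C c p) → P y × ι y ≡ c)
    (uniq : ∀ c p → Unique (S.vsᶜ (C c p)))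
    (square : ∀ κ b → P (κs κ b) × ((p : Valid (ι (κs κ b))) → inj₁ (κ , b) ∈ S.labsᶜ (C (ι (κs κ b)) p)))
    (reserved : ∀ r → P (s r) × ((p : Valid (ι (s r))) → inj₂ r ∈ S.labsᶜ (C (ι (s r)) p)))
    (root : V) (P-root : P root)
    (conn : ∀ {v} → P v → Conn κ₀ κ₁ (λ u v → P u × P v × ι u ≡ ι v) root v) where

    private
      open Partition sys P ι Valid C valid inside sound uniq
      xs = filter P? (words n)
      open Chosen (choose xs (λ p → proj₂ (∈-filter⁻ P? {xs = words n} p)))

      covers′ : ∀ {x} → P x → x ∈ S.vsˡ cycles
      covers′ {x} p = covers (∈-filter⁺ P? (∈-words x (len p)) p)

      has : ∀ {l x} → P x → ((p : Valid (ι x)) → l ∈ S.labsᶜ (C (ι x) p)) → S.Has cycles l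
      has px h = Any.map (λ { (p , refl) → h p }) (code-in (covers′ px))

      same : ∀ {u v} → P u × P v × ι u ≡ ι v → S.Same cycles u v
      same {u} {v} (pu , pv , eq) = Any.map (λ { (p , refl) → inside pu p , go eq p }) (code-in (covers′ pu))
        where
        go : ∀ {c} → c ≡ ι v → (p : Valid c) → v ∈ S.vsᶜ (C c p)
        go refl p = inside pv p

      merged : Single _ _ _ _ _ _ _
      merged = single cycles unique same (λ κ → has (proj₁ (square κ false)) (proj₂ (square κ false))
                                           , has (proj₁ (square κ true)) (proj₂ (square κ true)))
                   root (covers′ P-root) (conn ∘ all-P)
      open Single merged using (cycle; ⊆Cs; ⊇Cs; kept)

      same-vs : Walks.vs _ (mapʷ (proj₂ cycle)) ↭ S.vsᶜ cycle
      same-vs = ↭-trans (map-vs (proj₂ cycle)) (↭-reflexive (map-id (S.vsᶜ cycle)))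

    ham : Ham s t e P
    ham = record
      { start = proj₁ cycle
      ; walk = mapʷ (proj₂ cycle)
      ; unique = Unique-resp-↭ (↭-sym same-vs) (Single.uniq merged)
      ; sound = λ p → all-P (⊆Cs (∈-resp-↭ same-vs p))
      ; complete = λ p → ∈-resp-↭ (↭-sym same-vs) (⊇Cs (covers′ p))
      ; present = λ r → map-labs relabel-lab (proj₂ cycle) (kept (has (proj₁ (reserved r)) (proj₂ (reserved r)))) }

-- The middle levels and their partition

dbl≡ : ∀ n → dbl n ≡ n + n
dbl≡ zero = refl
dbl≡ (suc n) = cong suc (trans (cong suc (dbl≡ n)) (sym (+-suc n n)))

dbl-≢ : ∀ x y → dbl x ≢ suc (dbl y)
dbl-≢ (suc x) (suc y) p = dbl-≢ x y (suc-injective (suc-injective p))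

dbl-injective : ∀ x y → dbl x ≡ dbl y → x ≡ y
dbl-injective zero zero _ = refl
dbl-injective (suc x) (suc y) p = cong suc (dbl-injective x y (suc-injective (suc-injective p)))

dbl-mono : ∀ {x y} → x ≤ y → dbl x ≤ dbl y
dbl-mono z≤n = z≤n
dbl-mono (s≤s p) = s≤s (s≤s (dbl-mono p))

dbl-cancel : ∀ x y → dbl x ≤ suc (dbl y) → x ≤ y
dbl-cancel zero y _ = z≤n
dbl-cancel (suc x) zero (s≤s ())
dbl-cancel (suc x) (suc y) (s≤s (s≤s p)) = s≤s (dbl-cancel x y p)

-- Removing pieces of even total length from a word of odd length leaves an odd length, so the
-- remainder has a size k in the sense of B(k,λ). The same argument shows that the number of
-- unmatched bits is odd.
odd-split : ∀ x y m → x + dbl y ≡ suc (dbl m) → ∃ λ k → x ≡ suc (dbl k) × k + y ≡ m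
odd-split x zero m p = m , trans (sym (+-identityʳ x)) p , +-identityʳ m
odd-split x (suc y) zero p with () ← trans (sym p) (trans (+-suc x _) (cong suc (+-suc x (dbl y))))
odd-split x (suc y) (suc m) p
  with k , q , r ← odd-split x y m (suc-injective (suc-injective (trans (sym (trans (+-suc x _) (cong suc (+-suc x (dbl y))))) p)))
  = k , q , trans (+-suc k y) (cong suc r)

zeros ones : V → ℕ
zeros [] = 0
zeros (O ∷ x) = suc (zeros x)
zeros (I ∷ x) = zeros x
ones [] = 0
ones (O ∷ x) = ones x
ones (I ∷ x) = suc (ones x)

length-count : ∀ x → length x ≡ zeros x + ones x
length-count [] = refl
length-count (O ∷ x) = cong suc (length-count x)
length-count (I ∷ x) = trans (cong suc (length-count x)) (sym (+-suc (zeros x) (ones x)))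

zeros-++ : ∀ x y → zeros (x ++ y) ≡ zeros x + zeros y
zeros-++ [] y = refl
zeros-++ (O ∷ x) y = cong suc (zeros-++ x y)
zeros-++ (I ∷ x) y = zeros-++ x y

ones-++ : ∀ x y → ones (x ++ y) ≡ ones x + ones y
ones-++ [] y = refl
ones-++ (O ∷ x) y = ones-++ x y
ones-++ (I ∷ x) y = cong suc (ones-++ x y)

zeros-D : ∀ d k → zeros (⟦ d ⟧ k) ≡ sz d + zeros k
zeros-D ε k = refl
zeros-D (X ▷ u) k rewrite zeros-D X (O ∷ ⟦ u ⟧ (I ∷ k)) | zeros-D u (I ∷ k) = lem (sz X) (sz u) (zeros k)
  where
  lem : ∀ a b c → a + suc (b + c) ≡ suc (a + b + c)
  lem = solve-∀

ones-D : ∀ d k → ones (⟦ d ⟧ k) ≡ sz d + ones k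
ones-D ε k = refl
ones-D (X ▷ u) k rewrite ones-D X (O ∷ ⟦ u ⟧ (I ∷ k)) | ones-D u (I ∷ k) = lem (sz X) (sz u) (ones k)
  where
  lem : ∀ a b c → a + (b + suc c) ≡ suc (a + b + c)
  lem = solve-∀

zeros-B : ∀ {n} (L : Bal n) k → zeros (⟦ L ⟧ᴮ k) ≡ szᴮ L + zeros k
zeros-B ⌈ d ⌉ k = zeros-D d k
zeros-B (L ▸ d) k rewrite zeros-B L (I ∷ ⟦ d ⟧ k) | zeros-D d k = sym (+-assoc (szᴮ L) (sz d) (zeros k))

ones-B : ∀ {n} (L : Bal n) k → ones (⟦ L ⟧ᴮ k) ≡ n + szᴮ L + ones k
ones-B ⌈ d ⌉ k = ones-D d k
ones-B {suc n} (L ▸ d) k rewrite ones-B L (I ∷ ⟦ d ⟧ k) | ones-D d k = lem n (szᴮ L) (sz d) (ones k)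
  where
  lem : ∀ n a b c → n + a + suc (b + c) ≡ suc (n + (a + b) + c)
  lem = solve-∀

szᶠ : ∀ {b a} → Form b a → ℕ
szᶠ (lf L) = szᴮ L
szᶠ (f ∙ d) = szᶠ f + sz d

zeros-F : ∀ {b a} (f : Form b a) k → zeros (str f k) ≡ a + szᶠ f + zeros k
zeros-F (lf L) k = zeros-B L k
zeros-F {a = suc a} (f ∙ d) k rewrite zeros-F f (O ∷ ⟦ d ⟧ k) | zeros-D d k = lem a (szᶠ f) (sz d) (zeros k)
  where
  lem : ∀ n a b c → n + a + suc (b + c) ≡ suc (n + (a + b) + c)
  lem = solve-∀

ones-F : ∀ {b a} (f : Form b a) k → ones (str f k) ≡ b + szᶠ f + ones k
ones-F (lf L) k = ones-B L k
ones-F {b} (f ∙ d) k rewrite ones-F f (O ∷ ⟦ d ⟧ k) | ones-D d k = lem b (szᶠ f) (sz d) (ones k)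
  where
  lem : ∀ n a b c → n + a + (b + c) ≡ n + (a + b) + c
  lem = solve-∀

-- The words of length 2m+1 in the middle 2λ+2 levels.
record Band (m λ′ : ℕ) (x : V) : Set where
  constructor band
  field
    total : zeros x + ones x ≡ suc (dbl m)
    low   : zeros x ≤ ones x + suc (dbl λ′)
    high  : ones x ≤ zeros x + suc (dbl λ′)
open Band public

Band? : ∀ m λ′ → Decidable (Band m λ′)
Band? m λ′ x with (zeros x + ones x) ≟ suc (dbl m) | zeros x ≤? ones x + suc (dbl λ′) | ones x ≤? zeros x + suc (dbl λ′)
... | yes p | yes q | yes r = yes (band p q r)
... | no ¬p | _ | _ = no (λ z → ¬p (total z))
... | yes _ | no ¬p | _ = no (λ z → ¬p (low z))
... | yes _ | yes _ | no ¬p = no (λ z → ¬p (high z))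

Band-length : ∀ {m λ′ x} → Band m λ′ x → length x ≡ suc (dbl m)
Band-length {x = x} p = trans (length-count x) (total p)

Band-bit : ∀ {μ} c → Band 0 μ (c ∷ [])
Band-bit O = band refl (s≤s z≤n) z≤n
Band-bit I = band refl z≤n (s≤s z≤n)

mkBand : ∀ {m λ′ x z o} → zeros x ≡ z → ones x ≡ o →
         z + o ≡ suc (dbl m) → z ≤ o + suc (dbl λ′) → o ≤ z + suc (dbl λ′) → Band m λ′ x
mkBand refl refl = band

-- Matched pairs contribute equally to zeros and ones and cancel in both inequalities: the level is
-- governed by the unmatched bits alone.
record BandF (m λ′ b a s : ℕ) : Set where
  constructor bandF
  field
    totalF : dbl s + (a + b) ≡ suc (dbl m)
    lowF   : a ≤ b + suc (dbl λ′)
    highF  : b ≤ a + suc (dbl λ′)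
open BandF public

private
  reg : ∀ a b s → (a + s + 0) + (b + s + 0) ≡ (s + s) + (a + b)
  reg = solve-∀
  sh : ∀ b s l → b + s + 0 + l ≡ b + l + s
  sh = solve-∀

Band⇒F : ∀ {m λ′ b a} (f : Form b a) → Band m λ′ (str f []) → BandF m λ′ b a (szᶠ f)
Band⇒F {m} {λ′} {b} {a} f (band p q r) rewrite zeros-F f [] | ones-F f [] = bandF
  (trans (cong (_+ (a + b)) (dbl≡ (szᶠ f))) (trans (sym (reg a b (szᶠ f))) p))
  (+-cancelʳ-≤ (szᶠ f) a _ (subst₂ _≤_ (+-identityʳ _) (sh b (szᶠ f) _) q))
  (+-cancelʳ-≤ (szᶠ f) b _ (subst₂ _≤_ (+-identityʳ _) (sh a (szᶠ f) _) r))

F⇒Band : ∀ {m λ′ b a} (f : Form b a) → BandF m λ′ b a (szᶠ f) → Band m λ′ (str f [])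
F⇒Band {m} {λ′} {b} {a} f (bandF p q r) = mkBand (zeros-F f []) (ones-F f [])
  (trans (reg a b (szᶠ f)) (trans (cong (_+ (a + b)) (sym (dbl≡ (szᶠ f)))) p))
  (subst₂ _≤_ (sym (+-identityʳ _)) (sym (sh b (szᶠ f) _)) (+-monoˡ-≤ (szᶠ f) q))
  (subst₂ _≤_ (sym (+-identityʳ _)) (sym (sh a (szᶠ f) _)) (+-monoˡ-≤ (szᶠ f) r))

prepᴮ : ∀ {n r} → Bal n → Bal r → Bal (r + suc n)
prepᴮ S ⌈ d ⌉ = S ▸ d
prepᴮ S (L ▸ d) = prepᴮ S L ▸ d

prepᶠ : ∀ {n r a} → Bal n → Form r a → Form (r + suc n) a
prepᶠ S (lf L) = lf (prepᴮ S L)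
prepᶠ S (f ∙ d) = prepᶠ S f ∙ d

prepˢ : ∀ {n} → Bal n → SomeForm → SomeForm
prepˢ S ⟨ f ⟩ = ⟨ prepᶠ S f ⟩

prep-⊳ : ∀ {n r} (S : Bal n) (L : Bal r) d → prepᴮ S (L ⊳ d) ≡ prepᴮ S L ⊳ d
prep-⊳ S ⌈ _ ⌉ d = refl
prep-⊳ S (L ▸ _) d = refl

prep-snoc : ∀ {n} (S : Bal n) f c → snoc (prepˢ S f) c ≡ prepˢ S (snoc f c)
prep-snoc S ⟨ f ⟩ O = refl
prep-snoc S ⟨ lf L ⟩ I = refl
prep-snoc S ⟨ lf L ∙ d ⟩ I = cong (λ z → ⟨ lf z ⟩) (sym (prep-⊳ S L d))
prep-snoc S ⟨ f ∙ c ∙ d ⟩ I = refl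

prep-run : ∀ {n} (S : Bal n) f x → run (prepˢ S f) x ≡ prepˢ S (run f x)
prep-run S f [] = refl
prep-run S f (c ∷ x) = trans (cong (λ z → run z x) (prep-snoc S f c)) (prep-run S (snoc f c) x)

prepᴮ-str : ∀ {n r} (S : Bal n) (L : Bal r) k → ⟦ prepᴮ S L ⟧ᴮ k ≡ ⟦ S ⟧ᴮ (I ∷ ⟦ L ⟧ᴮ k)
prepᴮ-str S ⌈ d ⌉ k = refl
prepᴮ-str S (L ▸ d) k = prepᴮ-str S L _

prep-str : ∀ {n r a} (S : Bal n) (f : Form r a) k → str (prepᶠ S f) k ≡ ⟦ S ⟧ᴮ (I ∷ str f k)
prep-str S (lf L) k = prepᴮ-str S L k
prep-str S (f ∙ d) k = prep-str S f _

parse-prep : ∀ {n} (S : Bal n) z → parse (⟦ S ⟧ᴮ (I ∷ z)) ≡ prepˢ S (parse z)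
parse-prep S z = trans (parse-B S (I ∷ z)) (prep-run S ⟨ lf ⌈ ε ⌉ ⟩ z)

szᴮ-prep : ∀ {n r} (S : Bal n) (L : Bal r) → szᴮ (prepᴮ S L) ≡ szᴮ S + szᴮ L
szᴮ-prep S ⌈ d ⌉ = refl
szᴮ-prep S (L ▸ d) = trans (cong (_+ sz d) (szᴮ-prep S L)) (+-assoc (szᴮ S) _ _)

szᶠ-prep : ∀ {n r a} (S : Bal n) (f : Form r a) → szᶠ (prepᶠ S f) ≡ szᴮ S + szᶠ f
szᶠ-prep S (lf L) = szᴮ-prep S L
szᶠ-prep S (f ∙ d) = trans (cong (_+ sz d) (szᶠ-prep S f)) (+-assoc (szᴮ S) _ _)

data Prep {n r} : Bal (r + suc n) → Set where
  isPrep : (S : Bal n) (L : Bal r) → Prep (prepᴮ S L)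

unprepᴮ : ∀ r {n} (L : Bal (r + suc n)) → Prep {n} {r} L
unprepᴮ zero (S ▸ d) = isPrep S ⌈ d ⌉
unprepᴮ (suc r) (L ▸ d) with unprepᴮ r L
... | isPrep S L′ = isPrep S (L′ ▸ d)

data Prepᶠ {n r a} : Form (r + suc n) a → Set where
  isPrepᶠ : (S : Bal n) (f : Form r a) → Prepᶠ (prepᶠ S f)

unprep : ∀ r {n a} (f : Form (r + suc n) a) → Prepᶠ {n} {r} f
unprep r {n} (lf L) with unprepᴮ r L
... | isPrep S L′ = isPrepᶠ S (lf L′)
unprep r (f ∙ d) with unprep r f
... | isPrepᶠ S f′ = isPrepᶠ S (f′ ∙ d)

strip : ℕ → ∀ {n} → Bal n → ∃ Bal
strip zero L = _ , L
strip (suc r) (L ▸ d) = strip r L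
strip (suc r) ⌈ d ⌉ = _ , ⌈ d ⌉

strip-prep : ∀ {n r} (S : Bal n) (L : Bal r) → strip (suc r) (prepᴮ S L) ≡ (n , S)
strip-prep S ⌈ d ⌉ = refl
strip-prep S (L ▸ d) = strip-prep S L

left : ∀ {b a} → Form b a → Bal b
left (lf L) = L
left (f ∙ d) = left f

left-prep : ∀ {n r a} (S : Bal n) (f : Form r a) → left (prepᶠ S f) ≡ prepᴮ S (left f)
left-prep S (lf L) = refl
left-prep S (f ∙ d) = left-prep S f

suffix : D → D → V
suffix v B = O ∷ ⟦ v ⟧ (O ∷ ⟦ B ⟧ [])

-- The names of the classes: `cd` for z0v0B with k ≥ 1, `cq` for the 4-cycle c0udB, `cs` for cydw (a
-- 4-cycle, or a single edge when y has 2μ+1 unmatched ones), `ct` for S1z. The code `junk` makes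
-- `code` total and is excluded by `Valid`.
data Code : Set where
  cd   : ℕ → D → D → Code
  cq   : D → D → Code
  cs   : ∀ {n} → Bal n → D → Code
  ct   : ℕ → ∀ {n} → Bal n → Code
  junk : Code

-- Characterises the words S1z. With r = b - (2μ+2), the part z has r unmatched ones and a unmatched
-- zeros, and the second condition says a ≤ r+1. The counterpart r ≤ a+1, also required for z in
-- B(k,0), holds throughout B(m,μ+1).
Top : ℕ → ℕ → ℕ → Set
Top μ b a = suc (suc (dbl μ)) ≤ b × a + suc (suc (dbl μ)) ≤ suc b

Top? : ∀ μ b a → Dec (Top μ b a)
Top? μ b a = (suc (suc (dbl μ)) ≤? b) ×-dec (a + suc (suc (dbl μ)) ≤? suc b)

-- The class of the two words L*w. The first bit of L is the free bit c, and * is the free bit d. If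
-- L is empty, then * is c and d is the bit that closes the first factor of w, as in c0u1B.
star-code : ∀ {n} → Bal n → D → Code
star-code L w with front L
star-code _ w | empty with first w
... | none = junk
... | some u B = cq u B
star-code _ w | one y = cs y w
star-code _ w | nil y = cs y w

low-code : ℕ → D → D → Code
low-code zero v B = cq v B
low-code (suc k) v B = cd (suc k) v B

short-code : ℕ → ∀ {b a} → Form b a → Code
short-code m (lf ⌈ _ ⌉) = junk
short-code m (lf (L ▸ w)) = star-code L w
short-code m (lf L ∙ w) = star-code L w
short-code m (f ∙ v ∙ B) = low-code (m ∸ suc (sz v + sz B)) v B

top-code : ℕ → ℕ → ∃ Bal → Code
top-code m μ (_ , S) = ct (m ∸ (suc μ + szᴮ S)) S

code : ℕ → ℕ → SomeForm → Code
code m μ (b , a , f) with Top? μ b a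
-- The part z contributes as many unmatched ones as `b` exceeds 2μ+2; the extra `suc` removes the 1
-- between S and z.
... | yes _ = top-code m μ (strip (suc (b ∸ suc (suc (dbl μ)))) (left f))
... | no _ = short-code m f

ι : ℕ → ℕ → V → Code
ι m μ x = code m μ (parse x)

-- In `vb`, where y has 2μ+1 unmatched ones, only the first bit 0 occurs: writing y as Y1x, the word
-- 1ydw is S1z with S = 1Y and z = xdw and falls under `vt`.
data View (m μ : ℕ) : V → Set where
  vd : ∀ k v B z → Band (suc k) μ z → suc k + suc (sz v + sz B) ≡ m → View m μ (z ++ suffix v B)
  vq : ∀ c u d B → suc (sz u + sz B) ≡ m → View m μ (c ∷ O ∷ ⟦ u ⟧ (d ∷ ⟦ B ⟧ []))
  vc : ∀ {j} → j < μ → (y : Bal (suc (dbl j))) → ∀ c d w → suc j + (szᴮ y + sz w) ≡ m →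
       View m μ (c ∷ ⟦ y ⟧ᴮ (d ∷ ⟦ w ⟧ []))
  vb : (y : Bal (suc (dbl μ))) → ∀ d w → suc μ + (szᴮ y + sz w) ≡ m → View m μ (O ∷ ⟦ y ⟧ᴮ (d ∷ ⟦ w ⟧ []))
  vt : ∀ k (S : Bal (suc (dbl μ))) z → Band k 0 z → k + (suc μ + szᴮ S) ≡ m → View m μ (⟦ S ⟧ᴮ (I ∷ z))

szᴮ-push1 : ∀ {n} (y : Bal n) → szᴮ (push1 y) ≡ szᴮ y
szᴮ-push1 ⌈ d ⌉ = refl
szᴮ-push1 (y ▸ d) = cong (_+ sz d) (szᴮ-push1 y)

sz-cons : ∀ p q → sz (cons p q) ≡ suc (sz p + sz q)
sz-cons p ε = cong suc (sym (+-identityʳ (sz p)))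
sz-cons p (q ▷ u) rewrite sz-cons p q = cong suc (trans (cong suc (+-assoc (sz p) _ _)) (sym (+-suc (sz p) _)))

szᴮ-push0 : ∀ {n} (y : Bal (suc n)) → szᴮ (push0 y) ≡ suc (szᴮ y)
szᴮ-push0 (⌈ p ⌉ ▸ q) = sz-cons p q
szᴮ-push0 (y ▸ c ▸ d) = cong (_+ sz d) (szᴮ-push0 (y ▸ c))

starᶠ : ∀ {n} → Bal n → Bool → D → SomeForm
starᶠ L O w = ⟨ lf L ∙ w ⟩
starᶠ L I w = ⟨ lf (L ▸ w) ⟩

parse-star : ∀ {n} (L : Bal n) d w → parse (⟦ L ⟧ᴮ (d ∷ ⟦ w ⟧ [])) ≡ starᶠ L d w
parse-star L O w = trans (parse-B L _) (run-D′ (lf L) w [])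
parse-star L I w = trans (parse-B L _) (trans (run-D (lf (L ▸ ε)) w []) (cong (λ z → ⟨ lf (L ▸ z) ⟩) (cat-ε w)))

module _ {m μ : ℕ} where
  code-short : ∀ {b a} (f : Form b a) → ¬ Top μ b a → code m μ (b , a , f) ≡ short-code m f
  code-short {b} {a} f ¬t with Top? μ b a
  ... | yes t = ⊥-elim (¬t t)
  ... | no _ = refl

  ι-star : ∀ {n} (L : Bal n) d w → n ≤ dbl μ → ι m μ (⟦ L ⟧ᴮ (d ∷ ⟦ w ⟧ [])) ≡ star-code L w
  ι-star L d w n≤ rewrite parse-star L d w with d
  ... | O = code-short (lf L ∙ w) (λ t → 1+n≰n (≤-trans (≤-trans (n≤1+n _) (proj₁ t)) n≤))
  ... | I = code-short (lf (L ▸ w)) (λ t → 1+n≰n (≤-trans (≤-pred (proj₁ t)) n≤))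

  ι-d : ∀ k v B z → Band k μ z → k + suc (sz v + sz B) ≡ m → ι m μ (z ++ suffix v B) ≡ low-code k v B
  ι-d k v B z p refl with parse z | str-parse z | run-++ ⟨ lf ⌈ ε ⌉ ⟩ z (suffix v B)
  ... | b , a , f | refl | eq rewrite eq | run-D′ f v (O ∷ ⟦ B ⟧ []) | run-D′ (f ∙ v) B [] =
    trans (code-short (f ∙ v ∙ B) ¬t) (cong (λ i → low-code i v B) (m+n∸n≡m k (suc (sz v + sz B))))
    where
    ¬t : ¬ Top μ b (suc (suc a))
    ¬t (_ , t) = 1+n≰n (≤-trans (≤-trans (n≤1+n _) (subst (_≤ b) (cong suc (+-suc a (suc (dbl μ)))) (≤-pred t))) (highF (Band⇒F f p)))

  ι-t : ∀ k (S : Bal (suc (dbl μ))) z → Band k 0 z → k + (suc μ + szᴮ S) ≡ m → ι m μ (⟦ S ⟧ᴮ (I ∷ z)) ≡ ct k S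
  ι-t k S z p refl with parse z | str-parse z | parse-prep S z
  ... | b , a , f | refl | eq rewrite eq with Top? μ (b + suc (suc (dbl μ))) a
  ...   | no ¬t = ⊥-elim (¬t (m≤n+m _ b , (+-monoˡ-≤ (suc (suc (dbl μ))) (subst (a ≤_) (+-comm b 1) (lowF (Band⇒F f p))))))
  ...   | yes _ rewrite m+n∸n≡m b (suc (suc (dbl μ))) | left-prep S f | strip-prep S (left f) | m+n∸n≡m k (suc μ + szᴮ S) = refl

  ι-q : ∀ c u d B → suc (sz u + sz B) ≡ m → ι m μ (c ∷ O ∷ ⟦ u ⟧ (d ∷ ⟦ B ⟧ [])) ≡ cq u B
  ι-q c u I B eq = trans (cong (λ z → ι m μ (c ∷ z)) (sym (⟦cons⟧ u B [])))
    (trans (ι-star ⌈ ε ⌉ c (cons u B) z≤n) go)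
    where
    go : star-code ⌈ ε ⌉ (cons u B) ≡ cq u B
    go rewrite first-cons u B = refl
  ι-q c u O B eq = ι-d 0 u B (c ∷ []) (Band-bit c) eq

  ι-s : ∀ {n} (y : Bal (suc n)) c d w → suc (suc n) ≤ dbl μ ⊎ n ≤ dbl μ × c ≡ O → ι m μ (c ∷ ⟦ y ⟧ᴮ (d ∷ ⟦ w ⟧ [])) ≡ cs y w
  ι-s y O d w h = trans (cong (ι m μ) (sym (⟦push0⟧ y _))) (trans (ι-star (push0 y) d w (n≤ h)) go)
    where
    n≤ : ∀ {n} → suc (suc n) ≤ dbl μ ⊎ n ≤ dbl μ × O ≡ O → n ≤ dbl μ
    n≤ (inj₁ p) = ≤-trans (n≤1+n _) (≤-trans (n≤1+n _) p)
    n≤ (inj₂ (p , _)) = p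
    go : star-code (push0 y) w ≡ cs y w
    go rewrite front-nil y = refl
  ι-s y I d w (inj₁ n≤) = trans (cong (ι m μ) (sym (⟦push1⟧ y _))) (trans (ι-star (push1 y) d w n≤) go)
    where
    go : star-code (push1 y) w ≡ cs y w
    go rewrite front-one y = refl

  Band-suffix : ∀ {k} v B {z} → Band k μ z → k + suc (sz v + sz B) ≡ m → Band m (suc μ) (z ++ suffix v B)
  Band-suffix {k} v B {z} (band p q r) refl = mkBand
    (trans (zeros-++ z _) (cong (λ i → zeros z + suc i) (trans (zeros-D v _) (cong (λ i → sz v + suc i) (trans (zeros-D B []) (+-identityʳ _))))))
    (trans (ones-++ z _) (cong (ones z +_) (trans (ones-D v _) (cong (sz v +_) (trans (ones-D B []) (+-identityʳ _))))))
    (trans (eq₁ (zeros z) (ones z) (sz v) (sz B)) (trans (cong (_+ (T + T)) p)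
       (trans (cong (λ i → suc (i + (T + T))) (dbl≡ k)) (trans (eq₂ k T) (cong suc (sym (dbl≡ (k + T))))))))
    (subst₂ _≤_ (eq₃ (zeros z) (sz v) (sz B)) (eq₄ (ones z) (dbl μ) (sz v) (sz B)) (+-monoˡ-≤ (suc T) q))
    (≤-trans (+-monoˡ-≤ (sz v + sz B) r) (≤-trans (m≤n+m _ 4) (≤-reflexive (eq₅ (zeros z) (dbl μ) (sz v) (sz B)))))
    where
    T = suc (sz v + sz B)
    eq₁ : ∀ z o v B → (z + suc (v + suc B)) + (o + (v + B)) ≡ (z + o) + (suc (v + B) + suc (v + B))
    eq₁ = solve-∀
    eq₂ : ∀ k t → suc (k + k + (t + t)) ≡ suc (k + t + (k + t))
    eq₂ = solve-∀
    eq₃ : ∀ z v B → z + suc (suc (v + B)) ≡ z + suc (v + suc B)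
    eq₃ = solve-∀
    eq₄ : ∀ o d v B → (o + suc d) + suc (suc (v + B)) ≡ (o + (v + B)) + suc (suc (suc d))
    eq₄ = solve-∀
    eq₅ : ∀ z d v B → 4 + ((z + suc d) + (v + B)) ≡ (z + suc (v + suc B)) + suc (suc (suc d))
    eq₅ = solve-∀

  Band-prefix : ∀ {k} (S : Bal (suc (dbl μ))) {z} → Band k 0 z → k + (suc μ + szᴮ S) ≡ m → Band m (suc μ) (⟦ S ⟧ᴮ (I ∷ z))
  Band-prefix {k} S {z} (band p q r) refl = mkBand (zeros-B S (I ∷ z)) (ones-B S (I ∷ z))
    (trans (eq₁ (szᴮ S) (zeros z) (ones z) (dbl μ)) (trans (cong₂ (λ i j → i + (2 + j + (szᴮ S + szᴮ S))) p (dbl≡ μ))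
       (trans (cong (λ i → suc (i + (2 + (μ + μ) + (szᴮ S + szᴮ S)))) (dbl≡ k)) (trans (eq₂ k μ (szᴮ S)) (cong suc (sym (dbl≡ _)))))))
    (≤-trans (+-monoʳ-≤ (szᴮ S) q) (≤-trans (m≤n+m _ (4 + dbl μ + dbl μ)) (≤-reflexive (eq₃ (szᴮ S) (ones z) (dbl μ)))))
    (subst₂ _≤_ (eq₄ (szᴮ S) (ones z) (dbl μ)) (eq₅ (szᴮ S) (zeros z) (dbl μ)) (+-monoʳ-≤ (suc (suc (dbl μ)) + szᴮ S) r))
    where
    eq₁ : ∀ s z o d → (s + z) + (suc d + s + suc o) ≡ (z + o) + (2 + d + (s + s))
    eq₁ = solve-∀
    eq₂ : ∀ k u s → suc (k + k + (2 + (u + u) + (s + s))) ≡ suc (k + (suc u + s) + (k + (suc u + s)))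
    eq₂ = solve-∀
    eq₃ : ∀ s o d → (4 + d + d) + (s + (o + 1)) ≡ suc d + s + suc o + suc (suc (suc d))
    eq₃ = solve-∀
    eq₄ : ∀ s o d → suc (suc d) + s + o ≡ suc d + s + suc o
    eq₄ = solve-∀
    eq₅ : ∀ s z d → suc (suc d) + s + (z + 1) ≡ s + z + suc (suc (suc d))
    eq₅ = solve-∀

  Band-star : ∀ {j} (L : Bal (dbl j)) d w → j ≤ μ → j + (szᴮ L + sz w) ≡ m → Band m (suc μ) (⟦ L ⟧ᴮ (d ∷ ⟦ w ⟧ []))
  Band-star {j} L O w j≤ refl = F⇒Band (lf L ∙ w) (bandF (tot j (szᴮ L + sz w)) (≤-trans (s≤s z≤n) (m≤n+m _ (dbl j)))
    (≤-trans (dbl-mono j≤) (≤-trans (n≤1+n _) (≤-trans (n≤1+n _) (≤-trans (n≤1+n _) (n≤1+n _))))))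
    where
    tot : ∀ j s → dbl s + suc (dbl j) ≡ suc (dbl (j + s))
    tot j s rewrite dbl≡ j | dbl≡ s | dbl≡ (j + s) = eq j s
      where
      eq : ∀ j s → s + s + suc (j + j) ≡ suc (j + s + (j + s))
      eq = solve-∀
  Band-star {j} L I w j≤ refl = F⇒Band (lf (L ▸ w)) (bandF (tot j (szᴮ L + sz w)) z≤n
    (s≤s (≤-trans (dbl-mono j≤) (≤-trans (n≤1+n _) (n≤1+n _)))))
    where
    tot : ∀ j s → dbl s + suc (dbl j) ≡ suc (dbl (j + s))
    tot j s rewrite dbl≡ j | dbl≡ s | dbl≡ (j + s) = eq j s
      where
      eq : ∀ j s → s + s + suc (j + j) ≡ suc (j + s + (j + s))
      eq = solve-∀

str-++ : ∀ {b a} (f : Form b a) k s → str f k ++ s ≡ str f (k ++ s)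
str-++ (lf L) k s = ⟦⟧ᴮ-++ L k s
str-++ (f ∙ d) k s = trans (str-++ f _ s) (cong (λ z → str f (O ∷ z)) (⟦⟧-++ d k s))

module _ {m μ : ℕ} where
  -- By parity L has an even number 2j of unmatched ones. Removing its first bit leaves an odd
  -- number: one less if the bit is 1, one more if it is 0, since a match is broken. Only the latter
  -- with j = μ gives a single edge.
  classify-star : ∀ {n} (L : Bal n) d w → n ≤ suc (dbl μ) → dbl (szᴮ L + sz w) + suc n ≡ suc (dbl (suc m)) →
                  View (suc m) μ (⟦ L ⟧ᴮ (d ∷ ⟦ w ⟧ []))
  classify-star {n} L d w n≤ tot with odd-split (suc n) (szᴮ L + sz w) (suc m) (trans (+-comm (suc n) _) tot)
  ... | j , refl , eq with front L
  classify-star _ d w n≤ tot | zero , refl , eq | empty with first w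
  ... | none with () ← eq
  ... | some u B = subst (View (suc m) μ) (cong (d ∷_) (sym (⟦cons⟧ u B []))) (vq d u I B (trans (sym (sz-cons u B)) eq))
  classify-star _ d w n≤ tot | suc j , refl , eq | one y =
    subst (View (suc m) μ) (sym (⟦push1⟧ y _))
      (vc (dbl-cancel (suc j) μ n≤) y I d w (trans (cong (λ i → suc j + (i + sz w)) (sym (szᴮ-push1 y))) eq))
  classify-star _ d w n≤ tot | j , refl , eq | nil y with m≤n⇒m<n∨m≡n (dbl-cancel j μ n≤)
  ... | inj₁ j<μ = subst (View (suc m) μ) (sym (⟦push0⟧ y _)) (vc j<μ y O d w
          (trans (sym (trans (cong (λ i → j + (i + sz w)) (szᴮ-push0 y)) (+-suc j _))) eq))
  ... | inj₂ refl = subst (View (suc m) μ) (sym (⟦push0⟧ y _)) (vb y d w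
          (trans (sym (trans (cong (λ i → j + (i + sz w)) (szᴮ-push0 y)) (+-suc j _))) eq))

  classify-short : ∀ {b a} (f : Form b a) → ¬ Top μ b a → BandF (suc m) (suc μ) b a (szᶠ f) → View (suc m) μ (str f [])
  classify-short (lf ⌈ d ⌉) ¬t (bandF p q r) = ⊥-elim (dbl-≢ (sz d) (suc m) (trans (sym (+-identityʳ _)) p))
  classify-short {suc b} (lf (L ▸ w)) ¬t (bandF p q r) with b ≤? suc (dbl μ)
  ... | yes b≤ = classify-star L I w b≤ p
  ... | no b≰ = ⊥-elim (¬t (≤-trans (≰⇒> b≰) (n≤1+n _) , ≤-trans (≰⇒> b≰) (≤-trans (n≤1+n _) (n≤1+n _))))
  classify-short {b} (lf L ∙ w) ¬t (bandF p q r) with b ≤? suc (dbl μ)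
  ... | yes b≤ = classify-star L O w b≤ p
  ... | no b≰ = ⊥-elim (¬t (≰⇒> b≰ , s≤s (≰⇒> b≰)))
  classify-short {b} {suc (suc a)} (f ∙ v ∙ B) ¬t (bandF p q r)
    with odd-split (dbl (szᶠ f) + (a + b)) (suc (sz v + sz B)) (suc m) (trans (eq (szᶠ f) (sz v) (sz B) a b) p)
    where
    eq : ∀ s v B a b → dbl s + (a + b) + dbl (suc (v + B)) ≡ dbl (s + v + B) + (suc (suc a) + b)
    eq s v B a b rewrite dbl≡ s | dbl≡ (v + B) | dbl≡ (s + v + B) = lem s v B a b
      where
      lem : ∀ s v B a b → s + s + (a + b) + suc (suc (v + B + (v + B))) ≡ s + v + B + (s + v + B) + (suc (suc a) + b)
      lem = solve-∀
  ... | k , tot , eqk = result k tot eqk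
    where
    -- If `b` exceeded the bound by two or more, the word would be of the form S1z; if by one, the
    -- number of unmatched bits would be even.
    b≤ : b ≤ a + suc (dbl μ)
    b≤ with b ≤? a + suc (dbl μ)
    ... | yes h = h
    ... | no h with m≤n⇒m<n∨m≡n (≰⇒> h)
    ...   | inj₁ big = ⊥-elim (¬t (≤-trans (s≤s (m≤n+m _ a)) (<⇒≤ big) , ≤-trans (≤-reflexive (eq a (dbl μ))) (s≤s big)))
      where
      eq : ∀ a d → suc (suc a) + suc (suc d) ≡ suc (suc (suc (a + suc d)))
      eq = solve-∀
    ...   | inj₂ refl = ⊥-elim (dbl-≢ (szᶠ (f ∙ v ∙ B) + (suc (suc a) + μ)) (suc m) (trans eq p))
      where
      eq : dbl (szᶠ (f ∙ v ∙ B) + (suc (suc a) + μ)) ≡ dbl (szᶠ (f ∙ v ∙ B)) + (suc (suc a) + suc (a + suc (dbl μ)))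
      eq rewrite dbl≡ (szᶠ (f ∙ v ∙ B) + (suc (suc a) + μ)) | dbl≡ (szᶠ (f ∙ v ∙ B)) | dbl≡ μ = lem (szᶠ (f ∙ v ∙ B)) a μ
        where
        lem : ∀ s a u → s + (suc (suc a) + u) + (s + (suc (suc a) + u)) ≡ s + s + (suc (suc a) + suc (a + suc (u + u)))
        lem = solve-∀
    a≤ : a ≤ b + suc (dbl μ)
    a≤ = ≤-pred (≤-pred (≤-trans q (≤-reflexive (eq b (dbl μ)))))
      where
      eq : ∀ b d → b + suc (suc (suc d)) ≡ suc (suc (b + suc d))
      eq = solve-∀
    ends : str (f ∙ v ∙ B) [] ≡ str f [] ++ suffix v B
    ends = sym (str-++ f [] (suffix v B))
    result : ∀ k → dbl (szᶠ f) + (a + b) ≡ suc (dbl k) → k + suc (sz v + sz B) ≡ suc m → View (suc m) μ (str (f ∙ v ∙ B) [])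
    result (suc k) t e = subst (View (suc m) μ) (sym ends) (vd k v B (str f []) (F⇒Band f (bandF t a≤ b≤)) e)
    result zero t e with str f [] | Band-length (F⇒Band f (bandF {λ′ = μ} t a≤ b≤)) | ends
    ... | c ∷ [] | refl | eq = subst (View (suc m) μ) (sym eq) (vq c v O B e)

classify-top : ∀ {m μ b a} (f : Form b a) r → r + suc (suc (dbl μ)) ≡ b → a + suc (suc (dbl μ)) ≤ suc b →
               BandF (suc m) (suc μ) b a (szᶠ f) → View (suc m) μ (str f [])
classify-top {m} {μ} {a = a} f r refl a≤ p with unprep r {suc (dbl μ)} f
... | isPrepᶠ S f′ = go p
  where
  go : BandF (suc m) (suc μ) (r + suc (suc (dbl μ))) a (szᶠ (prepᶠ S f′)) → View (suc m) μ (str (prepᶠ S f′) [])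
  go (bandF t q h) with odd-split (dbl (szᶠ f′) + (a + r)) (suc μ + szᴮ S) (suc m) (trans eq t)
    where
    eq : dbl (szᶠ f′) + (a + r) + dbl (suc μ + szᴮ S) ≡ dbl (szᶠ (prepᶠ S f′)) + (a + (r + suc (suc (dbl μ))))
    eq rewrite szᶠ-prep S f′ | dbl≡ (szᶠ f′) | dbl≡ (μ + szᴮ S) | dbl≡ (szᴮ S + szᶠ f′) | dbl≡ μ = lem (szᶠ f′) a r μ (szᴮ S)
      where
      lem : ∀ f a r u s → f + f + (a + r) + suc (suc (u + s + (u + s))) ≡ s + f + (s + f) + (a + (r + suc (suc (u + u))))
      lem = solve-∀
  ... | k , t′ , eqk = subst (View (suc m) μ) (sym (prep-str S f′ [])) (vt k S (str f′ []) (F⇒Band f′ (bandF t′ a≤′ r≤)) eqk)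
    where
    a≤′ : a ≤ r + 1
    a≤′ = +-cancelʳ-≤ (suc (suc (dbl μ))) a _ (≤-trans a≤ (≤-reflexive (lem r (dbl μ))))
      where
      lem : ∀ r d → suc (r + suc (suc d)) ≡ r + 1 + suc (suc d)
      lem = solve-∀
    r≤ : r ≤ a + 1
    r≤ = +-cancelʳ-≤ (suc (suc (dbl μ))) r _ (≤-trans h (≤-reflexive (lem a (dbl μ))))
      where
      lem : ∀ a d → a + suc (suc (suc d)) ≡ a + 1 + suc (suc d)
      lem = solve-∀

classify : ∀ {m μ x} → Band (suc m) (suc μ) x → View (suc m) μ x
classify {m} {μ} {x} p with parse x | str-parse x
... | b , a , f | refl with Top? μ b a
...   | no ¬t = classify-short f ¬t (Band⇒F f p)
...   | yes (b≥ , a≤) with m≤n⇒∃[o]m+o≡n b≥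
...     | r , eq = classify-top f r (trans (+-comm r _) eq) a≤ (Band⇒F f p)

⟦⟧-inj : ∀ d {k k′} → ⟦ d ⟧ k ≡ ⟦ d ⟧ k′ → k ≡ k′
⟦⟧-inj ε p = p
⟦⟧-inj (X ▷ u) p with ⟦⟧-inj X p
... | q with ⟦⟧-inj u (cong (λ { [] → [] ; (_ ∷ z) → z }) q)
...   | refl = refl

⟦⟧ᴮ-inj : ∀ {n} (L : Bal n) {k k′} → ⟦ L ⟧ᴮ k ≡ ⟦ L ⟧ᴮ k′ → k ≡ k′
⟦⟧ᴮ-inj ⌈ d ⌉ p = ⟦⟧-inj d p
⟦⟧ᴮ-inj (L ▸ d) p with ⟦⟧ᴮ-inj L p
... | q = ⟦⟧-inj d (cong (λ { [] → [] ; (_ ∷ z) → z }) q)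

-- At most one irreducible factor. When there are more levels, the edges 00u* with other `u` are
-- spent on the exchange `k2`, so they cannot be promised to the next stage.
data Irr : D → Set where
  irrε : Irr ε
  irr▷ : ∀ t → Irr (ε ▷ t)

-- Edges guaranteed on the Hamilton cycle of the middle two levels.
data MidEdge (k : ℕ) : Set where
  flip-star : ∀ x w → .(sz x + sz w ≡ k) → MidEdge k
  flip-last : ∀ x → .(suc (sz x) ≡ k) → MidEdge k

midᵛ : ∀ {k} → MidEdge k → Bool → V
midᵛ (flip-star x w _) c = ⟦ x ⟧ (c ∷ ⟦ w ⟧ [])
midᵛ (flip-last x _) c = I ∷ O ∷ ⟦ x ⟧ (c ∷ [])

midᵉ : ∀ {k} (r : MidEdge k) → Adj (midᵛ r O) (midᵛ r I)
midᵉ (flip-star x w _) = ⟦⟧-adj x up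
midᵉ (flip-last x _) = I ∷ (O ∷ ⟦⟧-adj x up)

MidHam : ℕ → Set
MidHam k = Ham {MidEdge k} (λ r → midᵛ r O) (λ r → midᵛ r I) midᵉ (Band k 0)

-- Edges guaranteed on the Hamilton cycle of the middle 2(μ+2) levels.
data Kept (m μ : ℕ) : Set where
  flip-first : ∀ {j} → .(j ≤ μ) → (z : Bal (dbl j)) → .(j + szᴮ z ≡ m) → Kept m μ
  flip-last  : ∀ u → Irr u → .(suc (sz u) ≡ m) → Kept m μ

keptᵛ : ∀ {m μ} → Kept m μ → Bool → V
keptᵛ (flip-first _ z _) c = c ∷ ⟦ z ⟧ᴮ []
keptᵛ (flip-last u _ _) c = O ∷ O ∷ ⟦ u ⟧ (c ∷ [])

keptᵉ : ∀ {m μ} (r : Kept m μ) → Adj (keptᵛ r O) (keptᵛ r I)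
keptᵉ (flip-first _ z _) = up
keptᵉ (flip-last u _ _) = O ∷ (O ∷ ⟦⟧-adj u up)

BandHam : ℕ → ℕ → Set
BandHam m μ = Ham {Kept m μ} (λ r → keptᵛ r O) (λ r → keptᵛ r I) keptᵉ (Band m (suc μ))

pairs : ℕ → D
pairs zero = ε
pairs (suc n) = pairs n ▷ ε

sz-pairs : ∀ n → sz (pairs n) ≡ n
sz-pairs zero = refl
sz-pairs (suc n) = cong suc (trans (+-identityʳ _) (sz-pairs n))

Valid : ℕ → ℕ → Code → Set
Valid m μ (cd k v B) = (∃ λ k′ → k ≡ suc k′) × k + suc (sz v + sz B) ≡ m
Valid m μ (cq u B) = suc (sz u + sz B) ≡ m
Valid m μ (cs {n} y w) = (∃ λ j → j < μ × n ≡ suc (dbl j) × suc j + (szᴮ y + sz w) ≡ m)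
                       ⊎ (n ≡ suc (dbl μ) × suc μ + (szᴮ y + sz w) ≡ m)
Valid m μ (ct k {n} S) = n ≡ suc (dbl μ) × k + (suc μ + szᴮ S) ≡ m
Valid m μ junk = ⊥

view-code : ∀ {m μ x} → View m μ x → Code
view-code (vd k v B _ _ _) = cd (suc k) v B
view-code (vq _ u _ B _) = cq u B
view-code (vc _ y _ _ w _) = cs y w
view-code (vb y _ w _) = cs y w
view-code (vt k S _ _ _) = ct k S

2+dbl≤ : ∀ {j μ} → j < μ → suc (suc (dbl j)) ≤ dbl μ
2+dbl≤ p = dbl-mono p

view-ι : ∀ {m μ x} (v : View m μ x) → ι m μ x ≡ view-code v
view-ι (vd k v B z p e) = ι-d (suc k) v B z p e
view-ι (vq c u d B e) = ι-q c u d B e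
view-ι (vc {j} j<μ y c d w e) = ι-s y c d w (inj₁ (2+dbl≤ j<μ))
view-ι (vb y d w e) = ι-s y O d w (inj₂ (≤-refl , refl))
view-ι (vt k S z p e) = ι-t k S z p e

view-valid : ∀ {m μ x} (v : View m μ x) → Valid m μ (view-code v)
view-valid (vd k v B z p e) = (k , refl) , e
view-valid (vq c u d B e) = e
view-valid (vc {j} j<μ y c d w e) = inj₁ (j , j<μ , refl , e)
view-valid (vb y d w e) = inj₂ (refl , e)
view-valid (vt k S z p e) = refl , e

view-band : ∀ {m μ x} → View m μ x → Band m (suc μ) x
view-band (vd k v B z p e) = Band-suffix v B p e
view-band (vq c u I B e) = subst (Band _ _) (cong (c ∷_) (⟦cons⟧ u B []))
  (Band-star ⌈ ε ⌉ c (cons u B) z≤n (trans (sz-cons u B) e))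
view-band (vq c u O B e) = Band-suffix {k = 0} u B (Band-bit c) e
view-band {m} (vc {j} j<μ y O d w e) = subst (Band _ _) (⟦push0⟧ y _) (Band-star (push0 y) d w (<⇒≤ j<μ)
  (trans (cong (λ i → j + (i + sz w)) (szᴮ-push0 y)) (trans (+-suc j _) e)))
view-band (vc {j} j<μ y I d w e) = subst (Band _ _) (⟦push1⟧ y _) (Band-star {j = suc j} (push1 y) d w j<μ
  (trans (cong (λ i → suc j + (i + sz w)) (szᴮ-push1 y)) e))
view-band {μ = μ} (vb y d w e) = subst (Band _ _) (⟦push0⟧ y _) (Band-star (push0 y) d w ≤-refl
  (trans (cong (λ i → μ + (i + sz w)) (szᴮ-push0 y)) (trans (+-suc μ _) e)))
view-band (vt k S z p e) = Band-prefix S p e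

data View′ (m μ : ℕ) (x : V) (c : Code) : Set where
  view : (v : View m μ x) → view-code v ≡ c → View′ m μ x c

-- For k = 0 the words z0v0B have z = c, and belong to the 4-cycle of the words c0vdB.
view-low : ∀ {m μ k} v B z → Band k μ z → k + suc (sz v + sz B) ≡ m → View′ m μ (z ++ suffix v B) (low-code k v B)
view-low {k = suc k} v B z p e = view (vd k v B z p e) refl
view-low {k = zero} v B z p e with z | Band-length p
... | c ∷ [] | refl = view (vq c v O B e) refl

-- Cycles from copies of Hamilton cycles, from 4-cycles and from single edges

module _ {R : Set} (X : Squares R) where
  open Squares X using (sys)
  open Walks sys

  innˢ-nil : ∀ {a b} (x : Step a b) → innˢ x ≡ []
  innˢ-nil (pl x) = refl
  innˢ-nil (fw (inj₁ _) _ _) = refl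
  innˢ-nil (fw (inj₂ _) _ _) = refl
  innˢ-nil (bw (inj₁ _) _ _) = refl
  innˢ-nil (bw (inj₂ _) _ _) = refl

  -- The map `f` copies a Hamilton cycle into a class, and `σ` decides on what the image of each
  -- guaranteed edge is spent.
  module Embed {R₀ : Set} {s₀ t₀ : R₀ → V} {e₀} {P₀ : V → Set} (h : Ham s₀ t₀ e₀ P₀) (f : V → V)
    (f-adj : ∀ {a b} → Adj a b → Adj (f a) (f b)) (σ : ∀ r → Step (f (s₀ r)) (f (t₀ r))) where
    private
      module A = Walks (adjSys s₀ t₀ e₀)
      module H = Ham h

      φ : ∀ {a b} → A.Step a b → Walk (f a) (f b)
      φ (A.pl x) = pl (f-adj x) ∷ʷ []
      φ (A.fw r refl refl) = σ r ∷ʷ []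
      φ (A.bw r refl refl) = revˢ (σ r) ∷ʷ []

      φ-vs : ∀ {a b} (x : A.Step a b) → vs (φ x) ↭ map f (A.innˢ x ++ [ b ])
      φ-vs (A.pl x) = refl
      φ-vs (A.fw r refl refl) rewrite innˢ-nil (σ r) = refl
      φ-vs (A.bw r refl refl) rewrite innˢ-nil (revˢ (σ r)) = refl

      φ-lab : ∀ {r l} → l ∈ labˢ (σ r) → ∀ {a b} (x : A.Step a b) → r ∈ A.labˢ x → l ∈ labs (φ x)
      φ-lab p (A.fw r refl refl) (here refl) = ∈-++⁺ˡ p
      φ-lab p (A.bw r refl refl) (here refl) = ∈-++⁺ˡ (subst (_ ∈_) (sym (labˢ-rev (σ r))) p)

      open MapWalk (adjSys s₀ t₀ e₀) sys f φ φ-vs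

    cyc : Cyc
    cyc = f H.start , mapʷ H.walk

    cyc-uniq : (∀ {a b} → f a ≡ f b → a ≡ b) → Unique (vsᶜ cyc)
    cyc-uniq inj = Unique-resp-↭ (↭-sym (map-vs H.walk)) (Uniqueₚ.map⁺ inj H.unique)

    cyc-sound : ∀ {y} → y ∈ vsᶜ cyc → ∃ λ z → P₀ z × y ≡ f z
    cyc-sound p with ∈-map⁻ f (∈-resp-↭ (map-vs H.walk) p)
    ... | z , q , eq = z , H.sound q , eq

    cyc-complete : ∀ {z} → P₀ z → f z ∈ vsᶜ cyc
    cyc-complete p = ∈-resp-↭ (↭-sym (map-vs H.walk)) (∈-map⁺ f (H.complete p))

    cyc-lab : ∀ r {l} → l ∈ labˢ (σ r) → l ∈ labsᶜ cyc
    cyc-lab r p = map-labs (φ-lab p) H.walk (H.present r)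

  module Quad (v : Bool → Bool → V) (inj : ∀ {a b c d} → v a b ≡ v c d → a ≡ c × b ≡ d)
    (e₀ : Step (v O O) (v O I)) (e₁ : Step (v I O) (v I I)) (f₀ : Step (v O O) (v I O)) (f₁ : Step (v O I) (v I I)) where

    quad : Cyc
    quad = v O O , e₀ ∷ʷ f₁ ∷ʷ revˢ e₁ ∷ʷ revˢ f₀ ∷ʷ []

    private
      vs≡ : vsᶜ quad ≡ v O I ∷ v I I ∷ v I O ∷ v O O ∷ []
      vs≡ rewrite innˢ-nil e₀ | innˢ-nil f₁ | innˢ-nil (revˢ e₁) | innˢ-nil (revˢ f₀) = refl

    quad-uniq : Unique (vsᶜ quad)
    quad-uniq rewrite vs≡ =
      ((λ p → O≢I (proj₁ (inj p))) ∷ (λ p → O≢I (proj₁ (inj p))) ∷ (λ p → O≢I (sym (proj₂ (inj p)))) ∷ []) ∷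
      ((λ p → O≢I (sym (proj₂ (inj p)))) ∷ (λ p → O≢I (sym (proj₁ (inj p)))) ∷ []) ∷
      ((λ p → O≢I (sym (proj₁ (inj p)))) ∷ []) ∷ [] ∷ []

    quad-sound : ∀ {y} → y ∈ vsᶜ quad → ∃ λ a → ∃ λ b → y ≡ v a b
    quad-sound p rewrite vs≡ with p
    ... | here z = _ , _ , z
    ... | there (here z) = _ , _ , z
    ... | there (there (here z)) = _ , _ , z
    ... | there (there (there (here z))) = _ , _ , z

    quad-complete : ∀ a b → v a b ∈ vsᶜ quad
    quad-complete a b rewrite vs≡ = go a b
      where
      go : ∀ a b → v a b ∈ v O I ∷ v I I ∷ v I O ∷ v O O ∷ []
      go O I = here refl
      go I I = there (here refl)
      go I O = there (there (here refl))
      go O O = there (there (there (here refl)))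

    quad-e₀ : ∀ {l} → l ∈ labˢ e₀ → l ∈ labsᶜ quad
    quad-e₀ = ∈-++⁺ˡ
    quad-f₁ : ∀ {l} → l ∈ labˢ f₁ → l ∈ labsᶜ quad
    quad-f₁ p = ∈-++⁺ʳ (labˢ e₀) (∈-++⁺ˡ p)
    quad-e₁ : ∀ {l} → l ∈ labˢ e₁ → l ∈ labsᶜ quad
    quad-e₁ p = ∈-++⁺ʳ (labˢ e₀) (∈-++⁺ʳ (labˢ f₁) (∈-++⁺ˡ (subst (_ ∈_) (sym (labˢ-rev e₁)) p)))
    quad-f₀ : ∀ {l} → l ∈ labˢ f₀ → l ∈ labsᶜ quad
    quad-f₀ p = ∈-++⁺ʳ (labˢ e₀) (∈-++⁺ʳ (labˢ f₁) (∈-++⁺ʳ (labˢ (revˢ e₁)) (∈-++⁺ˡ (subst (_ ∈_) (sym (labˢ-rev f₀)) p))))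

  -- The two steps run to and fro along the same edge of the cube and are labelled separately, so a
  -- single edge can take part in two exchanges.
  module Pair (v : Bool → V) (inj : v O ≢ v I) (e₀ e₁ : Step (v O) (v I)) where

    pair : Cyc
    pair = v O , e₀ ∷ʷ revˢ e₁ ∷ʷ []

    private
      vs≡ : vsᶜ pair ≡ v I ∷ v O ∷ []
      vs≡ rewrite innˢ-nil e₀ | innˢ-nil (revˢ e₁) = refl

    pair-uniq : Unique (vsᶜ pair)
    pair-uniq rewrite vs≡ = ((λ p → inj (sym p)) ∷ []) ∷ [] ∷ []

    pair-sound : ∀ {y} → y ∈ vsᶜ pair → ∃ λ a → y ≡ v a
    pair-sound p rewrite vs≡ with p
    ... | here z = _ , z
    ... | there (here z) = _ , z

    pair-complete : ∀ a → v a ∈ vsᶜ pair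
    pair-complete a rewrite vs≡ = go a
      where
      go : ∀ a → v a ∈ v I ∷ v O ∷ []
      go I = here refl
      go O = there (here refl)

    pair-e₀ : ∀ {l} → l ∈ labˢ e₀ → l ∈ labsᶜ pair
    pair-e₀ = ∈-++⁺ˡ
    pair-e₁ : ∀ {l} → l ∈ labˢ e₁ → l ∈ labsᶜ pair
    pair-e₁ p = ∈-++⁺ʳ (labˢ e₀) (∈-++⁺ˡ (subst (_ ∈_) (sym (labˢ-rev e₁)) p))

module Classes {K : Set} (κ₀ κ₁ : K → V) (P : V → Set) {Code : Set} (ι : V → Code) where
  Joined : V → V → Set
  Joined = Conn κ₀ κ₁ (λ u v → P u × P v × ι u ≡ ι v)

  infix 4 _⇝_
  -- Within a class all words are connected by its cycle, so one exchange between two classes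
  -- connects each word of the one to the other. Quantifying over all words of `c` makes the
  -- relation transitive.
  _⇝_ : Code → Code → Set
  c ⇝ c′ = ∀ {x} → P x → ι x ≡ c → ∃ λ y → P y × ι y ≡ c′ × Joined x y

  stay : ∀ {c} → c ⇝ c
  stay p refl = _ , p , refl , base (p , p , refl)

  infixr 5 _⨾_
  _⨾_ : ∀ {c d e} → c ⇝ d → d ⇝ e → c ⇝ e
  (f ⨾ g) p q with f p q
  ... | y , py , qy , j with g py qy
  ...   | z , pz , qz , j′ = z , pz , qz , j ◅ j′

  module _ (κ : K) (p₀ : P (κ₀ κ)) (p₁ : P (κ₁ κ)) where
    hop : ι (κ₀ κ) ⇝ ι (κ₁ κ)
    hop px e = κ₁ κ , p₁ , refl , base (px , p₀ , e) ◅ link κ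
    poh : ι (κ₁ κ) ⇝ ι (κ₀ κ)
    poh px e = κ₀ κ , p₀ , refl , base (px , p₁ , e) ◅ inv (link κ)

  to-root : ∀ {root} → P root → ∀ {x} → P x → ι x ⇝ ι root → Joined root x
  to-root pr px f with f px refl
  ... | y , py , qy , j = base (pr , py , sym qy) ◅ inv j

cell : ∀ {n} → Bal n → D → Bool → Bool → V
cell y w c d = c ∷ ⟦ y ⟧ᴮ (d ∷ ⟦ w ⟧ [])

cell-inj : ∀ {n} (y : Bal n) w {a b c d} → cell y w a b ≡ cell y w c d → a ≡ c × b ≡ d
cell-inj y w p with refl ← cong (λ { [] → O ; (z ∷ _) → z }) p
  with refl ← ⟦⟧ᴮ-inj y (cong (λ { [] → [] ; (_ ∷ z) → z }) p) = refl , refl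

floor : D → D → Bool → Bool → V
floor u B c d = c ∷ O ∷ ⟦ u ⟧ (d ∷ ⟦ B ⟧ [])

floor-inj : ∀ u B {a b c d} → floor u B a b ≡ floor u B c d → a ≡ c × b ≡ d
floor-inj u B p with refl ← cong (λ { [] → O ; (z ∷ _) → z }) p
  with refl ← ⟦⟧-inj u (cong (λ { (_ ∷ _ ∷ z) → z ; z → z }) p) = refl , refl

suffix-inj : ∀ v B {a b : V} → a ++ suffix v B ≡ b ++ suffix v B → a ≡ b
suffix-inj v B {a} {b} = ++-cancelʳ (suffix v B) a b

prefix-inj : ∀ {n} (S : Bal n) {a b : V} → ⟦ S ⟧ᴮ (I ∷ a) ≡ ⟦ S ⟧ᴮ (I ∷ b) → a ≡ b
prefix-inj S p with refl ← ⟦⟧ᴮ-inj S p = refl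

view-as : ∀ {m μ x y c} → x ≡ y → View′ m μ x c → View′ m μ y c
view-as refl v = v

Band-first : ∀ {μ j} c (z : Bal (dbl j)) → j ≤ μ → Band (j + szᴮ z) μ (c ∷ ⟦ z ⟧ᴮ [])
Band-first {μ} {j} O z j≤ = mkBand {m = j + szᴮ z} (cong suc (trans (zeros-B z []) (+-identityʳ _))) (trans (ones-B z []) (+-identityʳ _))
  (cong suc (tot j (szᴮ z)))
  (≤-trans (+-monoˡ-≤ (szᴮ z) (m≤n+m 1 (dbl j + dbl μ))) (≤-reflexive (lem (dbl j) (dbl μ) (szᴮ z))))
  (≤-trans (+-monoˡ-≤ (szᴮ z) (dbl-mono j≤)) (≤-trans (m≤n+m _ 2) (≤-reflexive (lem′ (dbl μ) (szᴮ z)))))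
  where
  tot : ∀ j s → s + (dbl j + s) ≡ dbl (j + s)
  tot j s rewrite dbl≡ j | dbl≡ (j + s) = go j s
    where
    go : ∀ j s → s + (j + j + s) ≡ j + s + (j + s)
    go = solve-∀
  lem : ∀ j u s → j + u + 1 + s ≡ j + s + suc u
  lem = solve-∀
  lem′ : ∀ u s → 2 + (u + s) ≡ suc s + suc u
  lem′ = solve-∀
Band-first {μ} {j} I z j≤ = mkBand {m = j + szᴮ z} (trans (zeros-B z []) (+-identityʳ _)) (cong suc (trans (ones-B z []) (+-identityʳ _)))
  (tot j (szᴮ z))
  (≤-trans (m≤n+m _ (suc (dbl j) + suc (dbl μ))) (≤-reflexive (lem (dbl j) (dbl μ) (szᴮ z))))
  (≤-trans (s≤s (+-monoˡ-≤ (szᴮ z) (dbl-mono j≤))) (≤-reflexive (lem′ (dbl μ) (szᴮ z))))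
  where
  tot : ∀ j s → s + suc (dbl j + s) ≡ suc (dbl (j + s))
  tot j s rewrite dbl≡ j | dbl≡ (j + s) = go j s
    where
    go : ∀ j s → s + suc (j + j + s) ≡ suc (j + s + (j + s))
    go = solve-∀
  lem : ∀ j u s → suc j + suc u + s ≡ suc (j + s) + suc u
  lem = solve-∀
  lem′ : ∀ u s → suc (u + s) ≡ s + suc u
  lem′ = solve-∀

Band-last : ∀ {ν} u c → Band (suc (sz u)) (suc ν) (O ∷ O ∷ ⟦ u ⟧ (c ∷ []))
Band-last {ν} u c = mkBand (cong (λ i → suc (suc i)) (zeros-D u _)) (ones-D u _)
  (tot c) (lo c) (≤-trans (hi c) (m≤m+n _ _))
  where
  tot : ∀ c → suc (suc (sz u + zeros (c ∷ []))) + (sz u + ones (c ∷ [])) ≡ suc (dbl (suc (sz u)))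
  tot O rewrite dbl≡ (sz u) = go (sz u)
    where
    go : ∀ s → suc (suc (s + 1)) + (s + 0) ≡ suc (suc (suc (s + s)))
    go = solve-∀
  tot I rewrite dbl≡ (sz u) = go (sz u)
    where
    go : ∀ s → suc (suc (s + 0)) + (s + 1) ≡ suc (suc (suc (s + s)))
    go = solve-∀
  lo : ∀ c → suc (suc (sz u + zeros (c ∷ []))) ≤ sz u + ones (c ∷ []) + suc (dbl (suc ν))
  lo O = ≤-trans (m≤m+n _ (dbl ν)) (≤-reflexive (go (sz u) (dbl ν)))
    where
    go : ∀ s n → suc (suc (s + 1)) + n ≡ s + 0 + suc (suc (suc n))
    go = solve-∀
  lo I = ≤-trans (m≤m+n _ (suc (suc (dbl ν)))) (≤-reflexive (go (sz u) (dbl ν)))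
    where
    go : ∀ s n → suc (suc (s + 0)) + suc (suc n) ≡ s + 1 + suc (suc (suc n))
    go = solve-∀
  hi : ∀ c → sz u + ones (c ∷ []) ≤ suc (suc (sz u + zeros (c ∷ [])))
  hi O = ≤-trans (+-monoʳ-≤ (sz u) z≤n) (≤-trans (n≤1+n _) (n≤1+n _))
  hi I = ≤-trans (≤-reflexive (+-comm (sz u) 1)) (≤-trans (s≤s (m≤m+n _ _)) (n≤1+n _))

Band-mid : ∀ x c w → Band (sz x + sz w) 0 (⟦ x ⟧ (c ∷ ⟦ w ⟧ []))
Band-mid x O w = F⇒Band (lf ⌈ x ⌉ ∙ w) (bandF (+-comm _ 1) (s≤s z≤n) z≤n)
Band-mid x I w = F⇒Band (lf (⌈ x ⌉ ▸ w)) (bandF (+-comm _ 1) z≤n (s≤s z≤n))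

-- Labels carry their size equations irrelevantly, so that labels with the same words are
-- definitionally equal. Equality of numbers is decidable, which allows an equation to be recovered
-- where it is needed.
sure : ∀ {a b : ℕ} → .(a ≡ b) → a ≡ b
sure {a} {b} = recompute (a ≟ b)

szᴮ-⊳ : ∀ {n} (Z : Bal n) v → szᴮ (Z ⊳ v) ≡ suc (szᴮ Z + sz v)
szᴮ-⊳ ⌈ d ⌉ v = refl
szᴮ-⊳ (Z ▸ d) v = trans (+-suc (szᴮ Z) _) (cong suc (sym (+-assoc (szᴮ Z) (sz d) (sz v))))

-- Six and more levels

module ManyLevels (ν : ℕ) (H : ∀ k → BandHam (suc k) ν) (Hm : ∀ k → MidHam k) (m′ : ℕ) where
  μ m : ℕ
  μ = suc ν
  m = suc m′

  -- In `vert κ b c` the bit `c` changes along the exchanged edges and `b` along the new ones. With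
  -- the classes named as the modules below, `ka` joins a cell to a block, or to a floor when k
  -- would be 0; `k1` and `k2` join floors to cells, `kn` floors to blocks, `kc` and `ke` bricks to
  -- towers, `kg` bricks to cells.
  data K : Set where
    ka : ∀ {j} → .(j < μ) → (z : Bal (dbl j)) → ∀ v w → .(suc j + (szᴮ (z ▸ v) + sz w) ≡ m) → K
    k1 : ∀ q v B → .(suc (sz (cons q v) + sz B) ≡ m) → K
    k2 : ∀ A A′ t B → .(suc (sz (A ▷ A′ ▷ t) + sz B) ≡ m) → K
    kn : ∀ u → Irr u → ∀ t C → .(suc (sz u + sz (cons t C)) ≡ m) → K
    kc : (y : Bal (suc (dbl μ))) → ∀ w → .(suc μ + (szᴮ y + sz w) ≡ m) → K
    ke : (Y : Bal (suc (dbl μ))) → ∀ v w → .(suc μ + (szᴮ (Y ⊳ v) + sz w) ≡ m) → K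
    kg : (Z : Bal (suc (dbl ν))) → ∀ v w → .(suc ν + (szᴮ (Z ⊳ v) + sz w) ≡ m) → K

  vert : K → Bool → Bool → V
  vert (ka _ z v w _) b c = c ∷ ⟦ z ⟧ᴮ (not b ∷ ⟦ v ⟧ (O ∷ ⟦ w ⟧ []))
  vert (k1 q v B _) b c = I ∷ O ∷ b ∷ ⟦ q ⟧ (I ∷ ⟦ v ⟧ (c ∷ ⟦ B ⟧ []))
  vert (k2 A A′ t B _) b c = O ∷ O ∷ ⟦ A ▷ A′ ⟧ (b ∷ ⟦ t ⟧ (I ∷ c ∷ ⟦ B ⟧ []))
  vert (kn u _ t C _) b c = O ∷ O ∷ ⟦ u ⟧ (c ∷ O ∷ ⟦ t ⟧ (not b ∷ ⟦ C ⟧ []))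
  vert (kc y w _) b c = b ∷ ⟦ y ⟧ᴮ (c ∷ ⟦ w ⟧ [])
  vert (ke Y v w _) b c = O ∷ ⟦ Y ⟧ᴮ (b ∷ ⟦ v ⟧ (I ∷ c ∷ ⟦ w ⟧ []))
  vert (kg Z v w _) b c = O ∷ ⟦ Z ⟧ᴮ (not b ∷ ⟦ v ⟧ (I ∷ c ∷ ⟦ w ⟧ []))

  vert-edge : ∀ κ b → Adj (vert κ b O) (vert κ b I)
  vert-edge (ka _ z v w _) b = up
  vert-edge (k1 q v B _) b = I ∷ (O ∷ (b ∷ ⟦⟧-adj q (I ∷ ⟦⟧-adj v up)))
  vert-edge (k2 A A′ t B _) b = O ∷ (O ∷ ⟦⟧-adj (A ▷ A′) (b ∷ ⟦⟧-adj t (I ∷ up)))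
  vert-edge (kn u _ t C _) b = O ∷ (O ∷ ⟦⟧-adj u up)
  vert-edge (kc y w _) b = b ∷ ⟦⟧ᴮ-adj y up
  vert-edge (ke Y v w _) b = O ∷ ⟦⟧ᴮ-adj Y (b ∷ ⟦⟧-adj v (I ∷ up))
  vert-edge (kg Z v w _) b = O ∷ ⟦⟧ᴮ-adj Z (not b ∷ ⟦⟧-adj v (I ∷ up))

  vert-join : ∀ κ c → Adj (vert κ O c) (vert κ I c)
  vert-join (ka _ z v w _) c = c ∷ ⟦⟧ᴮ-adj z down
  vert-join (k1 q v B _) c = I ∷ (O ∷ up)
  vert-join (k2 A A′ t B _) c = O ∷ (O ∷ ⟦⟧-adj (A ▷ A′) up)
  vert-join (kn u _ t C _) c = O ∷ (O ∷ ⟦⟧-adj u (c ∷ (O ∷ ⟦⟧-adj t down)))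
  vert-join (kc y w _) c = up
  vert-join (ke Y v w _) c = O ∷ ⟦⟧ᴮ-adj Y up
  vert-join (kg Z v w _) c = O ∷ ⟦⟧ᴮ-adj Z down

  squares : Squares (Kept m μ)
  squares = record
    { K = K ; κs = λ κ b → vert κ b O ; κt = λ κ b → vert κ b I ; κe = vert-edge
    ; joinˢ = λ κ → vert-join κ O ; joinᵗ = λ κ → vert-join κ I
    ; s = λ r → keptᵛ r O ; t = λ r → keptᵛ r I ; e = keptᵉ }

  open Squares squares using (sys; exchange)
  open Walks sys hiding (e)

  -- For ν = 0 both `kg` and `k2` concern cells with j = 0. They do not collide: `kg` takes cells
  -- whose `y` ends in a nonempty Dyck word, `k2` those where that word is empty.
  E₀ : ∀ {j} → .(j < μ) → (y : Bal (suc (dbl j))) → ∀ w → .(suc j + (szᴮ y + sz w) ≡ m) → Step (cell y w O O) (cell y w O I)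
  E₀ {j} j< y@(z ▸ (X ▷ v)) w eq with j ≟ ν
  ... | yes refl = fw (k₁ (kg (z ▸ X) v w eq)) refl refl
  ... | no _ = pl (O ∷ ⟦⟧ᴮ-adj y up)
  E₀ {zero} j< y@(⌈ d ⌉ ▸ ε) w eq with first d
  ... | none = pl (O ∷ ⟦⟧ᴮ-adj y up)
  ... | some ε t = pl (O ∷ ⟦⟧ᴮ-adj (⌈ cons ε t ⌉ ▸ ε) up)
  ... | some (A ▷ A′) t = fw (k₁ (k2 A A′ t w (trans (lem (sz A) (sz A′) (sz t) (sz w) (sz-cons (A ▷ A′) t)) eq)))
      (cong (O ∷_) (sym (⟦cons⟧ (A ▷ A′) t _))) (cong (O ∷_) (sym (⟦cons⟧ (A ▷ A′) t _)))
    where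
    lem : ∀ a a′ t w {c} → c ≡ suc (suc (a + a′) + t) → suc (suc (suc (a + a′) + t) + w) ≡ 1 + (c + 0 + w)
    lem a a′ t w refl = cong (λ i → suc (i + w)) (sym (+-identityʳ _))
  E₀ {suc j} j< y@(z ▸ ε) w eq = pl (O ∷ ⟦⟧ᴮ-adj y up)

  E₁ : ∀ {j} → .(j < μ) → (y : Bal (suc (dbl j))) → ∀ w → .(suc j + (szᴮ y + sz w) ≡ m) → Step (cell y w I O) (cell y w I I)
  E₁ {zero} j< y@(⌈ d ⌉ ▸ v) w eq with first d
  ... | none = pl (I ∷ ⟦⟧ᴮ-adj (⌈ ε ⌉ ▸ v) up)
  ... | some (A ▷ A′) t = pl (I ∷ ⟦⟧ᴮ-adj (⌈ cons (A ▷ A′) t ⌉ ▸ v) up)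
  ... | some ε q = fw (k₁ (k1 q v w (trans (lem (sz q) (sz v) (sz w) (sz-cons q v) (sz-cons ε q)) eq)))
      (cong (I ∷_) (sym (⟦cons⟧ ε q _))) (cong (I ∷_) (sym (⟦cons⟧ ε q _)))
    where
    lem : ∀ q v w {c d} → c ≡ suc (q + v) → d ≡ suc q → suc (c + w) ≡ suc (d + v + w)
    lem q v w refl refl = refl
  E₁ {suc j} j< y w eq = pl (I ∷ ⟦⟧ᴮ-adj y up)

  F₀ : ∀ {j} → .(j < μ) → (y : Bal (suc (dbl j))) → ∀ w → .(suc j + (szᴮ y + sz w) ≡ m) → Step (cell y w O O) (cell y w I O)
  F₀ j< (z ▸ v) w eq = fw (k₀ (ka j< z v w eq)) refl refl

  F₁ : ∀ {j} → .(j < μ) → (y : Bal (suc (dbl j))) → ∀ w → .(suc j + (szᴮ y + sz w) ≡ m) → Step (cell y w O I) (cell y w I I)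
  F₁ {j} j< y w eq = fw (inj₂ (flip-first {j = suc j} j< (y ▸ w) eq)) refl refl

  module Cell {j} .(j< : j < μ) (y : Bal (suc (dbl j))) w .(eq : suc j + (szᴮ y + sz w) ≡ m) =
    Quad squares (cell y w) (cell-inj y w) (E₀ j< y w eq) (E₁ j< y w eq) (F₀ j< y w eq) (F₁ j< y w eq)

  -- The edge 00u0B - 00u1B. If `u` has at most one factor, it is promised to the next stage when B
  -- is empty and otherwise leads to a smaller B by `kn`; with two or more factors it serves `k2`.
  Q₀ : ∀ u B → .(suc (sz u + sz B) ≡ m) → Step (floor u B O O) (floor u B O I)
  Q₀ ε B eq with first B
  ... | none = fw (inj₂ (flip-last ε irrε eq)) refl refl
  ... | some t C = fw (k₀ (kn ε irrε t C eq)) (cong (λ z → O ∷ O ∷ O ∷ z) (sym (⟦cons⟧ t C []))) (cong (λ z → O ∷ O ∷ I ∷ z) (sym (⟦cons⟧ t C [])))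
  Q₀ (ε ▷ u) B eq with first B
  ... | none = fw (inj₂ (flip-last (ε ▷ u) (irr▷ u) (trans (cong (λ i → suc (suc i)) (sym (+-identityʳ (sz u)))) eq))) refl refl
  ... | some t C = fw (k₀ (kn (ε ▷ u) (irr▷ u) t C eq)) (cong (λ z → O ∷ O ∷ ⟦ ε ▷ u ⟧ (O ∷ z)) (sym (⟦cons⟧ t C [])))
                      (cong (λ z → O ∷ O ∷ ⟦ ε ▷ u ⟧ (I ∷ z)) (sym (⟦cons⟧ t C [])))
  Q₀ (A ▷ A′ ▷ t) B eq = fw (k₀ (k2 A A′ t B eq)) refl refl

  Q₁ : ∀ u B → .(suc (sz u + sz B) ≡ m) → Step (floor u B I O) (floor u B I I)
  Q₁ u B eq with first u
  ... | none = pl (I ∷ (O ∷ up))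
  ... | some q v = fw (k₀ (k1 q v B eq)) (cong (λ z → I ∷ O ∷ z) (sym (⟦cons⟧ q v _))) (cong (λ z → I ∷ O ∷ z) (sym (⟦cons⟧ q v _)))

  G₀ : ∀ u B → .(suc (sz u + sz B) ≡ m) → Step (floor u B O O) (floor u B I O)
  G₀ u B eq = fw (k₁ (ka {j = 0} (s≤s z≤n) ⌈ ε ⌉ u B eq)) refl refl

  G₁ : ∀ u B → .(suc (sz u + sz B) ≡ m) → Step (floor u B O I) (floor u B I I)
  G₁ u B eq = fw (inj₂ (flip-first {j = 0} z≤n ⌈ cons u B ⌉ (trans (sz-cons u B) eq)))
                 (cong (O ∷_) (⟦cons⟧ u B [])) (cong (I ∷_) (⟦cons⟧ u B []))

  module Floor u B .(eq : suc (sz u + sz B) ≡ m) =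
    Quad squares (floor u B) (floor-inj u B) (Q₀ u B eq) (Q₁ u B eq) (G₀ u B eq) (G₁ u B eq)

  B₀ : (y : Bal (suc (dbl μ))) → ∀ w → .(suc μ + (szᴮ y + sz w) ≡ m) → Step (cell y w O O) (cell y w O I)
  B₀ y w eq = fw (k₀ (kc y w eq)) refl refl

  -- The second passage along the edge of a brick; the first is always spent on `kc`. A nonempty
  -- last Dyck word of `y` offers a pair to break, giving `ke`; otherwise an unmatched one is turned
  -- into an opening bit, giving `kg`.
  B₁ : (y : Bal (suc (dbl μ))) → ∀ w → .(suc μ + (szᴮ y + sz w) ≡ m) → Step (cell y w O O) (cell y w O I)
  B₁ (z ▸ (X ▷ v)) w eq = fw (k₀ (ke (z ▸ X) v w eq)) refl refl
  B₁ (Z ▸ v ▸ ε) w eq = fw (k₀ (kg Z v w (trans (trans (cong (λ i → suc ν + (i + sz w)) (szᴮ-⊳ Z v)) (lem ν (szᴮ Z + sz v) (sz w))) eq))) refl refl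
    where
    lem : ∀ n z w → suc n + (suc z + w) ≡ suc (suc n) + (z + 0 + w)
    lem = solve-∀

  cell-inj₂ : ∀ (y : Bal (suc (dbl μ))) w → cell y w O O ≢ cell y w O I
  cell-inj₂ y w p with () ← proj₂ (cell-inj y w p)

  module Brick (y : Bal (suc (dbl μ))) w .(eq : suc μ + (szᴮ y + sz w) ≡ m) =
    Pair squares (cell y w O) (cell-inj₂ y w) (B₀ y w eq) (B₁ y w eq)

  module _ {k} v B .(eq : suc k + suc (sz v + sz B) ≡ m) where
    σᵈ : (r : Kept (suc k) ν) → Step (keptᵛ r O ++ suffix v B) (keptᵛ r I ++ suffix v B)
    σᵈ (flip-first {j} j≤ z e) = fw (k₁ (ka (s≤s j≤) z v B (trans (lem j (szᴮ z) (sz v) (sz B)) (trans (cong (_+ suc (sz v + sz B)) e) eq))))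
        (cong (O ∷_) (sym (⟦⟧ᴮ-++ z [] (suffix v B)))) (cong (I ∷_) (sym (⟦⟧ᴮ-++ z [] (suffix v B))))
      where
      lem : ∀ j z v B → suc j + (z + v + B) ≡ j + z + suc (v + B)
      lem = solve-∀
    σᵈ (flip-last u i e) = fw (k₁ (kn u i v B (trans (cong (λ i → suc (sz u + i)) (sz-cons v B)) (trans (cong (_+ suc (sz v + sz B)) e) eq))))
        (cong (λ z → O ∷ O ∷ z) (sym (⟦⟧-++ u (O ∷ []) (suffix v B)))) (cong (λ z → O ∷ O ∷ z) (sym (⟦⟧-++ u (I ∷ []) (suffix v B))))

    module Block = Embed squares (H k) (_++ suffix v B) (Adj-++ (suffix v B)) σᵈ

  pre : Bal (suc (dbl μ)) → V → V
  pre S z = ⟦ S ⟧ᴮ (I ∷ z)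

  -- If S begins with 1, changing this bit leads to a brick, so all edges x*w serve `kc`. If S
  -- begins with 0, only the edges *w are needed, for `ke`.
  σᵗ : ∀ {k} (S : Bal (suc (dbl μ))) → .(k + (suc μ + szᴮ S) ≡ m) → (r : MidEdge k) → Step (pre S (midᵛ r O)) (pre S (midᵛ r I))
  σᵗ S eq r@(flip-last x e) = pl (⟦⟧ᴮ-adj S (I ∷ midᵉ r))
  σᵗ (R ▸ v) eq (flip-star x w e) with front R
  ... | one R′ = fw (k₁ (kc (R′ ▸ v ▸ x) w (trans (trans (lem ν (szᴮ R′) (sz v) (sz x) (sz w)) (cong₂ (λ i j → i + (suc μ + (j + sz v))) e (sym (szᴮ-push1 R′)))) eq)))
                   (sym (⟦push1⟧ R′ _)) (sym (⟦push1⟧ R′ _))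
    where
    lem : ∀ n r v x w → suc (suc n) + (r + v + x + w) ≡ x + w + (suc (suc n) + (r + v))
    lem = solve-∀
  σᵗ (_ ▸ v) eq (flip-star (X ▷ x) w e) | nil Y = pl (⟦⟧ᴮ-adj (push0 Y ▸ v) (I ∷ ⟦⟧-adj (X ▷ x) up))
  σᵗ (_ ▸ v) eq (flip-star ε w e) | nil Y = fw (k₁ (ke Y v w (trans (trans (cong (λ i → suc μ + (i + sz w)) (szᴮ-⊳ Y v))
                     (trans (lem ν (szᴮ Y) (sz v) (sz w)) (cong₂ (λ i j → i + (suc μ + (j + sz v))) e (sym (szᴮ-push0 Y))))) eq)))
                   (sym (⟦push0⟧ Y _)) (sym (⟦push0⟧ Y _))
    where
    lem : ∀ n y v w → suc (suc n) + (suc (y + v) + w) ≡ w + (suc (suc n) + (suc y + v))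
    lem = solve-∀

  module Tower {k} (S : Bal (suc (dbl μ))) .(eq : k + (suc μ + szᴮ S) ≡ m) =
    Embed squares (Hm k) (pre S) (λ p → ⟦⟧ᴮ-adj S (I ∷ p)) (σᵗ S eq)

  C : ∀ c → Valid m μ c → Cyc
  C (cd _ v B) ((k , refl) , eq) = Block.cyc v B eq
  C (cq u B) eq = Floor.quad u B eq
  C (cs y w) (inj₁ (j , j< , refl , eq)) = Cell.quad j< y w eq
  C (cs y w) (inj₂ (refl , eq)) = Brick.pair y w eq
  C (ct k S) (refl , eq) = Tower.cyc S eq

  uniq : ∀ c p → Unique (vsᶜ (C c p))
  uniq (cd _ v B) ((k , refl) , eq) = Block.cyc-uniq v B eq (suffix-inj v B)
  uniq (cq u B) eq = Floor.quad-uniq u B eq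
  uniq (cs y w) (inj₁ (j , j< , refl , eq)) = Cell.quad-uniq j< y w eq
  uniq (cs y w) (inj₂ (refl , eq)) = Brick.pair-uniq y w eq
  uniq (ct k S) (refl , eq) = Tower.cyc-uniq S eq (prefix-inj S)

  sound : ∀ {c p y} → y ∈ vsᶜ (C c p) → Band m (suc μ) y × ι m μ y ≡ c
  sound {c} {p} q with go c p q
    where
    go : ∀ c p {y} → y ∈ vsᶜ (C c p) → View′ m μ y c
    go (cd _ v B) ((k , refl) , eq) q with Block.cyc-sound v B eq q
    ... | z , pz , refl = view (vd k v B z pz eq) refl
    go (cq u B) eq q with Floor.quad-sound u B eq q
    ... | a , b , refl = view (vq a u b B eq) refl
    go (cs y w) (inj₁ (j , j< , refl , eq)) q with Cell.quad-sound j< y w eq q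
    ... | a , b , refl = view (vc j< y a b w eq) refl
    go (cs y w) (inj₂ (refl , eq)) q with Brick.pair-sound y w eq q
    ... | a , refl = view (vb y a w eq) refl
    go (ct k S) (refl , eq) q with Tower.cyc-sound S eq q
    ... | z , pz , refl = view (vt k S z pz eq) refl
  ... | view v refl = view-band v , view-ι v

  at : ∀ {c c′} (Q : ∀ c → Valid m μ c → Set) → c′ ≡ c → (∀ p → Q c p) → ∀ p → Q c′ p
  at Q refl h = h

  inside : ∀ {x} → Band m (suc μ) x → (p : Valid m μ (ι m μ x)) → x ∈ vsᶜ (C (ι m μ x) p)
  inside {x} px = at (λ c p → x ∈ vsᶜ (C c p)) (view-ι (classify px)) (go (classify px))
    where
    go : ∀ {x} (v : View m μ x) (p : Valid m μ (view-code v)) → x ∈ vsᶜ (C (view-code v) p)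
    go (vd k v B z pz _) ((.k , refl) , eq) = Block.cyc-complete v B eq pz
    go (vq c u d B _) eq = Floor.quad-complete u B eq c d
    go (vc {j} j< y c d w _) (inj₁ (j′ , j<′ , e , eq)) with refl ← dbl-injective j j′ (suc-injective e) with refl ← e =
      Cell.quad-complete j<′ y w eq c d
    go (vc {j} j< y c d w _) (inj₂ (e , eq)) with refl ← dbl-injective j μ (suc-injective e) = ⊥-elim (<-irrefl refl j<)
    go (vb y d w _) (inj₁ (j′ , j<′ , e , eq)) with refl ← dbl-injective μ j′ (suc-injective e) = ⊥-elim (<-irrefl refl j<′)
    go (vb y d w _) (inj₂ (refl , eq)) = Brick.pair-complete y w eq d
    go (vt k S z pz _) (refl , eq) = Tower.cyc-complete S eq pz

  valid : ∀ {x} → Band m (suc μ) x → Valid m μ (ι m μ x)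
  valid px = subst (Valid m μ) (sym (view-ι (classify px))) (view-valid (classify px))

  κ-code : K → Bool → Code
  κ-code (ka {j} _ z v w _) O = cs (z ▸ v) w
  κ-code (ka {j} _ z v w _) I = low-code (j + szᴮ z) v w
  κ-code (k1 q v B _) O = cq (cons q v) B
  κ-code (k1 q v B _) I = cs (⌈ cons ε q ⌉ ▸ v) B
  κ-code (k2 A A′ t B _) O = cq (A ▷ A′ ▷ t) B
  κ-code (k2 A A′ t B _) I = cs (⌈ cons (A ▷ A′) t ⌉ ▸ ε) B
  κ-code (kn u _ t C _) O = cq u (cons t C)
  κ-code (kn u _ t C _) I = cd (suc (sz u)) t C
  κ-code (kc y w _) O = cs y w
  κ-code (kc (Y ▸ x) w _) I = ct (sz x + sz w) (push1 Y)
  κ-code (ke Y v w _) O = cs (Y ⊳ v) w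
  κ-code (ke Y v w _) I = ct (sz w) (push0 Y ▸ v)
  κ-code (kg Z v w _) O = cs (Z ▸ v ▸ ε) w
  κ-code (kg Z v w _) I = cs (Z ⊳ v) w

  κ-view : ∀ κ b c → View′ m μ (vert κ b c) (κ-code κ b)
  κ-view (ka {j} j< z v w eq) O c = view (vc (recompute (j <? μ) j<) (z ▸ v) c O w (sure eq)) refl
  κ-view (ka {j} j< z v w eq) I c = view-as (cong (c ∷_) (⟦⟧ᴮ-++ z [] (suffix v w)))
    (view-low v w (c ∷ ⟦ z ⟧ᴮ []) (Band-first c z (<⇒≤ (recompute (j <? μ) j<))) (trans (lem j (szᴮ z) (sz v) (sz w)) (sure eq)))
    where
    lem : ∀ j z v w → j + z + suc (v + w) ≡ suc j + (z + v + w)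
    lem = solve-∀
  κ-view (k1 q v B eq) O c = view-as (cong (λ z → I ∷ O ∷ z) (⟦cons⟧ q v _)) (view (vq I (cons q v) c B (sure eq)) refl)
  κ-view (k1 q v B eq) I c = view-as (cong (I ∷_) (⟦cons⟧ ε q _)) (view (vc {j = 0} (s≤s z≤n) (⌈ cons ε q ⌉ ▸ v) I c B
    (trans (trans (cong (λ i → suc (i + sz v + sz B)) (sz-cons ε q)) (cong (λ i → suc (i + sz B)) (sym (sz-cons q v)))) (sure eq))) refl)
  κ-view (k2 A A′ t B eq) O c = view (vq O (A ▷ A′ ▷ t) c B (sure eq)) refl
  κ-view (k2 A A′ t B eq) I c = view-as (cong (O ∷_) (⟦cons⟧ (A ▷ A′) t _)) (view (vc {j = 0} (s≤s z≤n) (⌈ cons (A ▷ A′) t ⌉ ▸ ε) O c B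
    (trans (cong (λ i → suc (i + sz B)) (trans (+-identityʳ _) (sz-cons (A ▷ A′) t))) (sure eq))) refl)
  κ-view (kn u i t C eq) O c = view-as (cong (λ z → O ∷ O ∷ ⟦ u ⟧ (c ∷ z)) (⟦cons⟧ t C [])) (view (vq O u c (cons t C) (sure eq)) refl)
  κ-view (kn u i t C eq) I c = view-as (cong (λ z → O ∷ O ∷ z) (⟦⟧-++ u (c ∷ []) (suffix t C)))
    (view-low t C (O ∷ O ∷ ⟦ u ⟧ (c ∷ [])) (Band-last u c) (trans (cong (λ i → suc (sz u + i)) (sym (sz-cons t C))) (sure eq)))
  κ-view (kc y w eq) O c = view (vb y c w (sure eq)) refl
  κ-view (kc (Y ▸ x) w eq) I c = view-as (⟦push1⟧ Y _) (view (vt (sz x + sz w) (push1 Y) _ (Band-mid x c w)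
    (trans (trans (cong (λ i → sz x + sz w + (suc μ + i)) (szᴮ-push1 Y)) (lem μ (szᴮ Y) (sz x) (sz w))) (sure eq))) refl)
    where
    lem : ∀ u y x w → x + w + (suc u + y) ≡ suc u + (y + x + w)
    lem = solve-∀
  κ-view (ke Y v w eq) O c = view-as (cong (O ∷_) (⟦⊳⟧ Y v _)) (view (vb (Y ⊳ v) c w (sure eq)) refl)
  κ-view (ke Y v w eq) I c = view-as (⟦push0⟧ Y _) (view (vt (sz w) (push0 Y ▸ v) (c ∷ ⟦ w ⟧ []) (Band-mid ε c w)
    (trans (trans (cong (λ i → sz w + (suc μ + (i + sz v))) (szᴮ-push0 Y)) (trans (lem μ (szᴮ Y) (sz v) (sz w)) (cong (λ i → suc μ + (i + sz w)) (sym (szᴮ-⊳ Y v))))) (sure eq))) refl)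
    where
    lem : ∀ u y v w → w + (suc u + (suc y + v)) ≡ suc u + (suc (y + v) + w)
    lem = solve-∀
  κ-view (kg Z v w eq) O c = view (vb (Z ▸ v ▸ ε) c w
    (trans (sym (trans (cong (λ i → suc ν + (i + sz w)) (szᴮ-⊳ Z v)) (lem ν (szᴮ Z + sz v) (sz w)))) (sure eq))) refl
    where
    lem : ∀ n z w → suc n + (suc z + w) ≡ suc (suc n) + (z + 0 + w)
    lem = solve-∀
  κ-view (kg Z v w eq) I c = view-as (cong (O ∷_) (⟦⊳⟧ Z v _)) (view (vc {j = ν} ≤-refl (Z ⊳ v) O c w (sure eq)) refl)

  in-cell : ∀ {j l} (y : Bal (suc (dbl j))) w → j < μ →
            (∀ .(j< : j < μ) .(eq : suc j + (szᴮ y + sz w) ≡ m) → l ∈ labsᶜ (Cell.quad j< y w eq)) →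
            (p : Valid m μ (cs y w)) → l ∈ labsᶜ (C (cs y w) p)
  in-cell {j} y w j< h (inj₁ (j′ , j<′ , e , eq)) with refl ← dbl-injective j j′ (suc-injective e) with refl ← e = h j<′ eq
  in-cell {j} y w j< h (inj₂ (e , eq)) with refl ← dbl-injective j μ (suc-injective e) = ⊥-elim (<-irrefl refl j<)

  in-brick : ∀ {l} (y : Bal (suc (dbl μ))) w → (∀ .(eq : suc μ + (szᴮ y + sz w) ≡ m) → l ∈ labsᶜ (Brick.pair y w eq)) →
             (p : Valid m μ (cs y w)) → l ∈ labsᶜ (C (cs y w) p)
  in-brick y w h (inj₁ (j′ , j<′ , e , eq)) with refl ← dbl-injective μ j′ (suc-injective e) = ⊥-elim (<-irrefl refl j<′)
  in-brick y w h (inj₂ (refl , eq)) = h eq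

  κ-present : ∀ κ b (p : Valid m μ (κ-code κ b)) → inj₁ (κ , b) ∈ labsᶜ (C (κ-code κ b) p)
  κ-present (ka {j} j< z v w eq) O = in-cell (z ▸ v) w (recompute (j <? μ) j<) (λ j< eq → Cell.quad-f₀ j< (z ▸ v) w eq (here refl))
  κ-present (ka {zero} j< ⌈ ε ⌉ v w eq) I p = Floor.quad-f₀ v w p (here refl)
  κ-present (ka {zero} j< z@(⌈ _ ▷ _ ⌉) v w eq) I ((_ , refl) , p) = Block.cyc-lab v w p (flip-first (≤-pred j<) z refl) (here refl)
  κ-present (ka {suc j} j< z v w eq) I ((_ , refl) , p) = Block.cyc-lab v w p (flip-first (≤-pred j<) z refl) (here refl)
  κ-present (k1 q v B eq) O p = Floor.quad-e₁ (cons q v) B p lem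
    where
    lem : k₀ (k1 q v B eq) ∈ labˢ (Q₁ (cons q v) B p)
    lem rewrite first-cons q v = here refl
  κ-present (k1 q v B eq) I = in-cell (⌈ cons ε q ⌉ ▸ v) B (s≤s z≤n) (λ j< p → Cell.quad-e₁ j< (⌈ cons ε q ⌉ ▸ v) B p (lem j< p))
    where
    lem : ∀ .(j< : 0 < μ) .(p : 1 + (szᴮ (⌈ cons ε q ⌉ ▸ v) + sz B) ≡ m) → k₁ (k1 q v B eq) ∈ labˢ (E₁ j< (⌈ cons ε q ⌉ ▸ v) B p)
    lem j< p rewrite first-cons ε q = here refl
  κ-present (k2 A A′ t B eq) O p = Floor.quad-e₀ (A ▷ A′ ▷ t) B p (here refl)
  κ-present (k2 A A′ t B eq) I = in-cell (⌈ cons (A ▷ A′) t ⌉ ▸ ε) B (s≤s z≤n) (λ j< p → Cell.quad-e₀ j< (⌈ cons (A ▷ A′) t ⌉ ▸ ε) B p (lem j< p))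
    where
    lem : ∀ .(j< : 0 < μ) .(p : 1 + (szᴮ (⌈ cons (A ▷ A′) t ⌉ ▸ ε) + sz B) ≡ m) →
          k₁ (k2 A A′ t B eq) ∈ labˢ (E₀ j< (⌈ cons (A ▷ A′) t ⌉ ▸ ε) B p)
    lem j< p rewrite first-cons (A ▷ A′) t = here refl
  κ-present (kn u i t C eq) O p = Floor.quad-e₀ u (cons t C) p (lem u i eq p)
    where
    lem : ∀ u i .(eq : suc (sz u + sz (cons t C)) ≡ m) .(p : suc (sz u + sz (cons t C)) ≡ m) → k₀ (kn u i t C eq) ∈ labˢ (Q₀ u (cons t C) p)
    lem _ irrε eq p rewrite first-cons t C = here refl
    lem _ (irr▷ u) eq p rewrite first-cons t C = here refl
  κ-present (kn u i t C eq) I ((_ , refl) , p) = Block.cyc-lab t C p (flip-last u i refl) (here refl)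
  κ-present (kc y w eq) O = in-brick y w (λ p → Brick.pair-e₀ y w p (here refl))
  κ-present (kc (R ▸ v ▸ x) w eq) I (refl , p) = Tower.cyc-lab (push1 (R ▸ v)) p (flip-star x w refl) lem
    where
    lem : k₁ (kc (R ▸ v ▸ x) w eq) ∈ labˢ (σᵗ (push1 (R ▸ v)) p (flip-star x w refl))
    lem rewrite front-one R = here refl
  κ-present (ke (Y ▸ X) v w eq) O = in-brick (Y ▸ (X ▷ v)) w (λ p → Brick.pair-e₁ (Y ▸ (X ▷ v)) w p (here refl))
  κ-present (ke Y v w eq) I (refl , p) = Tower.cyc-lab (push0 Y ▸ v) p (flip-star ε w refl) lem
    where
    lem : k₁ (ke Y v w eq) ∈ labˢ (σᵗ (push0 Y ▸ v) p (flip-star ε w refl))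
    lem rewrite front-nil Y = here refl
  κ-present (kg Z v w eq) O = in-brick (Z ▸ v ▸ ε) w (λ p → Brick.pair-e₁ (Z ▸ v ▸ ε) w p (here refl))
  κ-present (kg (Z ▸ X) v w eq) I = in-cell (Z ▸ (X ▷ v)) w ≤-refl (λ j< p → Cell.quad-e₀ j< (Z ▸ (X ▷ v)) w p (lem j< p))
    where
    lem : ∀ .(j< : ν < μ) .(p : suc ν + (szᴮ (Z ▸ (X ▷ v)) + sz w) ≡ m) → k₁ (kg (Z ▸ X) v w eq) ∈ labˢ (E₀ {ν} j< (Z ▸ (X ▷ v)) w p)
    lem j< p rewrite ≟-diag {ν} refl = here refl

  square : ∀ κ b → Band m (suc μ) (vert κ b O) × ((p : Valid m μ (ι m μ (vert κ b O))) → inj₁ (κ , b) ∈ labsᶜ (C (ι m μ (vert κ b O)) p))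
  square κ b with κ-view κ b O
  ... | view v e = view-band v , at (λ c p → inj₁ (κ , b) ∈ labsᶜ (C c p)) (trans (view-ι v) e) (κ-present κ b)

  reserved : ∀ r → Band m (suc μ) (keptᵛ r O) × ((p : Valid m μ (ι m μ (keptᵛ r O))) → inj₂ r ∈ labsᶜ (C (ι m μ (keptᵛ r O)) p))
  reserved (flip-first {zero} j≤ ⌈ d ⌉ eq) with first d
  ... | none with () ← sure eq
  ... | some u B rewrite ⟦cons⟧ u B [] = view-band v , at (λ c p → inj₂ (flip-first j≤ ⌈ cons u B ⌉ eq) ∈ labsᶜ (C c p)) (view-ι v)
      (λ p → Floor.quad-f₁ u B p (here refl))
    where
    v : View m μ (O ∷ O ∷ ⟦ u ⟧ (I ∷ ⟦ B ⟧ []))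
    v = vq O u I B (trans (sym (sz-cons u B)) (sure eq))
  reserved (flip-first {suc j} j≤ (y ▸ w) eq) = view-band v , at (λ c p → inj₂ (flip-first {j = suc j} j≤ (y ▸ w) eq) ∈ labsᶜ (C c p)) (view-ι v)
      (in-cell y w (recompute (j <? μ) j≤) (λ j< p → Cell.quad-f₁ j< y w p (here refl)))
    where
    v : View m μ (O ∷ ⟦ y ⟧ᴮ (I ∷ ⟦ w ⟧ []))
    v = vc (recompute (j <? μ) j≤) y O I w (sure eq)
  reserved (flip-last u i eq) = view-band v , at (λ c p → inj₂ (flip-last u i eq) ∈ labsᶜ (C c p)) (view-ι v)
      (λ p → Floor.quad-e₀ u ε p (lem u i eq p))
    where
    v : View m μ (O ∷ O ∷ ⟦ u ⟧ (O ∷ []))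
    v = vq O u O ε (trans (cong suc (+-identityʳ _)) (sure eq))
    lem : ∀ u i .(eq : suc (sz u) ≡ m) .(p : suc (sz u + 0) ≡ m) → inj₂ (flip-last u i eq) ∈ labˢ (Q₀ u ε p)
    lem _ irrε eq p = here refl
    lem _ (irr▷ u) eq p = here refl

  open Connect exchange using (κ₀; κ₁)
  open Classes κ₀ κ₁ (Band m (suc μ)) (ι m μ)

  forth : ∀ κ → κ-code κ O ⇝ κ-code κ I
  forth κ with κ-view κ O O | κ-view κ I O
  ... | view v e | view w e′ = subst₂ _⇝_ (trans (view-ι v) e) (trans (view-ι w) e′) (hop κ (view-band v) (view-band w))

  back : ∀ κ → κ-code κ I ⇝ κ-code κ O
  back κ with κ-view κ O O | κ-view κ I O
  ... | view v e | view w e′ = subst₂ _⇝_ (trans (view-ι w) e′) (trans (view-ι v) e) (poh κ (view-band v) (view-band w))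

  root-code : Code
  root-code = low-code m′ ε ε

  -- From the class of (v , B), where k ≥ 1: pass through the classes (c 0 q 1 v d B), first to v = ε, then shorten B.
  module _ (n : ℕ) (rec : ∀ k v B → sz B < n → k + suc (sz v + sz B) ≡ m → low-code k v B ⇝ root-code) where
    from-corner : ∀ u B → sz B ≤ n → Irr u → suc (sz u + sz B) ≡ m → B ≢ ε → cq u B ⇝ root-code
    from-corner u B B≤ i eq B≢ with first B
    ... | none = ⊥-elim (B≢ refl)
    ... | some t C = forth (kn u i t C eq) ⨾ rec (suc (sz u)) t C
            (≤-trans (≤-trans (s≤s (m≤n+m (sz C) (sz t))) (≤-reflexive (sym (sz-cons t C)))) B≤)
            (trans (cong (λ i → suc (sz u + i)) (sym (sz-cons t C))) eq)

    -- The block contains c01q0v0B for each Dyck word q of size k, and `pairs k` is merely one such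
    -- word. From there `ka` leads into a cell, and `k1` to the floor whose Dyck word is 0q1v.
    up-to-corner : ∀ k v B → suc k + suc (sz v + sz B) ≡ m → low-code (suc k) v B ⇝ cq (cons (pairs k) v) B
    up-to-corner k v B eq = subst (λ i → low-code i v B ⇝ cq (cons q v) B) len
        (back (ka {j = 0} (s≤s z≤n) ⌈ cons ε q ⌉ v B (trans (cong (λ i → suc (i + sz v + sz B)) len) eq′)) ⨾
         back (k1 q v B (trans (cong (λ i → suc (i + sz B)) (trans (sz-cons q v) (cong (λ i → suc (i + sz v)) (sz-pairs k)))) eq′)))
      where
      q = pairs k
      len : sz (cons ε q) ≡ suc k
      len = trans (sz-cons ε q) (cong suc (sz-pairs k))
      eq′ : suc (suc k + sz v + sz B) ≡ m
      eq′ = trans (lem k (sz v) (sz B)) eq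
        where
        lem : ∀ k v B → suc (suc k + v + B) ≡ suc k + suc (v + B)
        lem = solve-∀

    from-ε : ∀ k B → sz B ≤ n → suc k + suc (sz B) ≡ m → low-code (suc k) ε B ⇝ root-code
    from-ε k ε B≤ eq = subst (λ i → low-code (suc k) ε ε ⇝ low-code i ε ε) (suc-injective (trans (sym (+-comm (suc k) 1)) eq)) stay
    from-ε k B@(_ ▷ _) B≤ eq = up-to-corner k ε B eq ⨾ from-corner (ε ▷ pairs k) B B≤ (irr▷ _)
      (trans (trans (cong (λ i → suc (suc i + sz B)) (sz-pairs k)) (cong suc (sym (+-suc k (sz B))))) eq) (λ ())

    from-suc : ∀ k v B → sz B ≤ n → suc k + suc (sz v + sz B) ≡ m → low-code (suc k) v B ⇝ root-code
    from-suc k ε B B≤ eq = from-ε k B B≤ eq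
    from-suc k v@(X ▷ t) B B≤ eq = up-to-corner k v B eq ⨾ shift-over (cons (pairs k) X) refl
      where
      -- The inserted factor guarantees that 0t1 is not the only factor, as `k2` demands. That
      -- exchange turns Y0t1 into Y1t1, so that 0Y1t is a Dyck word followed by an unmatched one,
      -- and `ka` then reaches a block with empty v.
      shift-over : ∀ Y → Y ≡ cons (pairs k) X → cq (Y ▷ t) B ⇝ root-code
      shift-over ε p with () ← trans (sym (sz-cons (pairs k) X)) (cong sz (sym p))
      shift-over (A ▷ A′) p = forth (k2 A A′ t B eq₁) ⨾ forth (ka {j = 0} (s≤s z≤n) ⌈ cons (A ▷ A′) t ⌉ ε B eq₂) ⨾
          subst (λ i → low-code i ε B ⇝ root-code) (sym (sz-cons (A ▷ A′) t)) (from-ε (sz (A ▷ A′) + sz t) B B≤ eq₃)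
        where
        eq₁ : suc (sz (A ▷ A′ ▷ t) + sz B) ≡ m
        eq₁ = trans (trans (cong (λ i → suc (suc (i + sz t) + sz B)) (trans (cong sz p) (trans (sz-cons (pairs k) X) (cong (λ i → suc (i + sz X)) (sz-pairs k)))))
                   (lem k (sz X) (sz t) (sz B))) eq
          where
          lem : ∀ k x t b → suc (suc (suc (k + x) + t) + b) ≡ suc k + suc (suc (x + t) + b)
          lem = solve-∀
        eq₂ : suc (sz (cons (A ▷ A′) t) + 0 + sz B) ≡ m
        eq₂ = trans (cong (λ i → suc (i + sz B)) (trans (+-identityʳ _) (sz-cons (A ▷ A′) t))) eq₁
        eq₃ : suc (sz (A ▷ A′) + sz t) + suc (sz B) ≡ m
        eq₃ = trans (+-suc (suc (sz (A ▷ A′) + sz t)) (sz B)) eq₁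

    from-low : ∀ k v B → sz B ≤ n → k + suc (sz v + sz B) ≡ m → low-code k v B ⇝ root-code
    from-low (suc k) v B = from-suc k v B
    from-low zero v B B≤ eq with first v
    from-low zero v B B≤ eq | some q v′ = forth (k1 q v′ B eq) ⨾ forth (ka {j = 0} (s≤s z≤n) ⌈ cons ε q ⌉ v′ B
          (trans (trans (cong (λ i → suc (i + sz v′ + sz B)) (sz-cons ε q)) (cong (λ i → suc (i + sz B)) (sym (sz-cons q v′)))) eq)) ⨾
        subst (λ i → low-code i v′ B ⇝ root-code) (sym (sz-cons ε q))
          (from-suc (sz q) v′ B B≤ (trans (trans (+-suc (suc (sz q)) _) (trans (cong (λ i → suc (suc i)) (sym (+-assoc (sz q) _ _))) (cong (λ i → suc (i + sz B)) (sym (sz-cons q v′))))) eq))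
    from-low zero v ε B≤ eq | none = subst (λ i → cq ε ε ⇝ low-code i ε ε) (suc-injective eq) stay
    from-low zero v B@(_ ▷ _) B≤ eq | none = from-corner ε B B≤ irrε eq (λ ())

  reach-low : ∀ n k v B → sz B < n → k + suc (sz v + sz B) ≡ m → low-code k v B ⇝ root-code
  reach-low (suc n) k v B (s≤s B≤) = from-low n (reach-low n) k v B B≤

  reach-cell : ∀ {j} → j < μ → (y : Bal (suc (dbl j))) → ∀ w → suc j + (szᴮ y + sz w) ≡ m → cs y w ⇝ root-code
  reach-cell {j} j< (z ▸ v) w eq = forth (ka j< z v w eq) ⨾ reach-low (suc (sz w)) (j + szᴮ z) v w ≤-refl (trans (lem j (szᴮ z) (sz v) (sz w)) eq)
    where
    lem : ∀ j z v w → j + z + suc (v + w) ≡ suc j + (z + v + w)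
    lem = solve-∀

  -- A tower whose S begins with 1 contains the words 1Z1v1*w with any Dyck word w of size k.
  -- Changing the first bit gives a brick, and its other passage leads by `kg` to a cell. Bricks in
  -- turn lead to such towers by `kc`, and the remaining towers lead to bricks by `ke`.
  reach-tower₁ : ∀ k (Z : Bal (suc (dbl ν))) v → k + (suc μ + szᴮ (push1 Z ▸ v)) ≡ m → ct k (push1 Z ▸ v) ⇝ root-code
  reach-tower₁ k Z v eq = subst (λ i → ct i (push1 Z ▸ v) ⇝ root-code) (sz-pairs k)
      (back (kc (Z ▸ v ▸ ε) w eq₁) ⨾ forth (kg Z v w eq₂) ⨾ reach-cell ≤-refl (Z ⊳ v) w eq₂)
    where
    w = pairs k
    eq₁ : suc μ + (szᴮ (Z ▸ v ▸ ε) + sz w) ≡ m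
    eq₁ = trans (trans (cong (λ i → suc μ + (szᴮ Z + sz v + 0 + i)) (sz-pairs k)) (trans (lem μ (szᴮ Z) (sz v) k)
             (cong (λ i → k + (suc μ + (i + sz v))) (sym (szᴮ-push1 Z))))) eq
      where
      lem : ∀ u z v k → suc u + (z + v + 0 + k) ≡ k + (suc u + (z + v))
      lem = solve-∀
    eq₂ : suc ν + (szᴮ (Z ⊳ v) + sz w) ≡ m
    eq₂ = trans (trans (cong (λ i → suc ν + (i + sz w)) (szᴮ-⊳ Z v)) (lem ν (szᴮ Z + sz v) (sz w))) eq₁
      where
      lem : ∀ n z w → suc n + (suc z + w) ≡ suc (suc n) + (z + 0 + w)
      lem = solve-∀

  reach-brick : (y : Bal (suc (dbl μ))) → ∀ w → suc μ + (szᴮ y + sz w) ≡ m → cs y w ⇝ root-code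
  reach-brick (Z ▸ v ▸ x) w eq = forth (kc (Z ▸ v ▸ x) w eq) ⨾ reach-tower₁ (sz x + sz w) Z v
      (trans (trans (cong (λ i → sz x + sz w + (suc μ + (i + sz v))) (szᴮ-push1 Z)) (lem μ (szᴮ Z) (sz v) (sz x) (sz w))) eq)
    where
    lem : ∀ u z v x w → x + w + (suc u + (z + v)) ≡ suc u + (z + v + x + w)
    lem = solve-∀

  reach-tower : ∀ k (S : Bal (suc (dbl μ))) → k + (suc μ + szᴮ S) ≡ m → ct k S ⇝ root-code
  reach-tower k (R ▸ v) eq with front R
  ... | one Z = reach-tower₁ k Z v eq
  ... | nil Y = subst (λ i → ct i (push0 Y ▸ v) ⇝ root-code) (sz-pairs k) (back (ke Y v w eq₁) ⨾ reach-brick (Y ⊳ v) w eq₁)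
    where
    w = pairs k
    eq₁ : suc μ + (szᴮ (Y ⊳ v) + sz w) ≡ m
    eq₁ = trans (trans (cong₂ (λ i j → suc μ + (i + j)) (szᴮ-⊳ Y v) (sz-pairs k)) (trans (lem μ (szᴮ Y) (sz v) k)
             (cong (λ i → k + (suc μ + (i + sz v))) (sym (szᴮ-push0 Y))))) eq
      where
      lem : ∀ u z v k → suc u + (suc (z + v) + k) ≡ k + (suc u + (suc z + v))
      lem = solve-∀

  reach : ∀ {x} (v : View m μ x) → view-code v ⇝ root-code
  reach (vd k v B z p eq) = reach-low (suc (sz B)) (suc k) v B ≤-refl eq
  reach (vq c u d B eq) = reach-low (suc (sz B)) 0 u B ≤-refl eq
  reach (vc j< y c d w eq) = reach-cell j< y w eq
  reach (vb y d w eq) = reach-brick y w eq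
  reach (vt k S z p eq) = reach-tower k S eq

  root-view : View′ m μ ((O ∷ ⟦ pairs m′ ⟧ []) ++ suffix ε ε) root-code
  root-view = view-low ε ε (O ∷ ⟦ pairs m′ ⟧ [])
    (subst (λ i → Band i μ (O ∷ ⟦ pairs m′ ⟧ [])) (sz-pairs m′) (Band-first O ⌈ pairs m′ ⌉ z≤n)) (+-comm m′ 1)

  result : BandHam m μ
  result with root-view
  ... | view r e = Assemble.ham squares (Band? m (suc μ)) (suc (dbl m)) Band-length (ι m μ) (Valid m μ) C
    valid inside (λ {c} {p} → sound {c} {p}) uniq square reserved _ (view-band r)
    (λ {v} p → to-root (view-band r) p (subst₂ _⇝_ (sym (view-ι (classify p))) (sym (trans (view-ι r) e)) (reach (classify p))))

-- Four levels

-- For c = 0 this is x* with x = Y0v1, and for c = 1 it is S1z with a single bit z. In the scheme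
-- for more levels both would be single edges. For μ = 0 there are no cells to join them to, so they
-- are united to a 4-cycle.
roof : D → D → Bool → Bool → V
roof Y v c d = ⟦ Y ⟧ (c ∷ ⟦ v ⟧ (I ∷ d ∷ []))

roof-inj : ∀ Y v {a b c d} → roof Y v a b ≡ roof Y v c d → a ≡ c × b ≡ d
roof-inj Y v p with ⟦⟧-inj Y p
... | q with refl ← cong (λ { [] → O ; (z ∷ _) → z }) q
  with refl ← ⟦⟧-inj v (cong (λ { [] → [] ; (_ ∷ z) → z }) q) = refl , refl

leafᵛ : D → D → Bool → V
leafᵛ x w c = ⟦ x ⟧ (c ∷ ⟦ w ⟧ [])

data Code₂ : Set where
  dd      : ℕ → D → D → Code₂
  qq leaf : D → D → Code₂
  tow     : ℕ → D → D → Code₂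
  qq′     : D → D → Code₂
  junk    : Code₂

prime : D → Code₂
prime ε = junk
prime (Y ▷ v) = qq′ Y v

-- The classes for four levels are unions of the classes of `ι`, so the classification of words is
-- inherited. A brick 0p1q*w is rewritten as x*w with x = 0p1q; those with empty w are united with
-- the towers with k = 0.
coarsen : Code → Code₂
coarsen (cd k v B) = dd k v B
coarsen (cq u B) = qq u B
coarsen (cs (⌈ p ⌉ ▸ q) ε) = prime (cons p q)
coarsen (cs (⌈ p ⌉ ▸ q) w@(_ ▷ _)) = leaf (cons p q) w
coarsen (cs _ _) = junk
coarsen (ct zero (⌈ Y ⌉ ▸ v)) = qq′ Y v
coarsen (ct (suc k) (⌈ Y ⌉ ▸ v)) = tow (suc k) Y v
coarsen (ct _ _) = junk
coarsen junk = junk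

Valid₂ : ℕ → Code₂ → Set
Valid₂ m (dd k v B) = (∃ λ k′ → k ≡ suc k′) × k + suc (sz v + sz B) ≡ m
Valid₂ m (qq u B) = suc (sz u + sz B) ≡ m
Valid₂ m (leaf x w) = x ≢ ε × w ≢ ε × sz x + sz w ≡ m
Valid₂ m (tow k Y v) = (∃ λ k′ → k ≡ suc k′) × k + suc (sz Y + sz v) ≡ m
Valid₂ m (qq′ Y v) = suc (sz Y + sz v) ≡ m
Valid₂ m junk = ⊥

data View₂ (m : ℕ) : V → Code₂ → Set where
  wd : ∀ k v B z → Band (suc k) 0 z → suc k + suc (sz v + sz B) ≡ m → View₂ m (z ++ suffix v B) (dd (suc k) v B)
  wq : ∀ c u d B → suc (sz u + sz B) ≡ m → View₂ m (floor u B c d) (qq u B)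
  wl : ∀ x w d → x ≢ ε → w ≢ ε → sz x + sz w ≡ m → View₂ m (leafᵛ x w d) (leaf x w)
  wt : ∀ k Y v z → Band (suc k) 0 z → suc k + suc (sz Y + sz v) ≡ m → View₂ m (⟦ Y ⟧ (I ∷ ⟦ v ⟧ (I ∷ z))) (tow (suc k) Y v)
  wp : ∀ Y v c d → suc (sz Y + sz v) ≡ m → View₂ m (roof Y v c d) (qq′ Y v)

as₂ : ∀ {m x y c} → x ≡ y → View₂ m x c → View₂ m y c
as₂ refl v = v

cons≢ε : ∀ p q → cons p q ≢ ε
cons≢ε p ε ()
cons≢ε p (q ▷ u) ()

prime-view : ∀ {m} x d → x ≢ ε → sz x ≡ m → View₂ m (leafᵛ x ε d) (prime x)
prime-view ε d x≢ eq = ⊥-elim (x≢ refl)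
prime-view (Y ▷ v) d x≢ eq = wp Y v O d eq

view₂ : ∀ {m x} (v : View m 0 x) → View₂ m x (coarsen (view-code v))
view₂ (vd k v B z p eq) = wd k v B z p eq
view₂ (vq c u d B eq) = wq c u d B eq
view₂ (vb (⌈ p ⌉ ▸ q) d ε eq) = as₂ (⟦cons⟧ p q _) (prime-view (cons p q) d (cons≢ε p q) (trans (sz-cons p q) (trans (cong suc (sym (+-identityʳ _))) eq)))
view₂ (vb (⌈ p ⌉ ▸ q) d w@(_ ▷ _) eq) = as₂ (⟦cons⟧ p q _) (wl (cons p q) w d (cons≢ε p q) (λ ()) (trans (cong (_+ sz w) (sz-cons p q)) eq))
view₂ (vt zero (⌈ Y ⌉ ▸ v) z p eq) with z | Band-length p
... | d ∷ [] | refl = wp Y v I d eq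
view₂ (vt (suc k) (⌈ Y ⌉ ▸ v) z p eq) = wt k Y v z p eq

ι₂ : ℕ → V → Code₂
ι₂ m x = coarsen (ι m 0 x)

record Located (m : ℕ) (x : V) (c : Code₂) : Set where
  constructor located
  field
    in-band : Band m 1 x
    in-code : ι₂ m x ≡ c
open Located

locate : ∀ {m x} (v : View m 0 x) → Located m x (coarsen (view-code v))
locate v = located (view-band v) (cong coarsen (view-ι v))

locate₂ : ∀ {m x c} → View₂ m x c → Located m x c
locate₂ (wd k v B z p eq) = locate (vd k v B z p eq)
locate₂ (wq c u d B eq) = locate (vq c u d B eq)
locate₂ (wl x ε d x≢ w≢ eq) = ⊥-elim (w≢ refl)
locate₂ {m} (wl x w@(_ ▷ _) d x≢ w≢ eq) with first x
... | none = ⊥-elim (x≢ refl)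
... | some p q = subst (λ z → Located m z (leaf (cons p q) w)) (sym (⟦cons⟧ p q _))
                   (locate (vb (⌈ p ⌉ ▸ q) d w (trans (cong (_+ sz w) (sym (sz-cons p q))) eq)))
locate₂ (wt k Y v z p eq) = locate (vt (suc k) (⌈ Y ⌉ ▸ v) z p eq)
locate₂ (wp Y v I d eq) = locate (vt 0 (⌈ Y ⌉ ▸ v) (d ∷ []) (Band-bit d) eq)
locate₂ {m} (wp Y v O d eq) = go (Y ▷ v) refl
  where
  -- The first factor must be split off to reach the form 0p1q, while the class is named by the last
  -- factor; `x` and its equation mediate between the two.
  go : ∀ x → x ≡ Y ▷ v → Located m (roof Y v O d) (qq′ Y v)
  go x e with first x
  go x () | none
  go x e | some p q = subst₂ (Located m) (trans (sym (⟦cons⟧ p q _)) (cong (λ z → ⟦ z ⟧ (d ∷ [])) e)) (cong prime e)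
                   (locate (vb (⌈ p ⌉ ▸ q) d ε (trans (cong suc (+-identityʳ _)) (trans (sym (sz-cons p q)) (trans (cong sz e) eq)))))

valid₂ : ∀ {m x c} → View₂ m x c → Valid₂ m c
valid₂ (wd k v B z p eq) = (k , refl) , eq
valid₂ (wq c u d B eq) = eq
valid₂ (wl x w d x≢ w≢ eq) = x≢ , w≢ , eq
valid₂ (wt k Y v z p eq) = (k , refl) , eq
valid₂ (wp Y v c d eq) = eq

module FourLevels (Hm : ∀ k → MidHam k) (m′ : ℕ) where
  m : ℕ
  m = suc m′

  -- The copies of the two-level cycle offer the edges of `MidEdge`, so other squares are needed
  -- than for more levels. Here `kl` joins leaves to towers, `kr` leaves to blocks, `kg` roofs to
  -- blocks, `kh` roofs to towers, `k0` and `k1` floors to roofs, and `k2` floors to blocks.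
  data K : Set where
    kl : ∀ Y v W w → .(suc (sz Y + sz v) + sz (W ▷ w) ≡ m) → K
    kr : ∀ X t u B → .(sz (X ▷ t) + suc (sz u + sz B) ≡ m) → K
    kg : ∀ Y V v → .(suc (sz Y + sz (V ▷ v)) ≡ m) → K
    kh : ∀ Y Y′ v → .(suc (sz (Y ▷ Y′) + sz v) ≡ m) → K
    k0 : .(1 ≡ m) → K
    k1 : ∀ A t → .(suc (sz (A ▷ t)) ≡ m) → K
    k2 : ∀ u t C → .(suc (sz u) + suc (sz t + sz C) ≡ m) → K

  vert : K → Bool → Bool → V
  vert (kl Y v W w _) b c = ⟦ Y ⟧ (b ∷ ⟦ v ⟧ (I ∷ c ∷ ⟦ W ▷ w ⟧ []))
  vert (kr X t u B _) b c = ⟦ X ▷ t ⟧ (c ∷ O ∷ ⟦ u ⟧ (not b ∷ ⟦ B ⟧ []))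
  vert (kg Y V v _) b c = ⟦ Y ⟧ (c ∷ ⟦ V ▷ v ⟧ (not b ∷ O ∷ []))
  vert (kh Y Y′ v _) b c = ⟦ Y ⟧ (b ∷ ⟦ Y′ ⟧ (I ∷ O ∷ ⟦ v ⟧ (I ∷ c ∷ [])))
  vert (k0 _) b c = I ∷ b ∷ c ∷ []
  vert (k1 A t _) b c = I ∷ O ∷ ⟦ A ⟧ (b ∷ ⟦ t ⟧ (I ∷ c ∷ []))
  vert (k2 u t C _) b c = I ∷ O ∷ ⟦ u ⟧ (c ∷ O ∷ ⟦ t ⟧ (not b ∷ ⟦ C ⟧ []))

  vert-edge : ∀ κ b → Adj (vert κ b O) (vert κ b I)
  vert-edge (kl Y v W w _) b = ⟦⟧-adj Y (b ∷ ⟦⟧-adj v (I ∷ up))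
  vert-edge (kr X t u B _) b = ⟦⟧-adj (X ▷ t) up
  vert-edge (kg Y V v _) b = ⟦⟧-adj Y up
  vert-edge (kh Y Y′ v _) b = ⟦⟧-adj Y (b ∷ ⟦⟧-adj Y′ (I ∷ (O ∷ ⟦⟧-adj v (I ∷ up))))
  vert-edge (k0 _) b = I ∷ (b ∷ up)
  vert-edge (k1 A t _) b = I ∷ (O ∷ ⟦⟧-adj A (b ∷ ⟦⟧-adj t (I ∷ up)))
  vert-edge (k2 u t C _) b = I ∷ (O ∷ ⟦⟧-adj u up)

  vert-join : ∀ κ c → Adj (vert κ O c) (vert κ I c)
  vert-join (kl Y v W w _) c = ⟦⟧-adj Y up
  vert-join (kr X t u B _) c = ⟦⟧-adj (X ▷ t) (c ∷ (O ∷ ⟦⟧-adj u down))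
  vert-join (kg Y V v _) c = ⟦⟧-adj Y (c ∷ ⟦⟧-adj (V ▷ v) down)
  vert-join (kh Y Y′ v _) c = ⟦⟧-adj Y up
  vert-join (k0 _) c = I ∷ up
  vert-join (k1 A t _) c = I ∷ (O ∷ ⟦⟧-adj A up)
  vert-join (k2 u t C _) c = I ∷ (O ∷ ⟦⟧-adj u (c ∷ (O ∷ ⟦⟧-adj t down)))

  squares : Squares (Kept m 0)
  squares = record
    { K = K ; κs = λ κ b → vert κ b O ; κt = λ κ b → vert κ b I ; κe = vert-edge
    ; joinˢ = λ κ → vert-join κ O ; joinᵗ = λ κ → vert-join κ I
    ; s = λ r → keptᵛ r O ; t = λ r → keptᵛ r I ; e = keptᵉ }

  open Squares squares using (sys; exchange)
  open Walks sys hiding (e)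

  -- An edge x*w of the copy serves `kr` if w is empty and `kg` if w is nonempty and the block
  -- consists of words z00, so these two never claim the same edge.
  σᵈ : ∀ {k} v B → .(suc k + suc (sz v + sz B) ≡ m) → (r : MidEdge (suc k)) →
       Step (midᵛ r O ++ suffix v B) (midᵛ r I ++ suffix v B)
  σᵈ v B eq (flip-last x e) = fw (k₁ (k2 x v B (trans (cong (_+ suc (sz v + sz B)) e) eq)))
    (cong (λ z → I ∷ O ∷ z) (sym (⟦⟧-++ x (O ∷ []) (suffix v B)))) (cong (λ z → I ∷ O ∷ z) (sym (⟦⟧-++ x (I ∷ []) (suffix v B))))
  σᵈ v B eq (flip-star (X ▷ t) ε e) = fw (k₁ (kr X t v B (trans (cong (_+ suc (sz v + sz B)) (trans (sym (+-identityʳ _)) e)) eq)))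
    (sym (⟦⟧-++ (X ▷ t) (O ∷ []) (suffix v B))) (sym (⟦⟧-++ (X ▷ t) (I ∷ []) (suffix v B)))
  σᵈ ε ε eq (flip-star x (V ▷ v) e) = fw (k₁ (kg x V v (trans (trans (cong suc e) (+-comm 1 _)) eq))) (at O) (at I)
    where
    at : ∀ c → ⟦ x ⟧ (c ∷ ⟦ V ▷ v ⟧ (O ∷ O ∷ [])) ≡ ⟦ x ⟧ (c ∷ ⟦ V ▷ v ⟧ []) ++ O ∷ O ∷ []
    at c = sym (trans (⟦⟧-++ x _ (O ∷ O ∷ [])) (cong (λ z → ⟦ x ⟧ (c ∷ z)) (⟦⟧-++ (V ▷ v) [] _)))
  σᵈ v B eq r@(flip-star x w e) = pl (Adj-++ (suffix v B) (midᵉ r))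

  module Block {k} v B .(eq : suc k + suc (sz v + sz B) ≡ m) =
    Embed squares (Hm (suc k)) (_++ suffix v B) (Adj-++ (suffix v B)) (σᵈ v B eq)

  pre : D → D → V → V
  pre Y v z = ⟦ Y ⟧ (I ∷ ⟦ v ⟧ (I ∷ z))

  pre-adj : ∀ Y v {a b} → Adj a b → Adj (pre Y v a) (pre Y v b)
  pre-adj Y v p = ⟦⟧-adj Y (I ∷ ⟦⟧-adj v (I ∷ p))

  pre-inj : ∀ Y v {a b} → pre Y v a ≡ pre Y v b → a ≡ b
  pre-inj Y v p with ⟦⟧-inj Y p
  ... | q with ⟦⟧-inj v (cong (λ { [] → [] ; (_ ∷ z) → z }) q)
  ...   | refl = refl

  σᵗ : ∀ {k} Y v → .(suc k + suc (sz Y + sz v) ≡ m) → (r : MidEdge (suc k)) → Step (pre Y v (midᵛ r O)) (pre Y v (midᵛ r I))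
  σᵗ Y v eq (flip-star ε (W ▷ w) e) = fw (k₁ (kl Y v W w (trans (trans (+-comm _ (sz (W ▷ w))) (cong (_+ suc (sz Y + sz v)) e)) eq))) refl refl
  σᵗ Y v eq (flip-star (ε ▷ x) ε e) = fw (k₁ (kh Y v x (trans (trans (lem (sz Y) (sz v) (sz x)) (cong (_+ suc (sz Y + sz v)) e)) eq))) refl refl
    where
    lem : ∀ y v x → suc (suc (y + v) + x) ≡ suc x + 0 + suc (y + v)
    lem = solve-∀
  σᵗ Y v eq r = pl (pre-adj Y v (midᵉ r))

  module Tower {k} Y v .(eq : suc k + suc (sz Y + sz v) ≡ m) =
    Embed squares (Hm (suc k)) (pre Y v) (pre-adj Y v) (σᵗ Y v eq)

  L₀ L₁ : ∀ x w → .(x ≢ ε) → .(w ≢ ε) → .(sz x + sz w ≡ m) → Step (leafᵛ x w O) (leafᵛ x w I)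
  L₀ (Y ▷ v) (W ▷ w) _ _ eq = fw (k₀ (kl Y v W w eq)) refl refl
  L₀ x w _ _ eq = pl (⟦⟧-adj x up)
  L₁ (X ▷ t) w _ _ eq with first w
  ... | none = pl (⟦⟧-adj (X ▷ t) up)
  ... | some u B = fw (k₀ (kr X t u B (trans (cong (sz (X ▷ t) +_) (sym (sz-cons u B))) eq)))
      (cong (λ z → ⟦ X ▷ t ⟧ (O ∷ z)) (sym (⟦cons⟧ u B []))) (cong (λ z → ⟦ X ▷ t ⟧ (I ∷ z)) (sym (⟦cons⟧ u B [])))
  L₁ ε w _ _ eq = pl up

  leaf-inj : ∀ x w → leafᵛ x w O ≢ leafᵛ x w I
  leaf-inj x w p with () ← ⟦⟧-inj x p

  module Leaf x w .(x≢ : x ≢ ε) .(w≢ : w ≢ ε) .(eq : sz x + sz w ≡ m) =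
    Pair squares (leafᵛ x w) (leaf-inj x w) (L₀ x w x≢ w≢ eq) (L₁ x w x≢ w≢ eq)

  Q₀ : ∀ u B → .(suc (sz u + sz B) ≡ m) → Step (floor u B O O) (floor u B O I)
  Q₀ ε ε eq = fw (inj₂ (flip-last ε irrε eq)) refl refl
  Q₀ (ε ▷ u) ε eq = fw (inj₂ (flip-last (ε ▷ u) (irr▷ u) (trans (cong (λ i → suc (suc i)) (sym (+-identityʳ (sz u)))) eq))) refl refl
  Q₀ u B eq = pl (O ∷ (O ∷ ⟦⟧-adj u up))

  Q₁ : ∀ u B → .(suc (sz u + sz B) ≡ m) → Step (floor u B I O) (floor u B I I)
  Q₁ u B eq with first B
  Q₁ ε _ eq | none = fw (k₀ (k0 eq)) refl refl
  Q₁ (A ▷ t) _ eq | none = fw (k₀ (k1 A t (trans (cong suc (sym (+-identityʳ _))) eq))) refl refl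
  ... | some t C = fw (k₀ (k2 u t C (trans (cong (λ i → suc (sz u + i)) (sym (sz-cons t C))) eq)))
      (cong (λ z → I ∷ O ∷ ⟦ u ⟧ (O ∷ z)) (sym (⟦cons⟧ t C []))) (cong (λ z → I ∷ O ∷ ⟦ u ⟧ (I ∷ z)) (sym (⟦cons⟧ t C [])))

  G₀ : ∀ u B → Step (floor u B O O) (floor u B I O)
  G₀ u B = pl up

  G₁ : ∀ u B → .(suc (sz u + sz B) ≡ m) → Step (floor u B O I) (floor u B I I)
  G₁ u B eq = fw (inj₂ (flip-first {j = 0} z≤n ⌈ cons u B ⌉ (trans (sz-cons u B) eq)))
                 (cong (O ∷_) (⟦cons⟧ u B [])) (cong (I ∷_) (⟦cons⟧ u B []))

  module Floor u B .(eq : suc (sz u + sz B) ≡ m) =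
    Quad squares (floor u B) (floor-inj u B) (Q₀ u B eq) (Q₁ u B eq) (G₀ u B) (G₁ u B eq)

  R₀ : ∀ Y v → .(suc (sz Y + sz v) ≡ m) → Step (roof Y v O O) (roof Y v O I)
  R₀ (Y ▷ Y′) v eq = fw (k₀ (kh Y Y′ v eq)) refl refl
  R₀ ε v eq = pl (O ∷ ⟦⟧-adj v (I ∷ up))

  R₁ : ∀ Y v → .(suc (sz Y + sz v) ≡ m) → Step (roof Y v I O) (roof Y v I I)
  R₁ (Y ▷ Y′) v eq = pl (⟦⟧-adj (Y ▷ Y′) (I ∷ ⟦⟧-adj v (I ∷ up)))
  R₁ ε v eq with first v
  ... | none = fw (k₁ (k0 eq)) refl refl
  ... | some A t = fw (k₁ (k1 A t (trans (cong suc (sym (sz-cons A t))) eq)))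
      (cong (I ∷_) (sym (⟦cons⟧ A t _))) (cong (I ∷_) (sym (⟦cons⟧ A t _)))

  T₀ : ∀ Y v → .(suc (sz Y + sz v) ≡ m) → Step (roof Y v O O) (roof Y v I O)
  T₀ Y (V ▷ v) eq = fw (k₀ (kg Y V v eq)) refl refl
  T₀ Y ε eq = pl (⟦⟧-adj Y up)

  T₁ : ∀ Y v → Step (roof Y v O I) (roof Y v I I)
  T₁ Y v = pl (⟦⟧-adj Y up)

  module Roof Y v .(eq : suc (sz Y + sz v) ≡ m) =
    Quad squares (roof Y v) (roof-inj Y v) (R₀ Y v eq) (R₁ Y v eq) (T₀ Y v eq) (T₁ Y v)

  C : ∀ c → Valid₂ m c → Cyc
  C (dd _ v B) ((k , refl) , eq) = Block.cyc v B eq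
  C (qq u B) eq = Floor.quad u B eq
  C (leaf x w) (x≢ , w≢ , eq) = Leaf.pair x w x≢ w≢ eq
  C (tow _ Y v) ((k , refl) , eq) = Tower.cyc Y v eq
  C (qq′ Y v) eq = Roof.quad Y v eq

  uniq : ∀ c p → Unique (vsᶜ (C c p))
  uniq (dd _ v B) ((k , refl) , eq) = Block.cyc-uniq v B eq (suffix-inj v B)
  uniq (qq u B) eq = Floor.quad-uniq u B eq
  uniq (leaf x w) (x≢ , w≢ , eq) = Leaf.pair-uniq x w x≢ w≢ eq
  uniq (tow _ Y v) ((k , refl) , eq) = Tower.cyc-uniq Y v eq (pre-inj Y v)
  uniq (qq′ Y v) eq = Roof.quad-uniq Y v eq

  sound : ∀ {c p y} → y ∈ vsᶜ (C c p) → Band m 1 y × ι₂ m y ≡ c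
  sound {c} {p} q = in-band l , in-code l
    where
    go : ∀ c p {y} → y ∈ vsᶜ (C c p) → View₂ m y c
    go (dd _ v B) ((k , refl) , eq) q with Block.cyc-sound v B eq q
    ... | z , pz , refl = wd k v B z pz eq
    go (qq u B) eq q with Floor.quad-sound u B eq q
    ... | a , b , refl = wq a u b B eq
    go (leaf x w) (x≢ , w≢ , eq) q with Leaf.pair-sound x w x≢ w≢ eq q
    ... | a , refl = wl x w a x≢ w≢ eq
    go (tow _ Y v) ((k , refl) , eq) q with Tower.cyc-sound Y v eq q
    ... | z , pz , refl = wt k Y v z pz eq
    go (qq′ Y v) eq q with Roof.quad-sound Y v eq q
    ... | a , b , refl = wp Y v a b eq
    l = locate₂ (go c p q)

  at : ∀ {c c′} (Q : ∀ c → Valid₂ m c → Set) → c′ ≡ c → (∀ p → Q c p) → ∀ p → Q c′ p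
  at Q refl h = h

  here₂ : ∀ {x} → Band m 1 x → ∃ λ c → View₂ m x c
  here₂ p = _ , view₂ (classify p)

  inside : ∀ {x} → Band m 1 x → (p : Valid₂ m (ι₂ m x)) → x ∈ vsᶜ (C (ι₂ m x) p)
  inside {x} px with here₂ px
  ... | c , v = at (λ c p → x ∈ vsᶜ (C c p)) (in-code (locate₂ v)) (go v)
    where
    go : ∀ {x c} → View₂ m x c → (p : Valid₂ m c) → x ∈ vsᶜ (C c p)
    go (wd k v B z pz _) ((_ , refl) , eq) = Block.cyc-complete v B eq pz
    go (wq c u d B _) eq = Floor.quad-complete u B eq c d
    go (wl x w d _ _ _) (x≢ , w≢ , eq) = Leaf.pair-complete x w x≢ w≢ eq d
    go (wt k Y v z pz _) ((_ , refl) , eq) = Tower.cyc-complete Y v eq pz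
    go (wp Y v c d _) eq = Roof.quad-complete Y v eq c d

  valid : ∀ {x} → Band m 1 x → Valid₂ m (ι₂ m x)
  valid px with here₂ px
  ... | c , v = subst (Valid₂ m) (sym (in-code (locate₂ v))) (valid₂ v)

  κ-code : K → Bool → Code₂
  κ-code (kl Y v W w _) O = leaf (Y ▷ v) (W ▷ w)
  κ-code (kl Y v W w _) I = tow (sz (W ▷ w)) Y v
  κ-code (kr X t u B _) O = leaf (X ▷ t) (cons u B)
  κ-code (kr X t u B _) I = dd (sz (X ▷ t)) u B
  κ-code (kg Y V v _) O = qq′ Y (V ▷ v)
  κ-code (kg Y V v _) I = dd (suc (sz Y + (sz V + sz v))) ε ε
  κ-code (kh Y Y′ v _) O = qq′ (Y ▷ Y′) v
  κ-code (kh Y Y′ v _) I = tow (suc (sz v)) Y Y′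
  κ-code (k0 _) O = qq ε ε
  κ-code (k0 _) I = qq′ ε ε
  κ-code (k1 A t _) O = qq (A ▷ t) ε
  κ-code (k1 A t _) I = qq′ ε (cons A t)
  κ-code (k2 u t C _) O = qq u (cons t C)
  κ-code (k2 u t C _) I = dd (suc (sz u)) t C

  Band-ten : ∀ x c → Band (suc (sz x)) 0 (I ∷ O ∷ ⟦ x ⟧ (c ∷ []))
  Band-ten x O = F⇒Band (lf (⌈ ε ⌉ ▸ ε) ∙ x ∙ ε) (bandF (lem (sz x)) (s≤s (s≤s z≤n)) (s≤s z≤n))
    where
    lem : ∀ s → dbl (s + 0) + 3 ≡ suc (dbl (suc s))
    lem s rewrite +-identityʳ s = +-comm (dbl s) 3
  Band-ten x I = subst (Band (suc (sz x)) 0) (cong (I ∷_) (⟦cons⟧ x ε []))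
    (F⇒Band (lf (⌈ ε ⌉ ▸ cons x ε)) (bandF (+-comm _ 1) z≤n (s≤s z≤n)))

  κ-view : ∀ κ b c → View₂ m (vert κ b c) (κ-code κ b)
  κ-view (kl Y v W w eq) O c = wl (Y ▷ v) (W ▷ w) c (λ ()) (λ ()) (sure eq)
  κ-view (kl Y v W w eq) I c = wt _ Y v _ (Band-mid ε c (W ▷ w)) (trans (+-comm (sz (W ▷ w)) _) (sure eq))
  κ-view (kr X t u B eq) O c = as₂ (cong (λ z → ⟦ X ▷ t ⟧ (c ∷ z)) (⟦cons⟧ u B []))
    (wl (X ▷ t) (cons u B) c (λ ()) (cons≢ε u B) (trans (cong (sz (X ▷ t) +_) (sz-cons u B)) (sure eq)))
  κ-view (kr X t u B eq) I c = as₂ (⟦⟧-++ (X ▷ t) (c ∷ []) (suffix u B))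
    (wd _ u B _ (subst (λ i → Band i 0 (⟦ X ▷ t ⟧ (c ∷ []))) (+-identityʳ _) (Band-mid (X ▷ t) c ε)) (sure eq))
  κ-view (kg Y V v eq) O c = wp Y (V ▷ v) c O (sure eq)
  κ-view (kg Y V v eq) I c = as₂ (trans (⟦⟧-++ Y (c ∷ ⟦ V ▷ v ⟧ []) (O ∷ O ∷ [])) (cong (λ z → ⟦ Y ⟧ (c ∷ z)) (⟦⟧-++ (V ▷ v) [] (O ∷ O ∷ []))))
    (wd _ ε ε _ (subst (λ i → Band i 0 (⟦ Y ⟧ (c ∷ ⟦ V ▷ v ⟧ []))) (+-suc (sz Y) _) (Band-mid Y c (V ▷ v)))
      (trans (trans (+-comm _ 1) (cong suc (sym (+-suc (sz Y) _)))) (sure eq)))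
  κ-view (kh Y Y′ v eq) O c = wp (Y ▷ Y′) v O c (sure eq)
  κ-view (kh Y Y′ v eq) I c = wt _ Y Y′ _ (subst (λ i → Band i 0 (O ∷ ⟦ v ⟧ (I ∷ c ∷ []))) (+-identityʳ _) (Band-mid (ε ▷ v) c ε))
      (trans (lem (sz Y) (sz Y′) (sz v)) (sure eq))
    where
    lem : ∀ y y′ v → suc v + suc (y + y′) ≡ suc (suc (y + y′) + v)
    lem = solve-∀
  κ-view (k0 eq) O c = wq I ε c ε (sure eq)
  κ-view (k0 eq) I c = wp ε ε I c (sure eq)
  κ-view (k1 A t eq) O c = wq I (A ▷ t) c ε (trans (cong suc (+-identityʳ _)) (sure eq))
  κ-view (k1 A t eq) I c = as₂ (cong (I ∷_) (⟦cons⟧ A t _)) (wp ε (cons A t) I c (trans (cong suc (sz-cons A t)) (sure eq)))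
  κ-view (k2 u t C eq) O c = as₂ (cong (λ z → I ∷ O ∷ ⟦ u ⟧ (c ∷ z)) (⟦cons⟧ t C []))
    (wq I u c (cons t C) (trans (cong (λ i → suc (sz u + i)) (sz-cons t C)) (sure eq)))
  κ-view (k2 u t C eq) I c = as₂ (cong (λ z → I ∷ O ∷ z) (⟦⟧-++ u (c ∷ []) (suffix t C))) (wd _ t C _ (Band-ten u c) (sure eq))

  κ-present : ∀ κ b (p : Valid₂ m (κ-code κ b)) → inj₁ (κ , b) ∈ labsᶜ (C (κ-code κ b) p)
  κ-present (kl Y v W w eq) O (x≢ , w≢ , p) = Leaf.pair-e₀ (Y ▷ v) (W ▷ w) x≢ w≢ p (here refl)
  κ-present (kl Y v W w eq) I ((_ , refl) , p) = Tower.cyc-lab Y v p (flip-star ε (W ▷ w) refl) (here refl)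
  κ-present (kr X t u B eq) O (x≢ , w≢ , p) = Leaf.pair-e₁ (X ▷ t) (cons u B) x≢ w≢ p lem
    where
    lem : k₀ (kr X t u B eq) ∈ labˢ (L₁ (X ▷ t) (cons u B) x≢ w≢ p)
    lem rewrite first-cons u B = here refl
  κ-present (kr X t u B eq) I ((_ , refl) , p) = Block.cyc-lab u B p (flip-star (X ▷ t) ε (+-identityʳ _)) (here refl)
  κ-present (kg Y V v eq) O p = Roof.quad-f₀ Y (V ▷ v) p (here refl)
  κ-present (kg Y V v eq) I ((_ , refl) , p) = Block.cyc-lab ε ε p (flip-star Y (V ▷ v) (+-suc (sz Y) _)) (lem Y eq p)
    where
    lem : ∀ Y .(eq : suc (sz Y + sz (V ▷ v)) ≡ m) .(p : suc (sz Y + (sz V + sz v)) + 1 ≡ m) →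
          k₁ (kg Y V v eq) ∈ labˢ (σᵈ ε ε p (flip-star Y (V ▷ v) (+-suc (sz Y) _)))
    lem ε eq p = here refl
    lem (_ ▷ _) eq p = here refl
  κ-present (kh Y Y′ v eq) O p = Roof.quad-e₀ (Y ▷ Y′) v p (here refl)
  κ-present (kh Y Y′ v eq) I ((_ , refl) , p) = Tower.cyc-lab Y Y′ p (flip-star (ε ▷ v) ε (+-identityʳ _)) (here refl)
  κ-present (k0 eq) O p = Floor.quad-e₁ ε ε p (here refl)
  κ-present (k0 eq) I p = Roof.quad-e₁ ε ε p (here refl)
  κ-present (k1 A t eq) O p = Floor.quad-e₁ (A ▷ t) ε p (here refl)
  κ-present (k1 A t eq) I p = Roof.quad-e₁ ε (cons A t) p lem
    where
    lem : k₁ (k1 A t eq) ∈ labˢ (R₁ ε (cons A t) p)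
    lem rewrite first-cons A t = here refl
  κ-present (k2 u t C eq) O p = Floor.quad-e₁ u (cons t C) p lem
    where
    lem : k₀ (k2 u t C eq) ∈ labˢ (Q₁ u (cons t C) p)
    lem rewrite first-cons t C = here refl
  κ-present (k2 u t C eq) I ((_ , refl) , p) = Block.cyc-lab t C p (flip-last u refl) (here refl)

  square : ∀ κ b → Band m 1 (vert κ b O) × ((p : Valid₂ m (ι₂ m (vert κ b O))) → inj₁ (κ , b) ∈ labsᶜ (C (ι₂ m (vert κ b O)) p))
  square κ b = in-band l , at (λ c p → inj₁ (κ , b) ∈ labsᶜ (C c p)) (in-code l) (κ-present κ b)
    where l = locate₂ (κ-view κ b O)

  reserved : ∀ r → Band m 1 (keptᵛ r O) × ((p : Valid₂ m (ι₂ m (keptᵛ r O))) → inj₂ r ∈ labsᶜ (C (ι₂ m (keptᵛ r O)) p))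
  reserved (flip-first {zero} j≤ ⌈ d ⌉ eq) with first d
  ... | none with () ← sure eq
  ... | some u B rewrite ⟦cons⟧ u B [] = in-band l , at (λ c p → inj₂ (flip-first j≤ ⌈ cons u B ⌉ eq) ∈ labsᶜ (C c p)) (in-code l)
      (λ p → Floor.quad-f₁ u B p (here refl))
    where l = locate₂ (wq O u I B (trans (sym (sz-cons u B)) (sure eq)))
  reserved (flip-first {suc j} j≤ z eq) with () ← recompute (suc j ≤? 0) j≤
  reserved (flip-last u i eq) = in-band l , at (λ c p → inj₂ (flip-last u i eq) ∈ labsᶜ (C c p)) (in-code l)
      (λ p → Floor.quad-e₀ u ε p (lem u i eq p))
    where
    l = locate₂ (wq O u O ε (trans (cong suc (+-identityʳ _)) (sure eq)))
    lem : ∀ u i .(eq : suc (sz u) ≡ m) .(p : suc (sz u + 0) ≡ m) → inj₂ (flip-last u i eq) ∈ labˢ (Q₀ u ε p)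
    lem _ irrε eq p = here refl
    lem _ (irr▷ u) eq p = here refl

  open Connect exchange using (κ₀; κ₁)
  open Classes κ₀ κ₁ (Band m 1) (ι₂ m)

  forth : ∀ κ → κ-code κ O ⇝ κ-code κ I
  forth κ = subst₂ _⇝_ (in-code l₀) (in-code l₁) (hop κ (in-band l₀) (in-band l₁))
    where
    l₀ = locate₂ (κ-view κ O O)
    l₁ = locate₂ (κ-view κ I O)

  back : ∀ κ → κ-code κ I ⇝ κ-code κ O
  back κ = subst₂ _⇝_ (in-code l₁) (in-code l₀) (poh κ (in-band l₀) (in-band l₁))
    where
    l₀ = locate₂ (κ-view κ O O)
    l₁ = locate₂ (κ-view κ I O)

  root-code : Code₂
  root-code = qq′ ε (pairs m′)

  reach-block : ∀ k → suc k ≡ m′ → dd (suc k) ε ε ⇝ root-code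
  reach-block k refl = subst (λ i → dd i ε ε ⇝ root-code) (sz-pairs (suc k)) (back (kg ε (pairs k) ε (cong suc (sz-pairs (suc k)))))

  reach-long : ∀ Y V v → suc (sz Y + sz (V ▷ v)) ≡ m → qq′ Y (V ▷ v) ⇝ root-code
  reach-long Y V v eq = forth (kg Y V v eq) ⨾ reach-block _ (trans (sym (+-suc (sz Y) _)) (suc-injective eq))

  reach-tower : ∀ k Y v → suc k + suc (sz Y + sz v) ≡ m → tow (suc k) Y v ⇝ root-code
  -- For k = 1 the exchange `kh` would lead to a roof with empty last Dyck word, and such a roof is
  -- itself connected through this tower. The detour over a leaf avoids the circle.
  reach-tower zero Y v eq = back (kl Y v ε ε (trans (+-comm (suc (sz Y + sz v)) 1) eq)) ⨾
    forth (kr Y v ε ε (trans (+-comm (suc (sz Y + sz v)) 1) eq)) ⨾ reach-block (sz Y + sz v) (suc-injective eq)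
  reach-tower (suc k) Y v eq = subst (λ i → tow (suc i) Y v ⇝ root-code) (sz-pairs (suc k))
      (back (kh Y v (pairs (suc k)) eq′) ⨾ reach-long (Y ▷ v) (pairs k) ε eq′)
    where
    eq′ : suc (sz (Y ▷ v) + sz (pairs (suc k))) ≡ m
    eq′ = trans (trans (cong (λ i → suc (sz (Y ▷ v) + i)) (sz-pairs (suc k))) (lem k (sz Y) (sz v))) eq
      where
      lem : ∀ k y v → suc (suc (y + v) + suc k) ≡ suc (suc k) + suc (y + v)
      lem = solve-∀

  reach-leaf : ∀ x w → x ≢ ε → w ≢ ε → sz x + sz w ≡ m → leaf x w ⇝ root-code
  reach-leaf ε w x≢ _ _ = ⊥-elim (x≢ refl)
  reach-leaf (Y ▷ v) ε _ w≢ _ = ⊥-elim (w≢ refl)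
  reach-leaf (Y ▷ v) (W ▷ w) _ _ eq = forth (kl Y v W w eq) ⨾ reach-tower _ Y v (trans (+-comm (sz (W ▷ w)) _) eq)

  reach-low : ∀ k v B → suc k + suc (sz v + sz B) ≡ m → dd (suc k) v B ⇝ root-code
  reach-low k v B eq = subst (λ i → dd i v B ⇝ root-code) (sz-pairs (suc k))
      (back (kr (pairs k) ε v B eq′) ⨾ reach-leaf (pairs (suc k)) (cons v B) (λ ()) (cons≢ε v B) (trans (cong (sz (pairs (suc k)) +_) (sz-cons v B)) eq′))
    where
    eq′ : sz (pairs (suc k)) + suc (sz v + sz B) ≡ m
    eq′ = trans (cong (_+ suc (sz v + sz B)) (sz-pairs (suc k))) eq

  reach-roof : ∀ Y v → suc (sz Y + sz v) ≡ m → qq′ Y v ⇝ root-code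
  reach-roof Y (V ▷ v) eq = reach-long Y V v eq
  reach-roof (Y ▷ Y′) ε eq = forth (kh Y Y′ ε eq) ⨾ reach-tower 0 Y Y′ (trans (cong (λ i → suc (suc i)) (sym (+-identityʳ _))) eq)
  reach-roof ε ε eq = subst (λ i → qq′ ε ε ⇝ qq′ ε (pairs i)) (suc-injective eq) stay

  reach-floor : ∀ u B → suc (sz u + sz B) ≡ m → qq u B ⇝ root-code
  reach-floor u B eq with first B
  reach-floor ε _ eq | none = forth (k0 eq) ⨾ reach-roof ε ε eq
  reach-floor (A ▷ t) _ eq | none = forth (k1 A t eq′) ⨾ reach-roof ε (cons A t) (trans (cong suc (sz-cons A t)) eq′)
    where
    eq′ : suc (sz (A ▷ t)) ≡ m
    eq′ = trans (cong suc (sym (+-identityʳ _))) eq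
  ... | some t C = forth (k2 u t C eq′) ⨾ reach-low (sz u) t C eq′
    where
    eq′ : suc (sz u) + suc (sz t + sz C) ≡ m
    eq′ = trans (cong (λ i → suc (sz u + i)) (sym (sz-cons t C))) eq

  reach : ∀ {x c} → View₂ m x c → c ⇝ root-code
  reach (wd k v B z p eq) = reach-low k v B eq
  reach (wq c u d B eq) = reach-floor u B eq
  reach (wl x w d x≢ w≢ eq) = reach-leaf x w x≢ w≢ eq
  reach (wt k Y v z p eq) = reach-tower k Y v eq
  reach (wp Y v c d eq) = reach-roof Y v eq

  result : BandHam m 0
  result = Assemble.ham squares (Band? m 1) (suc (dbl m)) Band-length (ι₂ m) (Valid₂ m) C
    valid inside (λ {c} {p} → sound {c} {p}) uniq square reserved _ (in-band r)
    (λ {v} p → let w = view₂ (classify p) in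
               to-root (in-band r) p (subst₂ _⇝_ (sym (in-code (locate₂ w))) (sym (in-code r)) (reach w)))
    where r = locate₂ (wp ε (pairs m′) O O (cong suc (sz-pairs m′)))

-- Two levels

-- Dyck words of equal size are connected by rotating the last block and by moving a leaf over it.
infix 4 _≅_
data _≅_ : D → D → Set where
  ≅-refl  : ∀ {x} → x ≅ x
  ≅-sym   : ∀ {x y} → x ≅ y → y ≅ x
  ≅-trans : ∀ {x y z} → x ≅ y → y ≅ z → x ≅ z
  rotate  : ∀ X u → X ▷ u ≅ cons X u
  pull    : ∀ v u → v ▷ (u ▷ ε) ≅ v ▷ u ▷ ε

leaf-first : ∀ d → d ▷ ε ≅ cons ε d
leaf-first d = ≅-trans (rotate d ε) (rotate ε d)

-- The moves act at the end of a word, where the leaf 01 is in the way. A rotation is simulated by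
-- absorbing the leaf into the last factor with `pull` and rotating that; for a pull the leaf is
-- first carried to the front.
leaf-cong : ∀ {d d′} → d ≅ d′ → d ▷ ε ≅ d′ ▷ ε
leaf-cong ≅-refl = ≅-refl
leaf-cong (≅-sym p) = ≅-sym (leaf-cong p)
leaf-cong (≅-trans p q) = ≅-trans (leaf-cong p) (leaf-cong q)
leaf-cong (rotate X u) = ≅-trans (≅-sym (pull X u)) (rotate X (u ▷ ε))
leaf-cong (pull v u) = ≅-trans (leaf-first (v ▷ (u ▷ ε))) (≅-trans (pull (cons ε v) u) (≅-sym (leaf-first (v ▷ u ▷ ε))))

-- Rotating turns X0Y0u11 into 0X1Y0u1, whose last factor has the smaller content u. This ends with
-- the factor 01, which an induction on the size can then remove.
has-leaf : ∀ X u → ∃ λ d → X ▷ u ≅ d ▷ ε × sz d ≡ sz X + sz u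
has-leaf X ε = X , ≅-refl , sym (+-identityʳ _)
has-leaf X (Y ▷ u) with has-leaf (cons X Y) u
... | d , p , e = d , ≅-trans (rotate X (Y ▷ u)) p , trans e (trans (cong (_+ sz u) (sz-cons X Y)) (lem (sz X) (sz Y) (sz u)))
  where
  lem : ∀ x y u → suc (x + y) + u ≡ x + suc (y + u)
  lem = solve-∀

all-≅ : ∀ n x y → sz x ≡ n → sz y ≡ n → x ≅ y
all-≅ zero ε ε _ _ = ≅-refl
all-≅ (suc n) (X ▷ u) (Y ▷ v) p q with has-leaf X u | has-leaf Y v
... | d , a , e | d′ , a′ , e′ = ≅-trans a (≅-trans
  (leaf-cong (all-≅ n d d′ (trans e (suc-injective p)) (trans e′ (suc-injective q)))) (≅-sym a′))

sz-≅ : ∀ {x y} → x ≅ y → sz x ≡ sz y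
sz-≅ ≅-refl = refl
sz-≅ (≅-sym p) = sym (sz-≅ p)
sz-≅ (≅-trans p q) = trans (sz-≅ p) (sz-≅ q)
sz-≅ (rotate X u) = sym (sz-cons X u)
sz-≅ (pull v u) = lem (sz v) (sz u)
  where
  lem : ∀ v u → suc (v + suc (u + 0)) ≡ suc (suc (v + u) + 0)
  lem = solve-∀

unique-↭ : ∀ {A : Set} {xs ys : List A} → Unique xs → Unique ys → (∀ {v} → v ∈ xs → v ∈ ys) → (∀ {v} → v ∈ ys → v ∈ xs) → xs ↭ ys
unique-↭ {xs = []} {[]} u w f g = refl
unique-↭ {xs = []} {y ∷ ys} u w f g with () ← g (here refl)
unique-↭ {xs = x ∷ xs} {ys} (x∉ ∷ u) w f g with pick (f (here refl))
... | .x , zs , refl , perm with Unique-resp-↭ perm w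
...   | x∉′ ∷ w′ = ↭-trans (prep x (unique-↭ u w′ f′ g′)) (↭-sym perm)
  where
  f′ : ∀ {v} → v ∈ xs → v ∈ zs
  f′ p with ∈-resp-↭ perm (f (there p))
  ... | here refl = ⊥-elim (All.lookup x∉ p refl)
  ... | there q = q
  g′ : ∀ {v} → v ∈ zs → v ∈ xs
  g′ p with g (∈-resp-↭ (↭-sym perm) (there p))
  ... | here refl = ⊥-elim (All.lookup x∉′ p refl)
  ... | there q = q

∈-concatMap⁻ : ∀ {A B : Set} (f : A → List B) xs {v} → v ∈ concatMap f xs → ∃ λ x → x ∈ xs × v ∈ f x
∈-concatMap⁻ f (x ∷ xs) p with ∈-++⁻ (f x) p
... | inj₁ q = x , here refl , q
... | inj₂ q with ∈-concatMap⁻ f xs q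
...   | y , y∈ , r = y , there y∈ , r

∈-concatMap⁺ : ∀ {A B : Set} (f : A → List B) {xs x v} → x ∈ xs → v ∈ f x → v ∈ concatMap f xs
∈-concatMap⁺ f (here refl) q = ∈-++⁺ˡ q
∈-concatMap⁺ f {y ∷ _} (there p) q = ∈-++⁺ʳ (f y) (∈-concatMap⁺ f p q)

Unique-concatMap : ∀ {A B : Set} (f : A → List B) {xs} → Unique xs → (∀ x → Unique (f x)) →
                   (∀ {x y v} → v ∈ f x → v ∈ f y → x ≡ y) → Unique (concatMap f xs)
Unique-concatMap f [] u h = []
Unique-concatMap f {x ∷ xs} (x∉ ∷ w) u h = Uniqueₚ.++⁺ (u x) (Unique-concatMap f w u h)
  λ { (p , q) → let (y , y∈ , r) = ∈-concatMap⁻ f xs q in All.lookup x∉ y∈ (h p r) }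

Unique-words : ∀ n → Unique (words n)
Unique-words zero = [] ∷ []
Unique-words (suc n) = Uniqueₚ.++⁺ (Uniqueₚ.map⁺ inj (Unique-words n)) (Uniqueₚ.map⁺ inj (Unique-words n)) apart
  where
  inj : ∀ {b} {x y : V} → b ∷ x ≡ b ∷ y → x ≡ y
  inj refl = refl
  apart : ∀ {v} → ¬ (v ∈ map (O ∷_) (words n) × v ∈ map (I ∷_) (words n))
  apart (p , q) with ∈-map⁻ (O ∷_) p | ∈-map⁻ (I ∷_) q
  ... | _ , _ , refl | _ , _ , ()

-- Closing up arcs to cycles

module Orbits (S : Sys) where
  open Walks S

  record Arc : Set where
    constructor arc
    field
      from to : V
      path : Walk from to
      to∈  : to ∈ vs path
  open Arc public

  record Contains (α : Arc) (c : Cyc) : Set where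
    field
      from-in : from α ∈ vsᶜ c
      vs-in   : ∀ {v} → v ∈ vs (path α) → v ∈ vsᶜ c
      labs-in : ∀ {l} → l ∈ labs (path α) → l ∈ labsᶜ c
  open Contains public

  vsᵃ : List Arc → List V
  vsᵃ = concatMap (vs ∘ path)

  record Composed (αs : List Arc) : Set where
    field
      cycles : List Cyc
      same-vs : vsˡ cycles ↭ vsᵃ αs
      contains : ∀ {α} → α ∈ αs → Any (Contains α) cycles

  close : ∀ {αs} (α : Arc) → from α ≡ to α → Composed αs → Composed (α ∷ αs)
  close (arc a .a w a∈) refl C = record
    { cycles = (a , w) ∷ cycles
    ; same-vs = ++⁺ˡ (vs w) same-vs
    ; contains = λ { (here refl) → here (record { from-in = a∈ ; vs-in = id ; labs-in = id }) ; (there p) → there (contains p) } }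
    where open Composed C

  connect : (α β : Arc) → from β ≡ to α → Arc
  connect (arc a b w b∈) (arc .b c w′ c∈) refl = arc a c (w ++ʷ w′) (∈-resp-↭ (↭-sym (vs-++ w w′)) (∈-++⁺ʳ (vs w) c∈))

  uncut : ∀ {αs βs} (α β : Arc) (e : from β ≡ to α) → αs ↭ β ∷ βs → Composed (connect α β e ∷ βs) → Composed (α ∷ αs)
  uncut {αs} {βs} (arc a b w b∈) (arc .b c w′ c∈) refl perm C = record
    { cycles = cycles
    ; same-vs = ↭-trans same-vs (↭-trans (++⁺ʳ _ (vs-++ w w′)) (↭-trans (↭-++-assoc (vs w) (vs w′) _)
                  (++⁺ˡ (vs w) (↭-sym (concatMap-↭ (vs ∘ path) perm)))))
    ; contains = λ { (here refl) → Any.map (λ γ → record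
                        { from-in = from-in γ ; vs-in = vs-in γ ∘ inˡ ; labs-in = labs-in γ ∘ labs-++ˡ w }) (contains (here refl))
                   ; (there p) → in-rest (∈-resp-↭ perm p) } }
    where
    open Composed C
    inˡ : ∀ {v} → v ∈ vs w → v ∈ vs (w ++ʷ w′)
    inˡ p = ∈-resp-↭ (↭-sym (vs-++ w w′)) (∈-++⁺ˡ p)
    inʳ : ∀ {v} → v ∈ vs w′ → v ∈ vs (w ++ʷ w′)
    inʳ p = ∈-resp-↭ (↭-sym (vs-++ w w′)) (∈-++⁺ʳ (vs w) p)
    in-rest : ∀ {α} → α ∈ arc b c w′ c∈ ∷ βs → Any (Contains α) cycles
    in-rest (here refl) = Any.map (λ γ → record
      { from-in = vs-in γ (inˡ b∈) ; vs-in = vs-in γ ∘ inʳ ; labs-in = labs-in γ ∘ labs-++ʳ w }) (contains (here refl))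
    in-rest (there p) = contains (there p)

  connect-perm : ∀ {αs βs} (α β : Arc) (e : from β ≡ to α) → αs ↭ β ∷ βs → map from (α ∷ αs) ↭ map to (α ∷ αs) →
                 map from (connect α β e ∷ βs) ↭ map to (connect α β e ∷ βs)
  connect-perm (arc a b w b∈) (arc .b c w′ c∈) refl perm p =
    drop-∷ (↭-trans (swap b a refl) (↭-trans (prep a (↭-sym (↭-map⁺ from perm))) (↭-trans p (prep b (↭-map⁺ to perm)))))

  -- Starts and ends agree as multisets, so the end of the first arc starts some arc: the arc
  -- itself, which is then a cycle, or another one, which is appended. Each round uses up an arc and
  -- preserves the agreement.
  compose : ∀ n αs → length αs ≤ n → map from αs ↭ map to αs → Composed αs
  compose n [] _ _ = record { cycles = [] ; same-vs = refl ; contains = λ () }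
  compose (suc n) (α ∷ αs) (s≤s len) perm with from α ≟ⱽ to α
  ... | yes eq = close α eq (compose n αs len (drop-∷ (subst (λ z → z ∷ map from αs ↭ map to (α ∷ αs)) eq perm)))
  ... | no neq with ∈-resp-↭ (↭-sym perm) (here refl)
  ...   | here e = ⊥-elim (neq (sym e))
  ...   | there q with ∈-map⁻ from q
  ...     | β , β∈ , e with pick (Any.map (λ z → sym z) β∈)
  ...       | .β , βs , refl , split-off = uncut α β (sym e) split-off
              (compose n (connect α β (sym e) ∷ βs) (subst (_≤ n) (↭-length split-off) len) (connect-perm α β (sym e) split-off perm))

-- Rotating a marked bit through a Dyck word

zs : ∀ {n} → Vec D n → V
zs [] = []
zs (d ∷ ds) = O ∷ ⟦ d ⟧ (zs ds)

⟪_⟫ : ∀ {n} → Vec D (suc n) → V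
⟪ r ∷ rs ⟫ = ⟦ r ⟧ (zs rs)

-- A word L c R of the middle two levels, whose bit c is unmatched in the cyclic sense: R L is a Dyck word.
data St : Set where
  _∥_ : ∀ {b} → Bal b → Vec D (suc b) → St
infix 4 _∥_

vtx : St → Bool → V
vtx (L ∥ R) c = ⟦ L ⟧ᴮ (c ∷ ⟪ R ⟫)

szⱽ : ∀ {n} → Vec D n → ℕ
szⱽ [] = 0
szⱽ (d ∷ ds) = sz d + szⱽ ds

size : St → ℕ
size (_∥_ {b} L R) = b + (szᴮ L + szⱽ R)

-- The marked bit moves one position to the left, cyclically.
g : St → St
g (⌈ X ▷ u ⌉ ∥ R) = ⌈ X ⌉ ▸ u ∥ ε ∷ R
g (L ▸ (X ▷ u) ∥ R) = L ▸ X ▸ u ∥ ε ∷ R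
g (L ▸ ε ∥ r ∷ r′ ∷ R) = L ∥ cons r r′ ∷ R
g (⌈ ε ⌉ ∥ (X ▷ u) ∷ []) = ⌈ cons X u ⌉ ∥ ε ∷ []
g (⌈ ε ⌉ ∥ ε ∷ []) = ⌈ ε ⌉ ∥ ε ∷ []

h₀ : ∀ {b} → Bal b → Vec D b → St
h₀ (L ▸ u) R = L ⊳ u ∥ R
h₀ ⌈ d ⌉ [] with first d
... | none = ⌈ ε ⌉ ∥ ε ∷ []
... | some X u = ⌈ ε ⌉ ∥ (X ▷ u) ∷ []

h : St → St
h (L ∥ r ∷ R) with first r
... | none = h₀ L R
... | some p q = L ▸ ε ∥ p ∷ q ∷ R

h-g : ∀ s → h (g s) ≡ s
h-g (⌈ X ▷ u ⌉ ∥ R) = refl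
h-g (L ▸ (X ▷ u) ∥ R) = refl
h-g (L ▸ ε ∥ r ∷ r′ ∷ R) rewrite first-cons r r′ = refl
h-g (⌈ ε ⌉ ∥ (X ▷ u) ∷ []) rewrite first-cons X u = refl
h-g (⌈ ε ⌉ ∥ ε ∷ []) = refl

g-⊳ : ∀ {b} (L : Bal b) u R → g (L ⊳ u ∥ R) ≡ (L ▸ u ∥ ε ∷ R)
g-⊳ ⌈ d ⌉ u R = refl
g-⊳ (L ▸ d) u R = refl

g-h : ∀ s → g (h s) ≡ s
g-h (L ∥ r ∷ R) with first r
... | some p q = refl
g-h (L ▸ u ∥ _ ∷ R) | none = g-⊳ L u R
g-h (⌈ d ⌉ ∥ _ ∷ []) | none with first d
... | none = refl
... | some X u = refl

size-g : ∀ s → size (g s) ≡ size s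
size-g (⌈ X ▷ u ⌉ ∥ R) = lem (sz X) (sz u) (szⱽ R)
  where
  lem : ∀ x u r → suc (x + u + r) ≡ suc (x + u) + r
  lem = solve-∀
size-g (_∥_ {suc b} (L ▸ (X ▷ u)) R) = lem b (szᴮ L) (sz X) (sz u) (szⱽ R)
  where
  lem : ∀ b l x u r → suc (suc b) + (l + x + u + r) ≡ suc b + (l + suc (x + u) + r)
  lem = solve-∀
size-g (_∥_ {suc b} (L ▸ ε) (r ∷ r′ ∷ R)) rewrite sz-cons r r′ = lem b (szᴮ L) (sz r) (sz r′) (szⱽ R)
  where
  lem : ∀ b l x u r → b + (l + (suc (x + u) + r)) ≡ suc b + (l + 0 + (x + (u + r)))
  lem = solve-∀
size-g (⌈ ε ⌉ ∥ (X ▷ u) ∷ []) rewrite sz-cons X u = refl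
size-g (⌈ ε ⌉ ∥ ε ∷ []) = refl

size-h : ∀ s → size (h s) ≡ size s
size-h s = trans (sym (size-g (h s))) (cong size (g-h s))

-- The marked position passes one end of a matched pair, whose two bits then swap roles. Since the
-- marked bit changes from 0 to 1, the word keeps its letters at the old and the new marked
-- position, and only the other end of the pair differs. With no pairs at all only the marked bit
-- changes.
g-adj : ∀ s → Adj (vtx s O) (vtx (g s) I)
g-adj (⌈ X ▷ u ⌉ ∥ r ∷ R) = ⟦⟧-adj X up
g-adj (L ▸ (X ▷ u) ∥ r ∷ R) = ⟦⟧ᴮ-adj L (I ∷ ⟦⟧-adj X up)
g-adj (L ▸ ε ∥ r ∷ r′ ∷ R) rewrite ⟦cons⟧ r r′ (zs R) = ⟦⟧ᴮ-adj L (I ∷ (O ∷ ⟦⟧-adj r up))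
g-adj (⌈ ε ⌉ ∥ (X ▷ u) ∷ []) rewrite ⟦cons⟧ X u (I ∷ []) = O ∷ ⟦⟧-adj X up
g-adj (⌈ ε ⌉ ∥ ε ∷ []) = up

star-adj : ∀ s → Adj (vtx s I) (vtx s O)
star-adj (L ∥ R) = ⟦⟧ᴮ-adj L down

spl : SomeForm → ∃ Bal × List D
spl ⟨ lf L ⟩ = (_ , L) , []
spl ⟨ f ∙ d ⟩ = proj₁ (spl ⟨ f ⟩) , proj₂ (spl ⟨ f ⟩) ++ [ d ]

spl-run : ∀ {b a n} (f : Form b a) (R : Vec D n) → spl (run ⟨ f ⟩ (zs R)) ≡ (proj₁ (spl ⟨ f ⟩) , proj₂ (spl ⟨ f ⟩) ++ toList R)
spl-run f [] = cong (proj₁ (spl ⟨ f ⟩) ,_) (sym (++-identityʳ _))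
spl-run f (d ∷ R) = trans (cong spl (run-D′ f d (zs R))) (trans (spl-run (f ∙ d) R)
  (cong (proj₁ (spl ⟨ f ⟩) ,_) (++-assoc (proj₂ (spl ⟨ f ⟩)) [ d ] (toList R))))

spl-vtx : St → Bool → ∃ Bal × List D
spl-vtx (L ∥ R) O = (_ , L) , toList R
spl-vtx (L ∥ r ∷ R) I = (_ , L ▸ r) , toList R

spl-parse : ∀ s c → spl (parse (vtx s c)) ≡ spl-vtx s c
spl-parse (L ∥ r ∷ R) O = trans (cong spl (parse-B L (zs (r ∷ R)))) (spl-run (lf L) (r ∷ R))
spl-parse (L ∥ r ∷ R) I = trans (cong spl (parse-B (L ▸ r) (zs R))) (spl-run (lf (L ▸ r)) R)

toList-inj : ∀ {n} (R R′ : Vec D n) → toList R ≡ toList R′ → R ≡ R′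
toList-inj [] [] _ = refl
toList-inj (r ∷ R) (r′ ∷ R′) p with ∷-injective p
... | refl , q = cong (r ∷_) (toList-inj R R′ q)

length-toList : ∀ {n} (R : Vec D n) → length (toList R) ≡ n
length-toList [] = refl
length-toList (r ∷ R) = cong suc (length-toList R)

spl-vtx-inj : ∀ s s′ c c′ → spl-vtx s c ≡ spl-vtx s′ c′ → s ≡ s′ × c ≡ c′
spl-vtx-inj (L ∥ R) (L′ ∥ R′) O O p with cong proj₁ p
... | refl = cong (L ∥_) (toList-inj R R′ (cong proj₂ p)) , refl
spl-vtx-inj (L ∥ r ∷ R) (L′ ∥ r′ ∷ R′) I I p with cong proj₁ p
... | refl = cong (λ z → L ∥ r ∷ z) (toList-inj R R′ (cong proj₂ p)) , refl
spl-vtx-inj (L ∥ R) (L′ ∥ r′ ∷ R′) O I p with cong proj₁ p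
... | refl with () ← trans (sym (length-toList R)) (trans (cong length (cong proj₂ p)) (length-toList R′))
spl-vtx-inj (L ∥ r ∷ R) (L′ ∥ R′) I O p with cong proj₁ p
... | refl with () ← trans (sym (length-toList R′)) (trans (cong length (cong proj₂ (sym p))) (length-toList R))

-- The parse recovers the parts of L and R. The marked bit is determined by counting them: there is
-- one more unmatched zero than ones if it is 0, and one less if it is 1.
vtx-inj : ∀ s s′ {c c′} → vtx s c ≡ vtx s′ c′ → s ≡ s′ × c ≡ c′
vtx-inj s s′ {c} {c′} p = spl-vtx-inj s s′ c c′ (trans (sym (spl-parse s c)) (trans (cong (spl ∘ parse) p) (spl-parse s′ c′)))

zs-subst : ∀ {m n} (e : m ≡ n) (R : Vec D m) → zs (subst (Vec D) e R) ≡ zs R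
zs-subst refl R = refl

unform : ∀ {b a n} (f : Form b a) (R : Vec D n) → Σ (Bal b) λ L → Σ (Vec D (a + n)) λ R′ → str f (zs R) ≡ ⟦ L ⟧ᴮ (zs R′)
unform (lf L) R = L , R , refl
unform {a = suc a} {n} (f ∙ d) R with unform f (d ∷ R)
... | L , R′ , e = L , subst (Vec D) (+-suc a n) R′ , trans e (cong ⟦ L ⟧ᴮ (sym (zs-subst (+-suc a n) R′)))

zeros-zs : ∀ {n} (R : Vec D n) → zeros (zs R) ≡ n + szⱽ R
zeros-zs [] = refl
zeros-zs {suc n} (d ∷ R) rewrite zeros-D d (zs R) | zeros-zs R = lem (sz d) n (szⱽ R)
  where
  lem : ∀ d n r → suc (d + (n + r)) ≡ suc (n + (d + r))
  lem = solve-∀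

ones-zs : ∀ {n} (R : Vec D n) → ones (zs R) ≡ szⱽ R
ones-zs [] = refl
ones-zs (d ∷ R) rewrite ones-D d (zs R) | ones-zs R = refl

zeros-⟪⟫ : ∀ {b} (R : Vec D (suc b)) → zeros ⟪ R ⟫ ≡ b + szⱽ R
zeros-⟪⟫ {b} (r ∷ R) rewrite zeros-D r (zs R) | zeros-zs R = lem (sz r) b (szⱽ R)
  where
  lem : ∀ d n r → d + (n + r) ≡ n + (d + r)
  lem = solve-∀

ones-⟪⟫ : ∀ {b} (R : Vec D (suc b)) → ones ⟪ R ⟫ ≡ szⱽ R
ones-⟪⟫ (r ∷ R) rewrite ones-D r (zs R) | ones-zs R = refl

vtx-band : ∀ s c → Band (size s) 0 (vtx s c)
vtx-band (_∥_ {b} L R) O = mkBand (trans (zeros-B L _) (cong (λ i → szᴮ L + suc i) (zeros-⟪⟫ R))) (trans (ones-B L _) (cong (b + szᴮ L +_) (ones-⟪⟫ R)))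
  (trans (lem b (szᴮ L) (szⱽ R)) (cong suc (sym (dbl≡ _)))) (≤-reflexive (lem′ b (szᴮ L) (szⱽ R)))
  (≤-trans (m≤n+m _ 2) (≤-reflexive (lem″ b (szᴮ L) (szⱽ R))))
  where
  lem : ∀ b l r → l + suc (b + r) + (b + l + r) ≡ suc (b + (l + r) + (b + (l + r)))
  lem = solve-∀
  lem′ : ∀ b l r → l + suc (b + r) ≡ b + l + r + 1
  lem′ = solve-∀
  lem″ : ∀ b l r → 2 + (b + l + r) ≡ l + suc (b + r) + 1
  lem″ = solve-∀
vtx-band (_∥_ {b} L R) I = mkBand (trans (zeros-B L _) (cong (szᴮ L +_) (zeros-⟪⟫ R))) (trans (ones-B L _) (cong (λ i → b + szᴮ L + suc i) (ones-⟪⟫ R)))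
  (trans (lem b (szᴮ L) (szⱽ R)) (cong suc (sym (dbl≡ _))))
  (≤-trans (m≤n+m _ 2) (≤-reflexive (lem″ b (szᴮ L) (szⱽ R)))) (≤-reflexive (lem′ b (szᴮ L) (szⱽ R)))
  where
  lem : ∀ b l r → l + (b + r) + (b + l + suc r) ≡ suc (b + (l + r) + (b + (l + r)))
  lem = solve-∀
  lem′ : ∀ b l r → b + l + suc r ≡ l + (b + r) + 1
  lem′ = solve-∀
  lem″ : ∀ b l r → 2 + (l + (b + r)) ≡ b + l + suc r + 1
  lem″ = solve-∀

Band-size : ∀ {k s c} → Band k 0 (vtx s c) → size s ≡ k
Band-size {k} {s} {c} p = dbl-injective _ _ (suc-injective (trans (sym (total (vtx-band s c))) (total p)))

-- In B(k,0) the numbers of unmatched ones and zeros differ by at most one, and by parity they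
-- differ. The marked bit is the first unmatched zero or the last unmatched one, whichever kind is
-- in excess.
cover : ∀ {k x} → Band k 0 x → ∃ λ s → ∃ λ c → x ≡ vtx s c
cover {k} {x} p with parse x | str-parse x
... | b , a , f | refl with Band⇒F f p
...   | bandF t a≤ b≤ with unform f []
...     | L , R , e with m≤n⇒m<n∨m≡n (subst (a ≤_) (+-comm b 1) a≤)
...       | inj₂ refl = lower L (subst (Vec D) (+-identityʳ (suc b)) R) (trans e (cong ⟦ L ⟧ᴮ (sym (zs-subst (+-identityʳ (suc b)) R))))
  where
  lower : ∀ (L : Bal b) (R : Vec D (suc b)) → str f [] ≡ ⟦ L ⟧ᴮ (zs R) → ∃ λ s → ∃ λ c → str f [] ≡ vtx s c
  lower L (r ∷ R) e = (L ∥ r ∷ R) , O , e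
...       | inj₁ (s≤s a≤b) with m≤n⇒m<n∨m≡n a≤b
...         | inj₂ refl = ⊥-elim (dbl-≢ (szᶠ f + a) k (trans (lem (szᶠ f) a) t))
  where
  lem : ∀ s a → dbl (s + a) ≡ dbl s + (a + a)
  lem s a rewrite dbl≡ (s + a) | dbl≡ s = go s a
    where
    go : ∀ s a → s + a + (s + a) ≡ s + s + (a + a)
    go = solve-∀
...         | inj₁ a<b with ≤-antisym a<b (subst (b ≤_) (+-comm a 1) b≤)
...           | refl = upper L (subst (Vec D) (+-identityʳ a) R) (trans e (cong ⟦ L ⟧ᴮ (sym (zs-subst (+-identityʳ a) R))))
  where
  upper : ∀ (L : Bal (suc a)) (R : Vec D a) → str f [] ≡ ⟦ L ⟧ᴮ (zs R) → ∃ λ s → ∃ λ c → str f [] ≡ vtx s c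
  upper (L ▸ r) R e = (L ∥ r ∷ R) , I , e

-- Here i₁ = g x, i₂ = g i₁ and x₆ = g i₂. The arc from x0 to x₆0 has six edges; its first and its last edge and
-- the edge that leaves y0 are alternate edges of a 6-cycle, and are exchanged for the other three.
xˢ yˢ i₁ i₂ x₆ : D → D → St
xˢ v u = ⌈ v ▷ (u ▷ ε) ⌉ ∥ ε ∷ []
yˢ v u = ⌈ v ▷ u ▷ ε ⌉ ∥ ε ∷ []
i₁ v u = ⌈ v ⌉ ▸ (u ▷ ε) ∥ ε ∷ ε ∷ []
i₂ v u = ⌈ v ⌉ ▸ u ▸ ε ∥ ε ∷ ε ∷ ε ∷ []
x₆ v u = ⌈ v ⌉ ▸ u ∥ (ε ▷ ε) ∷ ε ∷ []

tˢ : D → St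
tˢ x = ⌈ ε ⌉ ▸ ε ∥ x ∷ ε ∷ []

-- The arcs that carry labels start at `isX`, `isY` or `isT`, and `isI₁`, `isI₂` are passed inside
-- the long arc. As `isN` imposes nothing, only the function `kind` makes the cases exclusive;
-- lemmas that depend on this keep the equation for `kind s`.
data Kind : St → Set where
  isX  : ∀ v u → Kind (xˢ v u)
  isY  : ∀ v u → Kind (yˢ v u)
  isI₁ : ∀ v u → Kind (i₁ v u)
  isI₂ : ∀ v u → Kind (i₂ v u)
  isT  : ∀ x → Kind (tˢ x)
  isN  : ∀ s → Kind s

kind : ∀ s → Kind s
kind (⌈ v ▷ (u ▷ ε) ⌉ ∥ ε ∷ []) = isX v u
kind (⌈ v ▷ u ▷ ε ⌉ ∥ ε ∷ []) = isY v u
kind (⌈ v ⌉ ▸ (u ▷ ε) ∥ ε ∷ ε ∷ []) = isI₁ v u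
kind (⌈ v ⌉ ▸ u ▸ ε ∥ ε ∷ ε ∷ ε ∷ []) = isI₂ v u
kind (⌈ ε ⌉ ▸ ε ∥ x ∷ ε ∷ []) = isT x
kind s = isN s

inner : ∀ {s} → Kind s → Bool
inner (isI₁ _ _) = I
inner (isI₂ _ _) = I
inner _ = O

orbᵏ : ∀ {s} → Kind s → List St
orbᵏ (isX v u) = i₁ v u ∷ i₂ v u ∷ x₆ v u ∷ []
orbᵏ (isI₁ v u) = []
orbᵏ (isI₂ v u) = []
orbᵏ (isY v u) = [ g (yˢ v u) ]
orbᵏ (isT x) = [ g (tˢ x) ]
orbᵏ (isN s) = [ g s ]

lastᵏ : ∀ {s} → Kind s → St
lastᵏ (isX v u) = x₆ v u
lastᵏ {s} _ = g s

rootᵏ : ∀ {s} → Kind s → St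
rootᵏ (isI₁ v u) = xˢ v u
rootᵏ (isI₂ v u) = xˢ v u
rootᵏ {s} _ = s

orb : St → List St
orb s = orbᵏ (kind s)

root : St → St
root s = rootᵏ (kind (h s))

root-g : ∀ s → root (g s) ≡ rootᵏ (kind s)
root-g s = cong (λ z → rootᵏ (kind z)) (h-g s)

root-orb : ∀ s {s′} → s′ ∈ orb s → root s′ ≡ s
root-orb s p with kind s in eq
root-orb _ (here refl) | isX v u = refl
root-orb _ (there (here refl)) | isX v u = refl
root-orb _ (there (there (here refl))) | isX v u = refl
root-orb s (here refl) | isY v u = trans (root-g s) (cong rootᵏ eq)
root-orb s (here refl) | isT x = trans (root-g s) (cong rootᵏ eq)
root-orb s (here refl) | isN _ = trans (root-g s) (cong rootᵏ eq)

orb-root : ∀ p → g p ∈ orb (rootᵏ (kind p))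
orb-root p with kind p in e
... | isX v u = here refl
... | isI₁ v u = there (here refl)
... | isI₂ v u = there (there (here refl))
... | isY v u = here refl
... | isT x rewrite e = here refl
... | isN s rewrite e = here refl

root-outer : ∀ p → inner (kind (rootᵏ (kind p))) ≡ O
root-outer p with kind p in e
... | isX v u = refl
... | isI₁ v u = refl
... | isI₂ v u = refl
... | isY v u = refl
... | isT x rewrite e = refl
... | isN s rewrite e = refl

size-root : ∀ p → size (rootᵏ (kind p)) ≡ size p
size-root p with kind p
... | isX v u = refl
... | isI₁ v u = sym (size-g (xˢ v u))
... | isI₂ v u = sym (trans (size-g (i₁ v u)) (size-g (xˢ v u)))
... | isY v u = refl
... | isT x = refl
... | isN s = refl

-- The map `g` is injective, so an inner state is entered only from `xˢ` or `i₁`, both of which the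
-- long arc leaves well before its end.
last-outer : ∀ s → inner (kind s) ≡ O → inner (kind (lastᵏ (kind s))) ≡ O
last-outer s p = go (kind (lastᵏ (kind s))) refl
  where
  go : ∀ {t} (κ : Kind t) → t ≡ lastᵏ (kind s) → inner κ ≡ O
  go (isX v u) _ = refl
  go (isY v u) _ = refl
  go (isT x) _ = refl
  go (isN t) _ = refl
  go (isI₁ v u) e with kind s in k
  ... | isX v′ u′ with () ← e
  ... | isY v′ u′ with () ← trans (cong h e) (h-g (yˢ v′ u′))
  ... | isT x with () ← trans (cong h e) (h-g (tˢ x))
  ... | isN .s with refl ← trans (cong h e) (h-g s) with () ← k
  go (isI₂ v u) e with kind s in k
  ... | isX v′ u′ with () ← e
  ... | isY v′ u′ with () ← trans (cong h e) (h-g (yˢ v′ u′))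
  ... | isT x with () ← trans (cong h e) (h-g (tˢ x))
  ... | isN .s with refl ← trans (cong h e) (h-g s) with () ← trans (cong inner (sym k)) refl

last-root : ∀ p → inner (kind (g p)) ≡ O → lastᵏ (kind (rootᵏ (kind p))) ≡ g p
last-root p q with kind p in k
... | isX v u with () ← q
... | isI₁ v u with () ← q
... | isI₂ v u = refl
... | isY v u = refl
... | isT x rewrite k = refl
... | isN _ rewrite k = refl

last-onto : ∀ s → inner (kind s) ≡ O → lastᵏ (kind (root s)) ≡ s
last-onto s p = trans (last-root (h s) (trans (cong (inner ∘ kind) (g-h s)) p)) (g-h s)

last∈orb : ∀ s → inner (kind s) ≡ O → lastᵏ (kind s) ∈ orb s
last∈orb s p with kind s
... | isX v u = there (there (here refl))
... | isY v u = here refl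
... | isT x = here refl
... | isN _ = here refl

orb-unique : ∀ s → Unique (orb s)
orb-unique s with kind s
... | isX v u = ((λ ()) ∷ (λ ()) ∷ []) ∷ ((λ ()) ∷ []) ∷ [] ∷ []
... | isI₁ v u = []
... | isI₂ v u = []
... | isY v u = [] ∷ []
... | isT x = [] ∷ []
... | isN _ = [] ∷ []

orb-size : ∀ s {s′} → s′ ∈ orb s → size s′ ≡ size s
orb-size s p with kind s
orb-size _ (here refl) | isX v u = size-g (xˢ v u)
orb-size _ (there (here refl)) | isX v u = trans (size-g (i₁ v u)) (size-g (xˢ v u))
orb-size _ (there (there (here refl))) | isX v u = trans (size-g (i₂ v u)) (trans (size-g (i₁ v u)) (size-g (xˢ v u)))
orb-size _ (here refl) | isY v u = size-g (yˢ v u)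
orb-size _ (here refl) | isT x = size-g (tˢ x)
orb-size _ (here refl) | isN s = size-g s

both : St → List V
both s = vtx s I ∷ vtx s O ∷ []

both⁻ : ∀ s {v} → v ∈ both s → ∃ λ c → v ≡ vtx s c
both⁻ s (here e) = I , e
both⁻ s (there (here e)) = O , e

both⁺ : ∀ s c → vtx s c ∈ both s
both⁺ s I = here refl
both⁺ s O = there (here refl)

ov : St → List V
ov s = concatMap both (orb s)

ov⁻ : ∀ s {v} → v ∈ ov s → ∃ λ s′ → s′ ∈ orb s × ∃ λ c → v ≡ vtx s′ c
ov⁻ s p with ∈-concatMap⁻ both (orb s) p
... | s′ , s′∈ , q = s′ , s′∈ , both⁻ s′ q

ov-unique : ∀ s → Unique (ov s)
ov-unique s = Unique-concatMap both (orb-unique s)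
  (λ t → ((λ e → O≢I (sym (proj₂ (vtx-inj t t e)))) ∷ []) ∷ [] ∷ [])
  (λ {x} {y} p q → let (c , e) = both⁻ x p ; (c′ , e′) = both⁻ y q in proj₁ (vtx-inj x y (trans (sym e) e′)))

ov-disjoint : ∀ {s t v} → v ∈ ov s → v ∈ ov t → s ≡ t
ov-disjoint {s} {t} p q with ov⁻ s p | ov⁻ t q
... | s′ , s′∈ , c , refl | t′ , t′∈ , c′ , e =
  trans (sym (root-orb s s′∈)) (trans (cong root (proj₁ (vtx-inj s′ t′ e))) (root-orb t t′∈))

record Outer (k : ℕ) : Set where
  constructor outer
  field
    st    : St
    size≡ : size st ≡ k
    isO   : inner (kind st) ≡ O
open Outer

Outer-≡ : ∀ {k} {a b : Outer k} → st a ≡ st b → a ≡ b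
Outer-≡ {a = outer s p q} {outer .s p′ q′} refl = cong₂ (outer s) (uip p p′) (uip q q′)

module Outers (k : ℕ) where
  -- A state is represented by its word with marked bit 0. Running through all words therefore lists
  -- every outer state exactly once.
  pick-outer : V → List (Outer k)
  pick-outer x with Band? k 0 x
  ... | no _ = []
  ... | yes p with cover p
  ...   | s , I , _ = []
  ...   | s , O , e with inner (kind s) ≟ᵇ O
  ...     | no _ = []
  ...     | yes o = [ outer s (Band-size {s = s} {O} (subst (Band k 0) e p)) o ]

  pick-sound : ∀ x {a} → a ∈ pick-outer x → x ≡ vtx (st a) O
  pick-sound x q with Band? k 0 x
  ... | yes p with cover p
  ...   | s , O , e with inner (kind s) ≟ᵇ O
  pick-sound x (here refl) | yes p | s , O , e | yes o = e

  pick-complete : ∀ a → a ∈ pick-outer (vtx (st a) O)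
  pick-complete (outer s refl q) with Band? k 0 (vtx s O)
  ... | no ¬p = ⊥-elim (¬p (vtx-band s O))
  ... | yes p with cover p
  ...   | s′ , c , e with vtx-inj s s′ e
  ...     | refl , refl with inner (kind s) ≟ᵇ O
  ...       | no ¬o = ⊥-elim (¬o q)
  ...       | yes o = here (Outer-≡ refl)

  pick-unique : ∀ x → Unique (pick-outer x)
  pick-unique x with Band? k 0 x
  ... | no _ = []
  ... | yes p with cover p
  ...   | s , I , _ = []
  ...   | s , O , e with inner (kind s) ≟ᵇ O
  ...     | no _ = []
  ...     | yes o = [] ∷ []

  outers : List (Outer k)
  outers = concatMap pick-outer (words (suc (dbl k)))

  ∈-outers : ∀ a → a ∈ outers
  ∈-outers a@(outer s refl _) = ∈-concatMap⁺ pick-outer (∈-words (vtx s O) (Band-length (vtx-band s O))) (pick-complete a)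

  outers-unique : Unique outers
  outers-unique = Unique-concatMap pick-outer (Unique-words (suc (dbl k))) pick-unique
    (λ {x} {y} p q → trans (pick-sound x p) (sym (pick-sound y q)))

-- Paths serve as edges of the system: the six edges of the long arc form one exchangeable edge, and
-- its five inner vertices pass to one of the new edges.
data Chain (a : V) : V → Set where
  last : ∀ {b} → Adj a b → Chain a b
  _⟶_  : ∀ {b c} → Adj a b → Chain b c → Chain a c
infixr 4 _⟶_

innᶜ : ∀ {a b} → Chain a b → List V
innᶜ (last p) = []
innᶜ (_⟶_ {b} p c) = b ∷ innᶜ c

snocᶜ : ∀ {a b c} → Chain a b → Adj b c → Chain a c
snocᶜ (last p) q = p ⟶ last q
snocᶜ (p ⟶ c) q = p ⟶ snocᶜ c q

innᶜ-snoc : ∀ {a b c} (x : Chain a b) (q : Adj b c) → innᶜ (snocᶜ x q) ≡ innᶜ x ++ [ b ]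
innᶜ-snoc (last p) q = refl
innᶜ-snoc (p ⟶ c) q = cong (_ ∷_) (innᶜ-snoc c q)

revᶜ : ∀ {a b} → Chain a b → Chain b a
revᶜ (last p) = last (Adj-sym p)
revᶜ (p ⟶ c) = snocᶜ (revᶜ c) (Adj-sym p)

innᶜ-rev : ∀ {a b} (x : Chain a b) → innᶜ (revᶜ x) ↭ innᶜ x
innᶜ-rev (last p) = refl
innᶜ-rev (_⟶_ {b} p c) = ↭-trans (↭-reflexive (innᶜ-snoc (revᶜ c) (Adj-sym p)))
  (↭-trans (↭-++-comm (innᶜ (revᶜ c)) [ b ]) (prep b (innᶜ-rev c)))

-- Connecting the cycles of the middle two levels

infix 4 _≈_
data _≈_ : St → St → Set where
  ≈-refl  : ∀ {s} → s ≈ s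
  ≈-sym   : ∀ {s s′} → s ≈ s′ → s′ ≈ s
  ≈-trans : ∀ {s s′ s″} → s ≈ s′ → s′ ≈ s″ → s ≈ s″
  turn    : ∀ s → s ≈ g s
  hexagon : ∀ v u → xˢ v u ≈ yˢ v u

size-≈ : ∀ {s s′} → s ≈ s′ → size s ≡ size s′
size-≈ ≈-refl = refl
size-≈ (≈-sym p) = sym (size-≈ p)
size-≈ (≈-trans p q) = trans (size-≈ p) (size-≈ q)
size-≈ (turn s) = sym (size-g s)
size-≈ (hexagon v u) = cong (_+ 0) (sz-≅ (pull v u))

≈-reflexive : ∀ {s s′} → s ≡ s′ → s ≈ s′
≈-reflexive refl = ≈-refl

⊕-ε : ∀ {n} (L : Bal n) → L ⊕ ε ≡ L
⊕-ε ⌈ d ⌉ = refl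
⊕-ε (L ▸ d) = refl

⊕-▷ : ∀ {n} (L : Bal n) X t → L ⊕ (X ▷ t) ≡ (L ⊕ X) ⊳ t
⊕-▷ ⌈ d ⌉ X t = refl
⊕-▷ (L ▸ d) X t = refl

cat-▷ : ∀ X t r → cat (X ▷ t) r ≡ cat X (cons t r)
cat-▷ X t ε = refl
cat-▷ X t (r ▷ u) = cong (_▷ u) (cat-▷ X t r)

-- The marked bit walks to the left over a whole Dyck word. In X0t1 it passes the 1, then t, the
-- opening bit and X; the pair is reinterpreted twice, at each of its ends, and so comes out
-- unchanged.
jump : ∀ {b} (L : Bal b) u r R → (L ⊕ u ∥ r ∷ R) ≈ (L ∥ cat u r ∷ R)
jump L ε r R = ≈-reflexive (cong₂ (λ l d → l ∥ d ∷ R) (⊕-ε L) (sym (cat-ε r)))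
jump L (X ▷ t) r R =
  ≈-trans (≈-reflexive (cong (_∥ r ∷ R) (⊕-▷ L X t)))
  (≈-trans (turn (L ⊕ X ⊳ t ∥ r ∷ R))
  (≈-trans (≈-reflexive (trans (g-⊳ (L ⊕ X) t (r ∷ R)) (cong (λ z → L ⊕ X ▸ z ∥ ε ∷ r ∷ R) (sym (cat-ε t)))))
  (≈-trans (jump (L ⊕ X ▸ ε) t ε (r ∷ R))
  (≈-trans (turn (L ⊕ X ▸ ε ∥ t ∷ r ∷ R))
  (≈-trans (jump L X (cons t r) R)
  (≈-reflexive (cong (λ z → L ∥ z ∷ R) (sym (cat-▷ X t r)))))))))

top : D → St
top y = ⌈ ε ⌉ ∥ y ∷ []

to-top : ∀ {b} (L : Bal b) R → ∃ λ y → (L ∥ R) ≈ top y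
to-top ⌈ x ⌉ (r ∷ []) = cat x r , ≈-trans (≈-reflexive (cong (λ z → ⌈ z ⌉ ∥ r ∷ []) (sym (cat-ε x)))) (jump ⌈ ε ⌉ x r [])
to-top (L ▸ d) (r ∷ r′ ∷ R) with to-top L (cons (cat d r) r′ ∷ R)
... | y , p = y , ≈-trans (≈-reflexive (cong (λ z → L ▸ z ∥ r ∷ r′ ∷ R) (sym (cat-ε d))))
  (≈-trans (jump (L ▸ ε) d r (r′ ∷ R)) (≈-trans (turn (L ▸ ε ∥ cat d r ∷ r′ ∷ R)) p))

closed : ∀ d → (⌈ d ⌉ ∥ ε ∷ []) ≈ top d
closed d = ≈-trans (≈-reflexive (cong (λ z → ⌈ z ⌉ ∥ ε ∷ []) (sym (cat-ε d)))) (jump ⌈ ε ⌉ d ε [])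

top-≅ : ∀ {x y} → x ≅ y → top x ≈ top y
top-≅ ≅-refl = ≈-refl
top-≅ (≅-sym p) = ≈-sym (top-≅ p)
top-≅ (≅-trans p q) = ≈-trans (top-≅ p) (top-≅ q)
top-≅ (rotate X u) = ≈-trans (turn (top (X ▷ u))) (closed (cons X u))
top-≅ (pull v u) = ≈-trans (≈-sym (closed (v ▷ (u ▷ ε)))) (≈-trans (hexagon v u) (closed (v ▷ u ▷ ε)))

all-≈ : ∀ s s′ → size s ≡ size s′ → s ≈ s′
all-≈ (L ∥ R) (L′ ∥ R′) e with to-top L R | to-top L′ R′
... | y , p | y′ , p′ = ≈-trans p (≈-trans (top-≅ (all-≅ _ y y′ refl (sym same))) (≈-sym p′))
  where
  same : sz y ≡ sz y′
  same = +-cancelʳ-≡ 0 (sz y) (sz y′) (trans (sym (size-≈ p)) (trans e (size-≈ p′)))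

module TwoLevels (k : ℕ) where
  open Outers k

  data Hexagon : Set where
    hex : ∀ v u → .(size (xˢ v u) ≡ k) → Hexagon

  s t : Hexagon × Bool ⊎ MidEdge k → V
  s (k₀ (hex v u _)) = vtx (xˢ v u) O
  s (k₁ (hex v u _)) = vtx (g (yˢ v u)) I
  s (inj₂ r) = midᵛ r O
  t (k₀ (hex v u _)) = vtx (x₆ v u) O
  t (k₁ (hex v u _)) = vtx (yˢ v u) O
  t (inj₂ r) = midᵛ r I

  inside-x : ∀ v u → Chain (vtx (i₁ v u) I) (vtx (x₆ v u) I)
  inside-x v u = star-adj (i₁ v u) ⟶ g-adj (i₁ v u) ⟶ star-adj (i₂ v u) ⟶ last (g-adj (i₂ v u))

  e : ∀ l → Chain (s l) (t l)
  e (k₀ (hex v u _)) = g-adj (xˢ v u) ⟶ snocᶜ (inside-x v u) (star-adj (x₆ v u))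
  e (k₁ (hex v u _)) = last (Adj-sym (g-adj (yˢ v u)))
  e (inj₂ r) = last (midᵉ r)

  -- The new edges are v0u0110 - v0u1110, v1u0010 - v1u0110 and v1u1010 - v0u1010.
  exchange : Exchange
  exchange = record
    { E = Chain ; inn = innᶜ ; rev = revᶜ ; inn-rev = innᶜ-rev ; K = Hexagon ; R = MidEdge k ; s = s ; t = t ; e = e
    ; joinˢ = λ { (hex v u _) → last (⟦⟧-adj v (O ∷ ⟦⟧-adj u up)) }
    ; joinᵗ = λ { (hex v u _) → ⟦⟧-adj v (I ∷ ⟦⟧-adj u (O ∷ up)) ⟶ snocᶜ (inside-x v u) (⟦⟧-adj v down) }
    ; join-inn = λ { (hex v u _) → refl } }

  module S = Walks (Exchange.sys exchange)
  open S using (Step; pl; fw; bw; Walk; []; _∷ʷ_; vs; labs; labˢ; innˢ)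
  open Orbits (Exchange.sys exchange)

  flip : ∀ s → .(size s ≡ k) → Step (vtx s I) (vtx s O)
  flip (⌈ x ⌉ ∥ w ∷ []) e = bw (inj₂ (flip-star x w (trans (cong (sz x +_) (sym (+-identityʳ (sz w)))) e))) refl refl
  flip s _ = pl (last (star-adj s))

  flip-inn : ∀ s .(e : size s ≡ k) → innˢ (flip s e) ≡ []
  flip-inn (⌈ x ⌉ ∥ w ∷ []) _ = refl
  flip-inn (L ▸ d ∥ R) _ = refl

  -- The long arc is a single labelled step, so no guaranteed edge may lie on it. In `i₁`, `i₂` and
  -- `x₆` an unmatched one precedes the marked bit, which excludes the edges of `flip-star`, and
  -- none of its three moves starts in a state `tˢ`.
  path-from : ∀ {s} (κ : Kind s) → inner κ ≡ O → .(size s ≡ k) → Walk (vtx s O) (vtx (lastᵏ κ) O)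
  path-from (isX v u) _ e = fw (k₀ (hex v u e)) refl refl ∷ʷ []
  path-from (isY v u) _ e = bw (k₁ (hex v u (trans (size-≈ (hexagon v u)) e))) refl refl ∷ʷ flip (g (yˢ v u)) (trans (size-g (yˢ v u)) e) ∷ʷ []
  path-from (isT x) _ e = fw (inj₂ (flip-last x (trans (cong suc (sym (+-identityʳ (sz x)))) e))) refl refl ∷ʷ flip (g (tˢ x)) (trans (size-g (tˢ x)) e) ∷ʷ []
  path-from (isN s) _ e = pl (last (g-adj s)) ∷ʷ flip (g s) (trans (size-g s) e) ∷ʷ []

  path-vs : ∀ {s} (κ : Kind s) (o : inner κ ≡ O) .(e : size s ≡ k) → vs (path-from κ o e) ≡ concatMap both (orbᵏ κ)
  path-vs (isX v u) _ e = refl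
  path-vs (isY v u) _ e rewrite flip-inn (g (yˢ v u)) (trans (size-g (yˢ v u)) e) = refl
  path-vs (isT x) _ e rewrite flip-inn (g (tˢ x)) (trans (size-g (tˢ x)) e) = refl
  path-vs (isN s) _ e rewrite flip-inn (g s) (trans (size-g s) e) = refl

  arc-of : Outer k → Arc
  arc-of (outer s e o) = arc (vtx s O) (vtx (lastᵏ (kind s)) O) (path-from (kind s) o e)
    (subst (_ ∈_) (sym (path-vs (kind s) o e)) (∈-concatMap⁺ both (last∈orb s o) (both⁺ (lastᵏ (kind s)) O)))

  arc-vs : ∀ a → vs (path (arc-of a)) ≡ ov (st a)
  arc-vs (outer s e o) = path-vs (kind s) o e

  arcs : List Arc
  arcs = map arc-of outers

  next : Outer k → Outer k
  next (outer s e o) = outer (lastᵏ (kind s)) (trans (orb-size s (last∈orb s o)) e) (last-outer s o)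

  prev : Outer k → Outer k
  prev (outer s e o) = outer (root s) (trans (size-root (h s)) (trans (size-h s) e)) (root-outer (h s))

  next-prev : ∀ a → next (prev a) ≡ a
  next-prev (outer s e o) = Outer-≡ (last-onto s o)

  prev-next : ∀ a → prev (next a) ≡ a
  prev-next (outer s e o) = Outer-≡ (root-orb s (last∈orb s o))

  mark : Outer k → V
  mark a = vtx (st a) O

  next-inj : ∀ {a b} → next a ≡ next b → a ≡ b
  next-inj e = trans (sym (prev-next _)) (trans (cong prev e) (prev-next _))

  -- The map `next` has the inverse `prev`, so it permutes the outer states. This is the agreement
  -- of starts and ends that `compose` asks for.
  next-↭ : outers ↭ map next outers
  next-↭ = unique-↭ outers-unique (Uniqueₚ.map⁺ next-inj outers-unique)
    (λ {a} _ → subst (_∈ map next outers) (next-prev a) (∈-map⁺ next (∈-outers (prev a)))) (λ _ → ∈-outers _)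

  ends-↭ : map from arcs ↭ map to arcs
  ends-↭ = ↭-trans (↭-reflexive (sym (map-∘ outers))) (↭-trans (↭-map⁺ mark next-↭)
    (↭-reflexive (trans (sym (map-∘ outers)) (map-∘ outers))))

  open Composed (compose _ arcs ≤-refl ends-↭)

  all-vs : S.vsˡ cycles ↭ concatMap (ov ∘ st) outers
  all-vs = ↭-trans same-vs (↭-reflexive (trans (concatMap-map (vs ∘ path) arc-of outers) (concatMap-cong arc-vs outers)))

  unique : Unique (S.vsˡ cycles)
  unique = Unique-resp-↭ (↭-sym all-vs) (Unique-concatMap (ov ∘ st) outers-unique (ov-unique ∘ st)
    (λ {a} {b} p q → Outer-≡ (ov-disjoint {st a} {st b} p q)))

  contained : ∀ a → Any (Contains (arc-of a)) cycles
  contained a = contains (∈-map⁺ arc-of (∈-outers a))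

  -- As `p` may be an inner state, the arc in question is the one on which `p` is followed by `g p`;
  -- `own` tells whether `p` is its start or lies on it.
  turn-same : ∀ p c → size p ≡ k → S.Same cycles (vtx p O) (vtx (g p) c)
  turn-same p c e = Any.map (λ γ → source γ (own p) , vs-in γ (moved (orb-root p) c)) (contained a)
    where
    a = outer (rootᵏ (kind p)) (trans (size-root p) e) (root-outer p)
    moved : ∀ {s} → s ∈ orb (st a) → ∀ c → vtx s c ∈ vs (path (arc-of a))
    moved {s} q c = subst (vtx s c ∈_) (sym (arc-vs a)) (∈-concatMap⁺ both q (both⁺ s c))
    own : ∀ p → rootᵏ (kind p) ≡ p ⊎ p ∈ orb (rootᵏ (kind p))
    own p with kind p
    ... | isX v u = inj₁ refl
    ... | isY v u = inj₁ refl
    ... | isI₁ v u = inj₂ (here refl)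
    ... | isI₂ v u = inj₂ (there (here refl))
    ... | isT x = inj₁ refl
    ... | isN s = inj₁ refl
    source : ∀ {c} → Contains (arc-of a) c → rootᵏ (kind p) ≡ p ⊎ p ∈ orb (rootᵏ (kind p)) → vtx p O ∈ S.vsᶜ c
    source γ (inj₁ q) = subst (λ z → vtx z O ∈ _) q (from-in γ)
    source γ (inj₂ q) = vs-in γ (moved q O)

  flip-same : ∀ s c → size s ≡ k → S.Same cycles (vtx (h s) O) (vtx s c)
  flip-same s c e = subst (λ z → S.Same cycles (vtx (h s) O) (vtx z c)) (g-h s) (turn-same (h s) c (trans (size-h s) e))

  open Connect exchange

  conn-≈ : ∀ {s s′} → s ≈ s′ → size s ≡ k → Conn κ₀ κ₁ (S.Same cycles) (vtx s O) (vtx s′ O)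
  conn-≈ (≈-refl {s}) e = base (Any.map (λ { (p , _) → p , p }) (turn-same s O e))
  conn-≈ (≈-sym p) e = inv (conn-≈ p (trans (size-≈ p) e))
  conn-≈ (≈-trans p q) e = conn-≈ p e ◅ conn-≈ q (trans (sym (size-≈ p)) e)
  conn-≈ (turn s) e = base (turn-same s O e)
  conn-≈ (hexagon v u) e = link (hex v u e) ◅ inv (base (turn-same (yˢ v u) I (trans (sym (size-≈ (hexagon v u))) e)))

  has : ∀ a {l} → l ∈ labs (path (arc-of a)) → S.Has cycles l
  has a p = Any.map (λ γ → labs-in γ p) (contained a)

  has-hexagon : ∀ κ → S.Has cycles (k₀ κ) × S.Has cycles (k₁ κ)
  has-hexagon (hex v u e) = has (outer (xˢ v u) e′ refl) (here refl) ,
    has (outer (yˢ v u) (trans (sym (size-≈ (hexagon v u))) e′) refl) (here refl)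
    where e′ = sure e

  -- From an inner state, `g` leads to a state with unmatched ones before the marked bit, so the
  -- edges x*w are never reached from there.
  flip-outer : ∀ {s} (κ : Kind s) {x w} → g s ≡ (⌈ x ⌉ ∥ w ∷ []) → inner κ ≡ O
  flip-outer (isX v u) _ = refl
  flip-outer (isY v u) _ = refl
  flip-outer (isT x) _ = refl
  flip-outer (isN s) _ = refl

  flip-lab : ∀ s .(e : size s ≡ k) {x w} .{e′} → s ≡ (⌈ x ⌉ ∥ w ∷ []) → inj₂ (flip-star x w e′) ∈ labˢ (flip s e)
  flip-lab _ _ refl = here refl

  star-lab : ∀ {s} (κ : Kind s) o .(e : size s ≡ k) {x w} .{e′} → g s ≡ (⌈ x ⌉ ∥ w ∷ []) → inj₂ (flip-star x w e′) ∈ labs (path-from κ o e)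
  star-lab (isT x) _ e refl = there (here refl)
  star-lab (isN s) _ e q = ∈-++⁺ˡ (flip-lab (g s) (trans (size-g s) e) q)

  has-edge : ∀ r → S.Has cycles (inj₂ r)
  has-edge (flip-last x e) = has (outer (tˢ x) (trans (cong suc (+-identityʳ (sz x))) (sure e)) refl) (here refl)
  has-edge (flip-star x w e) = has (outer (h s′) (trans (size-h s′) e′) o) (star-lab (kind (h s′)) o _ (g-h s′))
    where
    s′ = ⌈ x ⌉ ∥ w ∷ []
    e′ : size s′ ≡ k
    e′ = trans (cong (sz x +_) (+-identityʳ (sz w))) (sure e)
    o = flip-outer (kind (h s′)) (g-h s′)

  in-cycles : ∀ s c → size s ≡ k → vtx s c ∈ S.vsˡ cycles
  in-cycles s c e = ∈-vsˡ⁺ (Exchange.sys exchange) (Any.map proj₂ (flip-same s c e))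

  Band-cycles : ∀ {x} → Band k 0 x → x ∈ S.vsˡ cycles
  Band-cycles p with cover p
  ... | s , c , refl = in-cycles s c (Band-size {s = s} {c} p)

  from-cycles : ∀ {x} → x ∈ S.vsˡ cycles → ∃ λ s → ∃ λ c → x ≡ vtx s c × size s ≡ k
  from-cycles p with ∈-concatMap⁻ (ov ∘ st) outers (∈-resp-↭ all-vs p)
  ... | a , _ , q with ov⁻ (st a) q
  ...   | s , s∈ , c , e = s , c , e , trans (orb-size (st a) s∈) (size≡ a)

  origin : St
  origin = top (pairs k)

  size-origin : size origin ≡ k
  size-origin = trans (+-identityʳ _) (sz-pairs k)

  connected : ∀ {x} → x ∈ S.vsˡ cycles → Conn κ₀ κ₁ (S.Same cycles) (vtx origin O) x
  connected p with from-cycles p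
  ... | s , c , refl , e =
    conn-≈ (all-≈ origin (h s) (trans size-origin (sym (trans (size-h s) e)))) size-origin ◅ base (flip-same s c e)

  merged : Single cycles unique id has-hexagon (vtx origin O) (in-cycles origin O size-origin) connected
  merged = single cycles unique id has-hexagon (vtx origin O) (in-cycles origin O size-origin) connected

  plain : Sys
  plain = adjSys {MidEdge k} (λ r → midᵛ r O) (λ r → midᵛ r I) midᵉ
  module A = Walks plain

  expand : ∀ {a b} → Chain a b → A.Walk a b
  expand (last p) = A.pl p A.∷ʷ A.[]
  expand (p ⟶ c) = A.pl p A.∷ʷ expand c

  expand-vs : ∀ {a b} (c : Chain a b) → A.vs (expand c) ≡ innᶜ c ++ [ b ]
  expand-vs (last p) = refl
  expand-vs (p ⟶ c) = cong (_ ∷_) (expand-vs c)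

  relabel : ∀ {a b} → Step a b → A.Walk a b
  relabel (pl c) = expand c
  relabel (fw (inj₁ κ) refl refl) = expand (e (inj₁ κ))
  relabel (bw (inj₁ κ) refl refl) = expand (revᶜ (e (inj₁ κ)))
  relabel (fw (inj₂ r) p q) = A.fw r p q A.∷ʷ A.[]
  relabel (bw (inj₂ r) p q) = A.bw r p q A.∷ʷ A.[]

  relabel-vs : ∀ {a b} (x : Step a b) → A.vs (relabel x) ↭ map id (innˢ x ++ [ b ])
  relabel-vs x = ↭-trans (go x) (↭-reflexive (sym (map-id _)))
    where
    go : ∀ {a b} (x : Step a b) → A.vs (relabel x) ↭ innˢ x ++ [ b ]
    go (pl c) = ↭-reflexive (expand-vs c)
    go (fw (inj₁ κ) refl refl) = ↭-reflexive (expand-vs (e (inj₁ κ)))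
    go (bw (inj₁ κ) refl refl) = ↭-trans (↭-reflexive (expand-vs (revᶜ (e (inj₁ κ))))) (++⁺ʳ _ (innᶜ-rev (e (inj₁ κ))))
    go (fw (inj₂ r) _ _) = refl
    go (bw (inj₂ r) _ _) = refl

  relabel-lab : ∀ {r a b} (x : Step a b) → inj₂ r ∈ labˢ x → r ∈ A.labs (relabel x)
  relabel-lab (fw (inj₂ r) _ _) (here refl) = here refl
  relabel-lab (bw (inj₂ r) _ _) (here refl) = here refl

  open MapWalk (Exchange.sys exchange) plain id relabel relabel-vs
  open Single merged

  same : A.vs (mapʷ (proj₂ cycle)) ↭ S.vsᶜ cycle
  same = ↭-trans (map-vs (proj₂ cycle)) (↭-reflexive (map-id (S.vsᶜ cycle)))

  result : MidHam k
  result = record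
    { start = proj₁ cycle
    ; walk = mapʷ (proj₂ cycle)
    ; unique = Unique-resp-↭ (↭-sym same) uniq
    ; sound = λ p → sound (⊆Cs (∈-resp-↭ same p))
    ; complete = λ p → ∈-resp-↭ (↭-sym same) (⊇Cs (Band-cycles p))
    ; present = λ r → map-labs relabel-lab (proj₂ cycle) (kept (has-edge r)) }
    where
    sound : ∀ {x} → x ∈ S.vsˡ cycles → Band k 0 x
    sound p with from-cycles p
    ... | s , c , refl , refl = vtx-band s c

-- From words to bitstrings

midHam : ∀ k → MidHam k
midHam = TwoLevels.result

-- All sizes are treated for one number of levels at a time, since the next stage needs blocks of
-- every size k < m. If ν is large compared to the size, the band is the whole cube.
bandHam : ∀ ν k → BandHam (suc k) ν
bandHam zero = FourLevels.result midHam
bandHam (suc ν) = ManyLevels.result ν (bandHam ν) midHam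

-- Words that are too short are padded, longer ones are truncated.
vec : ∀ n → V → Vec Bool n
vec zero x = []
vec (suc n) [] = O ∷ vec n []
vec (suc n) (c ∷ x) = c ∷ vec n x

toList-vec : ∀ x → toList (vec (length x) x) ≡ x
toList-vec [] = refl
toList-vec (c ∷ x) = cong (c ∷_) (toList-vec x)

vec-toList : ∀ {n} (x : Vec Bool n) → vec n (toList x) ≡ x
vec-toList [] = refl
vec-toList (c ∷ x) = cong (c ∷_) (vec-toList x)

weight-ones : ∀ {n} (x : Vec Bool n) → weight x ≡ ones (toList x)
weight-ones [] = refl
weight-ones (O ∷ x) = weight-ones x
weight-ones (I ∷ x) = cong suc (weight-ones x)

total-toList : ∀ {n} (x : Vec Bool n) → zeros (toList x) + ones (toList x) ≡ n
total-toList [] = refl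
total-toList (O ∷ x) = cong suc (total-toList x)
total-toList (I ∷ x) = trans (+-suc _ _) (cong suc (total-toList x))

hamming-refl : ∀ {n} (x : Vec Bool n) → hamming x x ≡ 0
hamming-refl [] = refl
hamming-refl (O ∷ x) = hamming-refl x
hamming-refl (I ∷ x) = hamming-refl x

Adj-vec : ∀ {x y} → Adj x y → Adjacent (vec (length x) x) (vec (length x) y)
Adj-vec (up {x}) = cong suc (hamming-refl (vec (length x) x))
Adj-vec (down {x}) = cong suc (hamming-refl (vec (length x) x))
Adj-vec (O ∷ p) = Adj-vec p
Adj-vec (I ∷ p) = Adj-vec p

module Levels {z o m λ′ : ℕ} (total : z + o ≡ suc (dbl m)) where
  low-level : z ≤ o + suc (dbl λ′) → m ∸ λ′ ≤ o
  low-level p = m≤n+o⇒m∸n≤o m λ′ (dbl-cancel m (λ′ + o) (≤-trans (n≤1+n _) (≤-trans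
    (subst (_≤ o + suc (dbl λ′) + o) total (+-monoˡ-≤ o p)) (≤-reflexive lem))))
    where
    lem : o + suc (dbl λ′) + o ≡ suc (dbl (λ′ + o))
    lem rewrite dbl≡ λ′ | dbl≡ (λ′ + o) = go o λ′
      where
      go : ∀ o l → o + suc (l + l) + o ≡ suc (l + o + (l + o))
      go = solve-∀

  level-low : m ∸ λ′ ≤ o → z ≤ o + suc (dbl λ′)
  level-low p = +-cancelʳ-≤ o z _ (≤-trans (≤-reflexive total) (≤-trans (s≤s (dbl-mono (≤-trans (m≤n+m∸n m λ′) (+-monoʳ-≤ λ′ p)))) (≤-reflexive lem)))
    where
    lem : suc (dbl (λ′ + o)) ≡ o + suc (dbl λ′) + o
    lem rewrite dbl≡ λ′ | dbl≡ (λ′ + o) = go o λ′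
      where
      go : ∀ o l → suc (l + o + (l + o)) ≡ o + suc (l + l) + o
      go = solve-∀

  sum-high : z + suc (dbl λ′) + o ≡ dbl (m + suc λ′)
  sum-high = trans (reorder z (suc (dbl λ′)) o) (trans (cong (_+ suc (dbl λ′)) total) lem)
    where
    reorder : ∀ z l o → z + l + o ≡ z + o + l
    reorder = solve-∀
    lem : suc (dbl m) + suc (dbl λ′) ≡ dbl (m + suc λ′)
    lem rewrite dbl≡ λ′ | dbl≡ m | dbl≡ (m + suc λ′) = go m λ′
      where
      go : ∀ m l → suc (m + m) + suc (l + l) ≡ m + suc l + (m + suc l)
      go = solve-∀

  high-level : o ≤ z + suc (dbl λ′) → o ≤ m + suc λ′
  high-level p = dbl-cancel o (m + suc λ′) (≤-trans (≤-reflexive (dbl≡ o)) (≤-trans (+-monoˡ-≤ o p)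
    (≤-trans (≤-reflexive sum-high) (n≤1+n _))))

  level-high : o ≤ m + suc λ′ → o ≤ z + suc (dbl λ′)
  level-high p = +-cancelʳ-≤ o o _ (≤-trans (≤-reflexive (sym (dbl≡ o))) (≤-trans (dbl-mono p) (≤-reflexive (sym sum-high))))

2*≡dbl : ∀ m → 2 * m ≡ dbl m
2*≡dbl m = trans (cong (m +_) (+-identityʳ m)) (sym (dbl≡ m))

module _ {m λ′ : ℕ} where
  Band⇒Levels : ∀ x → Band m λ′ (toList x) → MiddleLevels m (suc λ′) x
  Band⇒Levels x (band t l h) rewrite weight-ones x = low-level l , high-level h
    where open Levels {zeros (toList x)} {ones (toList x)} {m} {λ′} t

  Levels⇒Band : ∀ x → MiddleLevels m (suc λ′) x → Band m λ′ (toList x)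
  Levels⇒Band x (l , h) rewrite weight-ones x = band t (level-low l) (level-high h)
    where
    t = trans (total-toList x) (cong suc (2*≡dbl m))
    open Levels {zeros (toList x)} {ones (toList x)} {m} {λ′} t

lookup-injective : ∀ {A : Set} {xs : List A} → Unique xs → ∀ i j → lookup xs i ≡ lookup xs j → i ≡ j
lookup-injective (p ∷ u) Fin.zero Fin.zero _ = refl
lookup-injective (p ∷ u) Fin.zero (Fin.suc j) e = ⊥-elim (All.lookup p (∈-lookup j) e)
lookup-injective (p ∷ u) (Fin.suc i) Fin.zero e = ⊥-elim (All.lookup p (∈-lookup i) (sym e))
lookup-injective (p ∷ u) (Fin.suc i) (Fin.suc j) e = cong Fin.suc (lookup-injective u i j e)

three : ∀ {A : Set} {x y z : A} xs → x ≢ y → x ≢ z → y ≢ z → x ∈ xs → y ∈ xs → z ∈ xs → 3 ≤ length xs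
three (_ ∷ _ ∷ _ ∷ _) _ _ _ _ _ _ = s≤s (s≤s (s≤s z≤n))
three (_ ∷ _) p _ _ (here refl) (here refl) _ = ⊥-elim (p refl)
three (_ ∷ _) _ p _ (here refl) _ (here refl) = ⊥-elim (p refl)
three (_ ∷ _) _ _ p _ (here refl) (here refl) = ⊥-elim (p refl)
three (_ ∷ _ ∷ []) _ _ p _ (there (here refl)) (there (here refl)) = ⊥-elim (p refl)
three (_ ∷ _ ∷ []) _ p _ (there (here refl)) _ (there (here refl)) = ⊥-elim (p refl)
three (_ ∷ _ ∷ []) p _ _ (there (here refl)) (there (here refl)) _ = ⊥-elim (p refl)

module Traverse {R : Set} (s t : R → V) (e : ∀ r → Adj (s r) (t r)) {m′ λ′ : ℕ} (H : Ham s t e (Band (suc m′) λ′)) where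
  private m = suc m′
  open Walks (adjSys s t e) using (Step; pl; fw; bw; Walk; []; _∷ʷ_; vs)
  open Ham H

  step-adj : ∀ {a b} → Step a b → Adj a b
  step-adj (pl p) = p
  step-adj (fw r refl refl) = e r
  step-adj (bw r refl refl) = Adj-sym (e r)

  step-vs : ∀ {a b c} (x : Step a b) (w : Walk b c) → vs (x ∷ʷ w) ≡ b ∷ vs w
  step-vs (pl _) w = refl
  step-vs (fw _ _ _) w = refl
  step-vs (bw _ _ _) w = refl

  walk-adj : ∀ {a b} (w : Walk a b) i → Adj (lookup (a ∷ vs w) (inject₁ i)) (lookup (vs w) i)
  walk-adj (x ∷ʷ w) rewrite step-vs x w = λ { Fin.zero → step-adj x ; (Fin.suc i) → walk-adj w i }

  walk-end : ∀ {a b} (w : Walk a b) → lookup (a ∷ vs w) (fromℕ (length (vs w))) ≡ b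
  walk-end [] = refl
  walk-end (x ∷ʷ w) rewrite step-vs x w = walk-end w

  -- A walk to and fro along one edge is closed as well. Two states exist for m ≥ 1, and each has
  -- two words, which leaves room for three different vertices.
  length-vs : 3 ≤ length (vs walk)
  length-vs = three (vs walk) (λ p → O≢I (proj₂ (vtx-inj s₁ s₁ p)))
    (λ p → s₁≢s₂ (proj₁ (vtx-inj s₁ s₂ p))) (λ p → s₁≢s₂ (proj₁ (vtx-inj s₁ s₂ p)))
    (on s₁ size₁ O) (on s₁ size₁ I) (on s₂ (cong suc (trans (+-identityʳ _) (sz-pairs m′))) O)
    where
    s₁ s₂ : St
    s₁ = top (pairs m)
    s₂ = ⌈ ε ▷ ε ⌉ ∥ pairs m′ ∷ []
    s₁≢s₂ : s₁ ≢ s₂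
    s₁≢s₂ ()
    size₁ : size s₁ ≡ m
    size₁ = trans (+-identityʳ _) (sz-pairs m)
    on : ∀ s → size s ≡ m → ∀ c → vtx s c ∈ vs walk
    on s e c = complete (band (trans (total p) (cong (suc ∘ dbl) e)) (≤-trans (low p) (+-monoʳ-≤ _ (s≤s z≤n)))
      (≤-trans (high p) (+-monoʳ-≤ _ (s≤s z≤n))))
      where p = vtx-band s c

  toVec : V → Vec Bool (suc (2 * m))
  toVec = vec (suc (2 * m))

  toList-toVec : ∀ {x} → length x ≡ suc (2 * m) → toList (toVec x) ≡ x
  toList-toVec {x} p = subst (λ n → toList (vec n x) ≡ x) p (toList-vec x)

  Adj-toVec : ∀ {x y} → length x ≡ suc (2 * m) → Adj x y → Adjacent (toVec x) (toVec y)
  Adj-toVec {x} {y} p q = subst (λ n → Adjacent (vec n x) (vec n y)) p (Adj-vec q)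

  build : ∀ b xs → (∀ i → Adj (lookup (b ∷ xs) (inject₁ i)) (lookup xs i)) → Adj (lookup (b ∷ xs) (fromℕ (length xs))) b →
          Unique (b ∷ xs) → (∀ {v} → v ∈ b ∷ xs → Band m λ′ v) → (∀ {v} → Band m λ′ v → v ∈ b ∷ xs) → 3 ≤ length (b ∷ xs) →
          HamiltonCycle (MiddleLevels m (suc λ′))
  build b xs@(_ ∷ _ ∷ zs) next back uniq sound complete _ = record
    { k = length zs
    ; cyc = λ i → toVec (lookup (b ∷ xs) i)
    ; inP = λ i → Band⇒Levels (toVec (lookup (b ∷ xs) i)) (subst (Band m λ′) (sym (toList-toVec (len i))) (sound (∈-lookup i)))
    ; injective = λ i j p → lookup-injective uniq i j
        (trans (sym (toList-toVec (len i))) (trans (cong toList p) (toList-toVec (len j))))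
    ; covers = λ x p → let q = complete (Levels⇒Band x p) in
        Any.index q , trans (cong toVec (sym (lookup-index q))) (vec-toList x)
    ; step = λ i → Adj-toVec (len (inject₁ i)) (next i)
    ; close = Adj-toVec (len (fromℕ (length xs))) back }
    where
    len : ∀ i → length (lookup (b ∷ xs) i) ≡ suc (2 * m)
    len i = trans (Band-length (sound (∈-lookup i))) (cong suc (sym (2*≡dbl m)))
  build b [] _ _ _ _ _ (s≤s ())
  build b (_ ∷ []) _ _ _ _ _ (s≤s (s≤s ()))

  -- The list `vs w` starts with the end of the first step and ends with the start of the walk, so
  -- the first step of the walk becomes the closing edge.
  close-up : ∀ {a} (w : Walk a a) → Unique (vs w) → (∀ {v} → v ∈ vs w → Band m λ′ v) → (∀ {v} → Band m λ′ v → v ∈ vs w) →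
             3 ≤ length (vs w) → HamiltonCycle (MiddleLevels m (suc λ′))
  close-up (_∷ʷ_ {b = b} x w) rewrite step-vs x w =
    build b (vs w) (walk-adj w) (subst (λ z → Adj z b) (sym (walk-end w)) (step-adj x))

  cycle : HamiltonCycle (MiddleLevels m (suc λ′))
  cycle = close-up walk unique sound complete length-vs

theorem1 : (m ℓ : ℕ) → 1 ≤ m → 1 ≤ ℓ → ℓ ≤ m + 1 →
    HamiltonCycle (MiddleLevels m ℓ)
theorem1 (suc m) (suc zero) _ _ _ = Traverse.cycle _ _ _ (midHam (suc m))
-- The middle 2ℓ levels are B(m,λ) with λ = ℓ - 1, and `bandHam μ` is the case λ = μ + 1.
theorem1 (suc m) (suc (suc μ)) _ _ _ = Traverse.cycle _ _ _ (bandHam μ m)
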